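{- Let $r,t$ be positive integers. Then there exists a polynomial $g$ such that every graph $G$ containing no induced subgraph isomorphic to a subdivision of $K_{r,t}$ has average degree at most $g(\omega(G))$.
   Context: A subdivision of a graph $H$ is any graph obtained from $H$ by replacing edges by (possibly) longer paths. $\omega(G)$ is the clique number of $G$. -}

module Defs where

open import Data.Nat using (ℕ; zero; suc; _+_; _*_; _≤_)
open import Data.Bool using (Bool; true; false)
open import Data.Fin using (Fin; zero; suc)
open import Data.Fin.Subset using (Subset; _∈_; ∣_∣)
open import Data.Vec using (tabulate; sum)
open import Data.List using (List; []; _∷_)
open import Data.Maybe using (Maybe; just; nothing)
import Data.Maybe as Maybe
open import Data.Product using (Σ; _×_; _,_; ∃)
open import Data.Sum using (_⊎_; inj₁; inj₂)
open import Function using (Injective)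
open import Relation.Binary.PropositionalEquality using (_≡_; _≢_)
open import Relation.Nullary using (¬_)

record Graph : Set where
  field
    n     : ℕ
    adj   : Fin n → Fin n → Bool
    sym   : ∀ i j → adj i j ≡ adj j i
    loopless : ∀ i → adj i i ≡ false
open Graph public

Adj : (G : Graph) → Fin (n G) → Fin (n G) → Set
Adj G i j = adj G i j ≡ true

degree : (G : Graph) → Fin (n G) → ℕ
degree G i = ∣ tabulate (adj G i) ∣

degreeSum : Graph → ℕ
degreeSum G = sum (tabulate (degree G))

IsClique : (G : Graph) → Subset (n G) → Set
IsClique G s = ∀ i j → i ∈ s → j ∈ s → i ≢ j → Adj G i j

IsCliqueNumber : Graph → ℕ → Set
IsCliqueNumber G w =
  Σ (Subset (n G)) (λ s → IsClique G s × ∣ s ∣ ≡ w)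
  × (∀ s → IsClique G s → ∣ s ∣ ≤ w)

-- Subdivision of K_{r,t}: each edge (i,j) is replaced by a path with
-- len i j ≥ 0 internal vertices.
SubdivV : (r t : ℕ) → (Fin r → Fin t → ℕ) → Set
SubdivV r t len = Fin r ⊎ (Fin t ⊎ Σ (Fin r × Fin t) (λ { (i , j) → Fin (len i j) }))

lowerM : (ℓ : ℕ) → Fin (suc ℓ) → Maybe (Fin ℓ)
lowerM zero zero = nothing
lowerM (suc ℓ) zero = just zero
lowerM (suc ℓ) (suc k) = Maybe.map suc (lowerM ℓ k)

pathVertex : ∀ {r t} (len : Fin r → Fin t → ℕ) (i : Fin r) (j : Fin t) →
             Fin (suc (suc (len i j))) → SubdivV r t len
pathVertex len i j zero = inj₁ i
pathVertex len i j (suc k) with lowerM (len i j) k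
... | just m  = inj₂ (inj₂ ((i , j) , m))
... | nothing = inj₂ (inj₁ j)

Step : ∀ {r t} (len : Fin r → Fin t → ℕ) → SubdivV r t len → SubdivV r t len → Set
Step {r} {t} len x y =
  Σ (Fin r) λ i → Σ (Fin t) λ j → Σ (Fin (suc (len i j))) λ k →
    (x ≡ pathVertex len i j (Data.Fin.inject₁ k)) × (y ≡ pathVertex len i j (suc k))

SubdivAdj : ∀ {r t} (len : Fin r → Fin t → ℕ) → SubdivV r t len → SubdivV r t len → Set
SubdivAdj len x y = Step len x y ⊎ Step len y x

InducedCopy : (r t : ℕ) (len : Fin r → Fin t → ℕ) (G : Graph) → Set
InducedCopy r t len G =
  Σ (SubdivV r t len → Fin (n G)) λ f →
    Injective _≡_ _≡_ f ×
    (∀ x y → SubdivAdj len x y → Adj G (f x) (f y)) ×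
    (∀ x y → Adj G (f x) (f y) → SubdivAdj len x y)

HasInducedSubdivision : (r t : ℕ) → Graph → Set
HasInducedSubdivision r t G = Σ (Fin r → Fin t → ℕ) λ len → InducedCopy r t len G

Poly : Set
Poly = List ℕ

eval : Poly → ℕ → ℕ
eval [] x = 0
eval (c ∷ cs) x = c + x * eval cs x

{-# OPTIONS --safe #-}
module Submission where

-- Let h = r + t. By Ramsey's theorem every set of (ω + 2)^h vertices contains an independent h-set,
-- so excluding an induced K_{r,t} gives a Kővári–Sós–Turán bound: for a large set X, few vertices
-- see a fixed fraction of X. Suppose the degeneracy exceeds a large polynomial in ω, and take a
-- core of largest minimum degree. Deleting vertices of small degree yields one of two structures:
--   * unbalanced: sets A, B such that vertices of A have bounded degree, while those of B have
--     many neighbours in A; then paths u – a – v with u, v ∈ B and a ∈ A are used as connections;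
--   * regular: all degrees agree up to a constant factor; then paths b – y – y′ – b′ are used.
-- Keeping the possible end points independently with probability about 1 / degree, and then an
-- independent set of the conflict graph on the surviving paths, leaves an induced subdivision of
-- a graph of large average degree on the end points. That graph contains a subdivision of K_{r,t}
-- by Mader's theorem, and its image is an induced subdivision of K_{r,t}.

open import Defs hiding (n; sym; adj)
open import Data.Bool using (Bool; true; false; if_then_else_; _∧_; _∨_; not)
open import Data.Bool.Properties using (T-≡)
open import Data.Empty using (⊥; ⊥-elim)
open import Data.Fin using (Fin; zero; suc; inject₁)
import Data.Fin.Properties as Fᵖ
import Data.Fin.Subset as Ss
open import Data.List using (List; []; _∷_; length; allFin; _++_; [_]; take; map)
import Data.List as L
open import Data.List.Properties using (length-map; length-take; ++-assoc)
open import Data.List.Membership.Propositional using (_∈_; _∉_)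
open import Data.List.Membership.Propositional.Properties using (∈-allFin; ∈-lookup; ∈-map⁺; ∈-map⁻; ∈-++⁺ˡ; ∈-++⁺ʳ)
open import Data.List.Relation.Unary.Any using (here; there)
open import Data.List.Relation.Unary.All as All using (All; []; _∷_)
open import Data.List.Relation.Unary.AllPairs using (AllPairs; []; _∷_)
open import Data.List.Relation.Unary.Unique.Propositional using (Unique)
import Data.List.Relation.Unary.Unique.Propositional.Properties as Uᵖ
open import Data.Maybe as Maybe using (Maybe; just; nothing; maybe)
open import Data.Nat using (ℕ; zero; suc; _+_; _*_; _^_; _≤_; _<_; z≤n; s≤s; s≤s⁻¹; _≤ᵇ_; _≤?_; _<?_; pred; >-nonZero; NonZero)
open import Data.Nat.Properties hiding (eq?)
open import Data.Nat.Tactic.RingSolver using (solve-∀)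
open import Data.Product using (Σ; _×_; _,_; ∃; proj₁; proj₂)
open import Data.Sum using (_⊎_; inj₁; inj₂)
open import Data.Unit using (⊤)
open import Data.Vec using (Vec; []; _∷_; lookup; _[_]≔_)
import Data.Vec as Vec
open import Data.Vec.Properties using (lookup∘update′)
open import Function using (_∘_; Equivalence; Injective)
open import Relation.Binary.PropositionalEquality hiding (J; [_])
open import Relation.Nullary using (¬_; Dec; yes; no; contradiction)
open import Relation.Nullary.Decidable using (⌊_⌋)

-- Booleans

private variable
  𝒜 ℬ : Set

t≢f : {p : Bool} → p ≡ true → p ≡ false → ⊥
t≢f refl ()

¬t⇒f : {p : Bool} → ¬ p ≡ true → p ≡ false
¬t⇒f {true} h = ⊥-elim (h refl)
¬t⇒f {false} h = refl

bool? : (p : Bool) → p ≡ true ⊎ p ≡ false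
bool? true = inj₁ refl
bool? false = inj₂ refl

∧-t : {p q : Bool} → p ≡ true → q ≡ true → p ∧ q ≡ true
∧-t refl refl = refl

∧-t₁ : {p q : Bool} → p ∧ q ≡ true → p ≡ true
∧-t₁ {true} h = refl

∧-t₂ : {p q : Bool} → p ∧ q ≡ true → q ≡ true
∧-t₂ {true} h = h

∨-t₁ : {p q : Bool} → p ≡ true → p ∨ q ≡ true
∨-t₁ refl = refl

∨-t₂ : {p q : Bool} → q ≡ true → p ∨ q ≡ true
∨-t₂ {true} refl = refl
∨-t₂ {false} refl = refl

∨-case : {p q : Bool} → p ∨ q ≡ true → p ≡ true ⊎ q ≡ true
∨-case {true} h = inj₁ refl
∨-case {false} h = inj₂ h

not-t : {p : Bool} → p ≡ false → not p ≡ true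
not-t refl = refl

not-f : {p : Bool} → not p ≡ true → p ≡ false
not-f {false} h = refl

≤⇒≤ᵇ≡ : ∀ {m n} → m ≤ n → (m ≤ᵇ n) ≡ true
≤⇒≤ᵇ≡ h = Equivalence.to T-≡ (≤⇒≤ᵇ h)

≤ᵇ≡⇒≤ : ∀ {m n} → (m ≤ᵇ n) ≡ true → m ≤ n
≤ᵇ≡⇒≤ {m} {n} h = ≤ᵇ⇒≤ m n (Equivalence.from T-≡ h)

infix 7 _==_
_==_ : ∀ {n} → Fin n → Fin n → Bool
x == y = ⌊ x Fᵖ.≟ y ⌋

==⇒≡ : ∀ {n} {x y : Fin n} → x == y ≡ true → x ≡ y
==⇒≡ {x = x} {y} h with x Fᵖ.≟ y
... | yes e = e

==-refl : ∀ {n} (x : Fin n) → x == x ≡ true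
==-refl x with x Fᵖ.≟ x
... | yes _ = refl
... | no ne = ⊥-elim (ne refl)

≢⇒== : ∀ {n} {x y : Fin n} → x ≢ y → x == y ≡ false
≢⇒== ne = ¬t⇒f (ne ∘ ==⇒≡)

==-f : ∀ {n} {x y : Fin n} → x == y ≡ false → x ≢ y
==-f {x = x} h refl = t≢f (==-refl x) h

-- Sums and counts over lists

χ : Bool → ℕ
χ true = 1
χ false = 0

∑ : List 𝒜 → (𝒜 → ℕ) → ℕ
∑ [] f = 0
∑ (x ∷ xs) f = f x + ∑ xs f

# : List 𝒜 → (𝒜 → Bool) → ℕ
# xs p = ∑ xs (λ x → χ (p x))

sel : (𝒜 → Bool) → List 𝒜 → List 𝒜
sel p [] = []
sel p (x ∷ xs) = if p x then x ∷ sel p xs else sel p xs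

χ≤1 : ∀ p → χ p ≤ 1
χ≤1 true = ≤-refl
χ≤1 false = z≤n

χ*≤ : ∀ p m → χ p * m ≤ m
χ*≤ true m = ≤-reflexive (*-identityˡ m)
χ*≤ false m = z≤n

χ-mono : ∀ {p q} → (p ≡ true → q ≡ true) → χ p ≤ χ q
χ-mono {true} h rewrite h refl = ≤-refl
χ-mono {false} h = z≤n

χ-∧ : ∀ p q → χ (p ∧ q) ≡ χ p * χ q
χ-∧ true q = sym (+-identityʳ _)
χ-∧ false q = refl

χ-∨ : ∀ p q → χ (p ∨ q) ≤ χ p + χ q
χ-∨ true q = s≤s z≤n
χ-∨ false q = ≤-refl

χ-not : ∀ p → χ p + χ (not p) ≡ 1
χ-not true = refl
χ-not false = refl

∑-mono : (xs : List 𝒜) {f g : 𝒜 → ℕ} → (∀ {x} → x ∈ xs → f x ≤ g x) → ∑ xs f ≤ ∑ xs g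
∑-mono [] h = z≤n
∑-mono (x ∷ xs) h = +-mono-≤ (h (here refl)) (∑-mono xs (h ∘ there))

∑-cong : (xs : List 𝒜) {f g : 𝒜 → ℕ} → (∀ {x} → x ∈ xs → f x ≡ g x) → ∑ xs f ≡ ∑ xs g
∑-cong [] h = refl
∑-cong (x ∷ xs) h = cong₂ _+_ (h (here refl)) (∑-cong xs (h ∘ there))

+-interchange : ∀ a b c d → (a + b) + (c + d) ≡ (a + c) + (b + d)
+-interchange = solve-∀

∑-+ : (xs : List 𝒜) (f g : 𝒜 → ℕ) → ∑ xs (λ x → f x + g x) ≡ ∑ xs f + ∑ xs g
∑-+ [] f g = refl
∑-+ (x ∷ xs) f g = trans (cong (f x + g x +_) (∑-+ xs f g)) (+-interchange (f x) (g x) _ _)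

∑-*ˡ : (xs : List 𝒜) (c : ℕ) (f : 𝒜 → ℕ) → ∑ xs (λ x → c * f x) ≡ c * ∑ xs f
∑-*ˡ [] c f = sym (*-zeroʳ c)
∑-*ˡ (x ∷ xs) c f = trans (cong (c * f x +_) (∑-*ˡ xs c f)) (sym (*-distribˡ-+ c (f x) _))

∑-*ʳ : (xs : List 𝒜) (f : 𝒜 → ℕ) (c : ℕ) → ∑ xs (λ x → f x * c) ≡ ∑ xs f * c
∑-*ʳ xs f c = trans (∑-cong xs λ _ → *-comm _ c) (trans (∑-*ˡ xs c f) (*-comm c _))

∑-const : (xs : List 𝒜) (c : ℕ) → ∑ xs (λ _ → c) ≡ length xs * c
∑-const [] c = refl
∑-const (x ∷ xs) c = cong (c +_) (∑-const xs c)

∑-zero : (xs : List 𝒜) → ∑ xs (λ _ → 0) ≡ 0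
∑-zero xs = trans (∑-const xs 0) (*-zeroʳ (length xs))

∑-swap : (xs : List 𝒜) (ys : List ℬ) (f : 𝒜 → ℬ → ℕ) →
         ∑ xs (λ x → ∑ ys (f x)) ≡ ∑ ys (λ y → ∑ xs (λ x → f x y))
∑-swap [] ys f = sym (∑-zero ys)
∑-swap (x ∷ xs) ys f = trans (cong (∑ ys (f x) +_) (∑-swap xs ys f)) (sym (∑-+ ys (f x) _))

∑-++ : (xs ys : List 𝒜) (f : 𝒜 → ℕ) → ∑ (xs ++ ys) f ≡ ∑ xs f + ∑ ys f
∑-++ [] ys f = refl
∑-++ (x ∷ xs) ys f = trans (cong (f x +_) (∑-++ xs ys f)) (sym (+-assoc (f x) _ _))

∑≤ : (xs : List 𝒜) {f : 𝒜 → ℕ} (c : ℕ) → (∀ {x} → x ∈ xs → f x ≤ c) → ∑ xs f ≤ length xs * c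
∑≤ xs c h = ≤-trans (∑-mono xs h) (≤-reflexive (∑-const xs c))

∑≥ : (xs : List 𝒜) {f : 𝒜 → ℕ} (c : ℕ) → (∀ {x} → x ∈ xs → c ≤ f x) → length xs * c ≤ ∑ xs f
∑≥ xs c h = ≤-trans (≤-reflexive (sym (∑-const xs c))) (∑-mono xs h)

∑-∈ : (xs : List 𝒜) (f : 𝒜 → ℕ) {x : 𝒜} → x ∈ xs → f x ≤ ∑ xs f
∑-∈ (_ ∷ xs) f (here refl) = m≤m+n _ _
∑-∈ (y ∷ xs) f (there h) = ≤-trans (∑-∈ xs f h) (m≤n+m _ (f y))

∑-find : (xs : List 𝒜) (f g : 𝒜 → ℕ) → ∑ xs f < ∑ xs g → ∃ λ x → x ∈ xs × f x < g x
∑-find (x ∷ xs) f g h with f x <? g x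
... | yes lt = x , here refl , lt
... | no ≥x with ∑-find xs f g (≰⇒> λ le → <⇒≱ h (+-mono-≤ (≮⇒≥ ≥x) le))
... | y , y∈ , lt = y , there y∈ , lt

∑-take≤ : (k : ℕ) (xs : List 𝒜) (f : 𝒜 → ℕ) → ∑ (take k xs) f ≤ ∑ xs f
∑-take≤ zero xs f = z≤n
∑-take≤ (suc k) [] f = z≤n
∑-take≤ (suc k) (x ∷ xs) f = +-monoʳ-≤ (f x) (∑-take≤ k xs f)

∈-take : (k : ℕ) (xs : List 𝒜) {x : 𝒜} → x ∈ take k xs → x ∈ xs
∈-take (suc k) (y ∷ xs) (here e) = here e
∈-take (suc k) (y ∷ xs) (there h) = there (∈-take k xs h)

∑-sel : (p : 𝒜 → Bool) (xs : List 𝒜) (f : 𝒜 → ℕ) → ∑ (sel p xs) f ≡ ∑ xs (λ x → χ (p x) * f x)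
∑-sel p [] f = refl
∑-sel p (x ∷ xs) f with p x
... | true = cong₂ _+_ (sym (+-identityʳ _)) (∑-sel p xs f)
... | false = ∑-sel p xs f

length≡∑ : (xs : List 𝒜) → length xs ≡ ∑ xs (λ _ → 1)
length≡∑ xs = sym (trans (∑-const xs 1) (*-identityʳ _))

length-sel : (p : 𝒜 → Bool) (xs : List 𝒜) → length (sel p xs) ≡ # xs p
length-sel p xs = trans (length≡∑ (sel p xs)) (trans (∑-sel p xs _) (∑-cong xs λ _ → *-identityʳ _))

∈-sel⁻ : (p : 𝒜 → Bool) (xs : List 𝒜) {x : 𝒜} → x ∈ sel p xs → x ∈ xs × p x ≡ true
∈-sel⁻ p (y ∷ xs) h with p y in eq
∈-sel⁻ p (y ∷ xs) (here refl) | true = here refl , eq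
∈-sel⁻ p (y ∷ xs) (there h) | true = there (proj₁ (∈-sel⁻ p xs h)) , proj₂ (∈-sel⁻ p xs h)
... | false = there (proj₁ (∈-sel⁻ p xs h)) , proj₂ (∈-sel⁻ p xs h)

∈-sel⁺ : (p : 𝒜 → Bool) (xs : List 𝒜) {x : 𝒜} → x ∈ xs → p x ≡ true → x ∈ sel p xs
∈-sel⁺ p (y ∷ xs) (here refl) px rewrite px = here refl
∈-sel⁺ p (y ∷ xs) (there h) px with p y
... | true = there (∈-sel⁺ p xs h px)
... | false = ∈-sel⁺ p xs h px

sel-All : (p : 𝒜 → Bool) {xs : List 𝒜} {P : 𝒜 → Set} → All P xs → All P (sel p xs)
sel-All p [] = []
sel-All p {x ∷ xs} (h ∷ hs) with p x
... | true = h ∷ sel-All p hs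
... | false = sel-All p hs

sel-unique : (p : 𝒜 → Bool) {xs : List 𝒜} → Unique xs → Unique (sel p xs)
sel-unique p [] = []
sel-unique p {x ∷ xs} (h ∷ hs) with p x
... | true = sel-All p h ∷ sel-unique p hs
... | false = sel-unique p hs

#-mono : (xs : List 𝒜) {p q : 𝒜 → Bool} → (∀ {x} → x ∈ xs → p x ≡ true → q x ≡ true) → # xs p ≤ # xs q
#-mono xs h = ∑-mono xs λ x∈ → χ-mono (h x∈)

#-∨ : (xs : List 𝒜) (p q : 𝒜 → Bool) → # xs (λ x → p x ∨ q x) ≤ # xs p + # xs q
#-∨ xs p q = ≤-trans (∑-mono xs λ {x} _ → χ-∨ (p x) (q x)) (≤-reflexive (∑-+ xs _ _))

#≤length : (xs : List 𝒜) (p : 𝒜 → Bool) → # xs p ≤ length xs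
#≤length xs p = ≤-trans (∑≤ xs 1 λ _ → χ≤1 _) (≤-reflexive (*-identityʳ _))

#-sel : (p : 𝒜 → Bool) (xs : List 𝒜) (q : 𝒜 → Bool) → # (sel p xs) q ≡ # xs (λ x → p x ∧ q x)
#-sel p xs q = trans (∑-sel p xs _) (∑-cong xs λ {x} _ → sym (χ-∧ (p x) (q x)))

#-compl : (xs : List 𝒜) (p : 𝒜 → Bool) → # xs p + # xs (not ∘ p) ≡ length xs
#-compl xs p = trans (sym (∑-+ xs _ _)) (trans (∑-cong xs λ {x} _ → χ-not (p x)) (sym (length≡∑ xs)))

#≡0 : (xs : List 𝒜) (p : 𝒜 → Bool) → # xs p ≡ 0 → ∀ {x} → x ∈ xs → p x ≡ false
#≡0 xs p h {x} x∈ = ¬t⇒f λ px → contradiction (≤-trans (≤-reflexive (cong χ (sym px))) (≤-trans (∑-∈ xs (χ ∘ p) x∈) (≤-reflexive h))) λ ()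

sel-⊆-mono : (p : 𝒜 → Bool) (xs : List 𝒜) (f : 𝒜 → ℕ) → ∑ (sel p xs) f ≤ ∑ xs f
sel-⊆-mono p xs f = ≤-trans (≤-reflexive (∑-sel p xs f))
  (∑-mono xs λ {x} _ → ≤-trans (*-monoˡ-≤ (f x) (χ≤1 (p x))) (≤-reflexive (*-identityˡ _)))

member⇒0< : {xs : List 𝒜} {x : 𝒜} → x ∈ xs → 0 < length xs
member⇒0< (here _) = s≤s z≤n
member⇒0< (there _) = s≤s z≤n

0<⇒member : (xs : List 𝒜) → 0 < length xs → ∃ λ x → x ∈ xs
0<⇒member (x ∷ xs) _ = x , here refl

-- Dependent products of lists

infixr 6 _⊗_
_⊗_ : List 𝒜 → (𝒜 → List ℬ) → List (𝒜 × ℬ)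
[] ⊗ ys = []
(x ∷ xs) ⊗ ys = map (x ,_) (ys x) ++ xs ⊗ ys

∑-map : (g : 𝒜 → ℬ) (xs : List 𝒜) (f : ℬ → ℕ) → ∑ (map g xs) f ≡ ∑ xs (f ∘ g)
∑-map g [] f = refl
∑-map g (x ∷ xs) f = cong (f (g x) +_) (∑-map g xs f)

∑-⊗ : (xs : List 𝒜) (ys : 𝒜 → List ℬ) (f : 𝒜 × ℬ → ℕ) →
      ∑ (xs ⊗ ys) f ≡ ∑ xs (λ x → ∑ (ys x) (λ y → f (x , y)))
∑-⊗ [] ys f = refl
∑-⊗ (x ∷ xs) ys f = trans (∑-++ (map (x ,_) (ys x)) (xs ⊗ ys) f)
  (cong₂ _+_ (∑-map (x ,_) (ys x) f) (∑-⊗ xs ys f))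

length-⊗ : (xs : List 𝒜) (ys : 𝒜 → List ℬ) → length (xs ⊗ ys) ≡ ∑ xs (λ x → length (ys x))
length-⊗ xs ys = trans (length≡∑ (xs ⊗ ys)) (trans (∑-⊗ xs ys _) (∑-cong xs λ {x} _ → sym (length≡∑ (ys x))))

∈-map-pair : {x : 𝒜} (ys : List ℬ) {z : 𝒜 × ℬ} → z ∈ map (x ,_) ys → proj₁ z ≡ x × proj₂ z ∈ ys
∈-map-pair (y ∷ ys) (here refl) = refl , here refl
∈-map-pair (y ∷ ys) (there h) = proj₁ (∈-map-pair ys h) , there (proj₂ (∈-map-pair ys h))

∈-++-case : (xs : List 𝒜) {ys : List 𝒜} {z : 𝒜} → z ∈ xs ++ ys → z ∈ xs ⊎ z ∈ ys
∈-++-case [] h = inj₂ h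
∈-++-case (x ∷ xs) (here e) = inj₁ (here e)
∈-++-case (x ∷ xs) (there h) with ∈-++-case xs h
... | inj₁ k = inj₁ (there k)
... | inj₂ k = inj₂ k

∈-⊗⁻ : (xs : List 𝒜) (ys : 𝒜 → List ℬ) {z : 𝒜 × ℬ} → z ∈ xs ⊗ ys → proj₁ z ∈ xs × proj₂ z ∈ ys (proj₁ z)
∈-⊗⁻ (x ∷ xs) ys h with ∈-++-case (map (x ,_) (ys x)) h
... | inj₁ k = here (proj₁ (∈-map-pair (ys x) k)) ,
               subst (λ v → _ ∈ ys v) (sym (proj₁ (∈-map-pair (ys x) k))) (proj₂ (∈-map-pair (ys x) k))
... | inj₂ k = there (proj₁ (∈-⊗⁻ xs ys k)) , proj₂ (∈-⊗⁻ xs ys k)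

-- Removing one vertex from a duplicate-free list of vertices

infixl 7 _∖_
_∖_ : ∀ {n} → List (Fin n) → Fin n → List (Fin n)
xs ∖ v = sel (λ x → not (x == v)) xs

∖-notin : ∀ {n} (xs : List (Fin n)) {v : Fin n} → All (v ≢_) xs → xs ∖ v ≡ xs
∖-notin [] [] = refl
∖-notin (x ∷ xs) {v} (ne ∷ h) rewrite ≢⇒== (ne ∘ sym) = cong (x ∷_) (∖-notin xs h)

∑-∖ : ∀ {n} {xs : List (Fin n)} {v : Fin n} (f : Fin n → ℕ) → Unique xs → v ∈ xs →
      ∑ xs f ≡ f v + ∑ (xs ∖ v) f
∑-∖ {xs = x ∷ xs} f (h ∷ u) (here refl) rewrite ==-refl x | ∖-notin xs h = refl
∑-∖ {xs = x ∷ xs} {v} f (h ∷ u) (there v∈) rewrite ≢⇒== (All.lookup h v∈) =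
  trans (cong (f x +_) (∑-∖ f u v∈)) (lem (f x) (f v) _)
  where lem : ∀ a b c → a + (b + c) ≡ b + (a + c)
        lem = solve-∀

length-∖ : ∀ {n} {xs : List (Fin n)} {v : Fin n} → Unique xs → v ∈ xs → length xs ≡ suc (length (xs ∖ v))
length-∖ {xs = xs} {v} u v∈ = trans (length≡∑ xs) (trans (∑-∖ (λ _ → 1) u v∈) (cong suc (sym (length≡∑ (xs ∖ v)))))

∑-point : ∀ {n} {xs : List (Fin n)} (v : Fin n) (f : Fin n → ℕ) → Unique xs →
          ∑ xs (λ x → χ (x == v) * f x) ≤ f v
∑-point {xs = []} v f u = z≤n
∑-point {xs = x ∷ xs} v f (h ∷ u) with x Fᵖ.≟ v
... | no _ = ∑-point v f u
... | yes refl = ≤-trans (≤-reflexive (cong₂ _+_ (*-identityˡ (f x)) (trans (∑-cong xs λ y∈ → cong (λ b → χ b * f _) (≢⇒== (λ e → All.lookup h y∈ (sym e)))) (∑-zero xs)))) (≤-reflexive (+-identityʳ _))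

#-point : ∀ {n} {xs : List (Fin n)} (v : Fin n) → Unique xs → # xs (_== v) ≤ 1
#-point {xs = xs} v u = ≤-trans (≤-reflexive (∑-cong xs λ _ → sym (*-identityʳ _))) (∑-point v (λ _ → 1) u)

-- Random subsets

-- The expectation of f over a random subset containing each point independently with
-- probability 1 / (1 + q), multiplied by (1 + q) ^ n.
Ex : ℕ → (n : ℕ) → (Vec Bool n → ℕ) → ℕ
Ex q zero f = f []
Ex q (suc n) f = Ex q n (λ S → f (true ∷ S)) + q * Ex q n (λ S → f (false ∷ S))

Ex-mono : ∀ q n {f g : Vec Bool n → ℕ} → (∀ S → f S ≤ g S) → Ex q n f ≤ Ex q n g
Ex-mono q zero h = h []
Ex-mono q (suc n) h = +-mono-≤ (Ex-mono q n λ _ → h _) (*-monoʳ-≤ q (Ex-mono q n λ _ → h _))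

Ex-cong : ∀ q n {f g : Vec Bool n → ℕ} → (∀ S → f S ≡ g S) → Ex q n f ≡ Ex q n g
Ex-cong q n h = ≤-antisym (Ex-mono q n λ S → ≤-reflexive (h S)) (Ex-mono q n λ S → ≤-reflexive (sym (h S)))

Ex-zero : ∀ q n → Ex q n (λ _ → 0) ≡ 0
Ex-zero q zero = refl
Ex-zero q (suc n) rewrite Ex-zero q n = *-zeroʳ q

Ex-+ : ∀ q n (f g : Vec Bool n → ℕ) → Ex q n (λ S → f S + g S) ≡ Ex q n f + Ex q n g
Ex-+ q zero f g = refl
Ex-+ q (suc n) f g
  rewrite Ex-+ q n (λ S → f (true ∷ S)) (λ S → g (true ∷ S))
        | Ex-+ q n (λ S → f (false ∷ S)) (λ S → g (false ∷ S)) = lem q (Ex q n λ S → f (true ∷ S)) (Ex q n λ S → g (true ∷ S)) (Ex q n λ S → f (false ∷ S)) (Ex q n λ S → g (false ∷ S))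
  where lem : ∀ q a b c d → (a + b) + q * (c + d) ≡ (a + q * c) + (b + q * d)
        lem = solve-∀

Ex-* : ∀ q n c (f : Vec Bool n → ℕ) → Ex q n (λ S → c * f S) ≡ c * Ex q n f
Ex-* q zero c f = refl
Ex-* q (suc n) c f
  rewrite Ex-* q n c (λ S → f (true ∷ S)) | Ex-* q n c (λ S → f (false ∷ S)) = lem q c _ _
  where lem : ∀ q c a b → c * a + q * (c * b) ≡ c * (a + q * b)
        lem = solve-∀

Ex-∑ : ∀ {A : Set} q n (xs : List A) (f : A → Vec Bool n → ℕ) →
       Ex q n (λ S → ∑ xs (λ x → f x S)) ≡ ∑ xs (λ x → Ex q n (f x))
Ex-∑ q n [] f = Ex-zero q n
Ex-∑ q n (x ∷ xs) f = trans (Ex-+ q n (f x) _) (cong (Ex q n (f x) +_) (Ex-∑ q n xs f))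

Ex-find : ∀ q n (f g : Vec Bool n → ℕ) → Ex q n f < Ex q n g → ∃ λ S → f S < g S
Ex-find q zero f g h = [] , h
Ex-find q (suc n) f g h with Ex q n (λ S → f (true ∷ S)) <? Ex q n (λ S → g (true ∷ S))
... | yes lt with Ex-find q n _ _ lt
...   | S , p = true ∷ S , p
Ex-find q (suc n) f g h | no ≥t with Ex q n (λ S → f (false ∷ S)) <? Ex q n (λ S → g (false ∷ S))
... | yes lt with Ex-find q n _ _ lt
...   | S , p = false ∷ S , p
Ex-find q (suc n) f g h | no ≥t | no ≥f = contradiction h (≤⇒≯ (+-mono-≤ (≮⇒≥ ≥t) (*-monoʳ-≤ q (≮⇒≥ ≥f))))

Ex-pos : ∀ q n → 0 < Ex q n (λ _ → 1)
Ex-pos q zero = s≤s z≤n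
Ex-pos q (suc n) = ≤-trans (Ex-pos q n) (m≤m+n _ _)

Ex-indep : ∀ q n (x : Fin n) (f : Vec Bool n → ℕ) → (∀ S p → f (S [ x ]≔ p) ≡ f S) →
           suc q * Ex q n (λ S → χ (lookup S x) * f S) ≡ Ex q n f
Ex-indep q (suc n) zero f h
  rewrite Ex-zero q n | Ex-cong q n {λ S → f (true ∷ S) + 0} {λ S → f (true ∷ S)} (λ S → +-identityʳ _)
        | Ex-cong q n {λ S → f (true ∷ S)} {λ S → f (false ∷ S)} (λ S → h (false ∷ S) true) = lem q _
  where lem : ∀ q a → suc q * (a + q * 0) ≡ a + q * a
        lem = solve-∀
Ex-indep q (suc n) (suc x) f h = trans (lem q _ _)
  (cong₂ (λ a b → a + q * b) (Ex-indep q n x (λ S → f (true ∷ S)) λ S p → h (true ∷ S) p)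
                             (Ex-indep q n x (λ S → f (false ∷ S)) λ S p → h (false ∷ S) p))
  where lem : ∀ q a b → suc q * (a + q * b) ≡ suc q * a + q * (suc q * b)
        lem = solve-∀

allIn : ∀ {n} → List (Fin n) → Vec Bool n → ℕ
allIn [] S = 1
allIn (x ∷ xs) S = χ (lookup S x) * allIn xs S

allIn-update : ∀ {n} (xs : List (Fin n)) (x : Fin n) → All (x ≢_) xs → ∀ S p → allIn xs (S [ x ]≔ p) ≡ allIn xs S
allIn-update [] x [] S p = refl
allIn-update (y ∷ ys) x (ne ∷ h) S p =
  cong₂ (λ a b → χ a * b) (lookup∘update′ (ne ∘ sym) S p) (allIn-update ys x h S p)

Ex-allIn : ∀ q n {xs : List (Fin n)} → Unique xs → suc q ^ length xs * Ex q n (allIn xs) ≡ Ex q n (λ _ → 1)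
Ex-allIn q n [] = +-identityʳ _
Ex-allIn q n {x ∷ xs} (h ∷ u) =
  trans (lem (suc q) (suc q ^ length xs) _)
    (trans (cong (suc q ^ length xs *_) (Ex-indep q n x (allIn xs) (allIn-update xs x h))) (Ex-allIn q n u))
  where lem : ∀ a b c → a * b * c ≡ b * (a * c)
        lem = solve-∀

-- Independent sets in digraphs of bounded out-degree

Apart : {A : Set} → (A → A → Bool) → A → A → Set
Apart con x y = con x y ≡ false × con y x ≡ false

-- Some x has at most k in-neighbours, since the average in-degree equals the average out-degree.
independent : {A : Set} (con : A → A → Bool) (k : ℕ) (fuel : ℕ) (xs : List A) → length xs ≤ fuel →
  (∀ x → con x x ≡ true) → (∀ {x} → x ∈ xs → # xs (con x) ≤ k) →
  ∃ λ ys → AllPairs (Apart con) ys × (∀ {y} → y ∈ ys → y ∈ xs) × length xs ≤ 2 * k * length ys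
independent con k fuel [] _ _ _ = [] , [] , (λ ()) , z≤n
independent con k (suc fuel) xs@(x₀ ∷ xs₀) le rf out = x ∷ ys , All.tabulate apart ∷ ap , sub , bound
  where
  in≤ : ∑ xs (λ x → # xs (λ y → con y x)) < ∑ xs (λ _ → suc k)
  in≤ = begin-strict
    ∑ xs (λ x → # xs (λ y → con y x)) ≡⟨ ∑-swap xs xs _ ⟩
    ∑ xs (λ y → # xs (con y)) ≤⟨ ∑≤ xs k out ⟩
    length xs * k <⟨ *-monoʳ-< (length xs) (n<1+n k) ⟩
    length xs * suc k ≡⟨ ∑-const xs (suc k) ⟨
    ∑ xs (λ _ → suc k) ∎
    where open ≤-Reasoning
  found = ∑-find xs (λ x → # xs (λ y → con y x)) (λ _ → suc k) in≤
  x = proj₁ found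
  x∈ : x ∈ xs
  x∈ = proj₁ (proj₂ found)
  hit : _ → Bool
  hit y = con x y ∨ con y x
  rest = sel (not ∘ hit) xs
  hits≤ : # xs hit ≤ 2 * k
  hits≤ = ≤-trans (#-∨ xs (con x) (λ y → con y x))
    (≤-trans (+-mono-≤ (out x∈) (s≤s⁻¹ (proj₂ (proj₂ found)))) (≤-reflexive (cong (k +_) (sym (+-identityʳ k)))))
  len : # xs hit + length rest ≡ length xs
  len = trans (cong (# xs hit +_) (length-sel (not ∘ hit) xs)) (#-compl xs hit)
  hit-x : 1 ≤ # xs hit
  hit-x = ≤-trans (≤-reflexive (cong χ (sym (∨-t₁ {con x x} (rf x))))) (∑-∈ xs (χ ∘ hit) x∈)
  shorter : length rest ≤ fuel
  shorter = +-cancelˡ-≤ 1 _ _ (≤-trans (+-monoˡ-≤ _ hit-x) (≤-trans (≤-reflexive len) le))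
  rec = independent con k fuel rest shorter rf λ y∈ →
    ≤-trans (sel-⊆-mono (not ∘ hit) xs _) (out (proj₁ (∈-sel⁻ (not ∘ hit) xs y∈)))
  ys = proj₁ rec
  ap = proj₁ (proj₂ rec)
  sub′ = proj₁ (proj₂ (proj₂ rec))
  apart : ∀ {y} → y ∈ ys → Apart con x y
  apart {y} y∈ = split (con x y) (con y x) (not-f (proj₂ (∈-sel⁻ (not ∘ hit) xs (sub′ y∈))))
    where split : ∀ p q → p ∨ q ≡ false → p ≡ false × q ≡ false
          split false false _ = refl , refl
  sub : ∀ {y} → y ∈ x ∷ ys → y ∈ xs
  sub (here refl) = x∈
  sub (there h) = proj₁ (∈-sel⁻ (not ∘ hit) xs (sub′ h))
  bound : length xs ≤ 2 * k * length (x ∷ ys)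
  bound = begin
    length xs ≡⟨ len ⟨
    # xs hit + length rest ≤⟨ +-mono-≤ hits≤ (proj₂ (proj₂ (proj₂ rec))) ⟩
    2 * k + 2 * k * length ys ≡⟨ *-suc (2 * k) (length ys) ⟨
    2 * k * suc (length ys) ∎
    where open ≤-Reasoning

-- Selecting objects whose end points form a random subset

module Selection {X : Set} {n : ℕ} (Q k C : ℕ) (𝒯 : List X) (P : List (Fin n))
  (src dst : X → Fin n) (killed : X → Fin n → Bool) (con : X → X → Bool) where

  q : ℕ
  q = pred Q

  weight : X → Fin n → ℕ
  weight τ c = if (c == src τ) ∨ (c == dst τ) then Q else 1

  weight≤Q : 0 < Q → ∀ τ c → weight τ c ≤ Q
  weight≤Q 0<Q τ c with (c == src τ) ∨ (c == dst τ)
  ... | true = ≤-refl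
  ... | false = 0<Q

  weight≤ : ∀ τ c → weight τ c ≤ 1 + (χ (c == src τ) * Q + χ (c == dst τ) * Q)
  weight≤ τ c with c == src τ | c == dst τ
  ... | true | _ = ≤-trans (≤-reflexive (sym (*-identityˡ Q))) (≤-trans (m≤m+n _ _) (n≤1+n _))
  ... | false | true = ≤-trans (≤-reflexive (sym (*-identityˡ Q))) (n≤1+n _)
  ... | false | false = s≤s z≤n

  inner? : X → Fin n → Bool
  inner? τ x = not (x == src τ) ∧ not (x == dst τ)

  kill : X → List (Fin n)
  kill τ = sel (inner? τ) (sel (killed τ) P)

  record Selected : Set where
    field
      S : Vec Bool n
      I : List X
      I⊆ : ∀ {τ} → τ ∈ I → τ ∈ 𝒯
      src∈ : ∀ {τ} → τ ∈ I → lookup S (src τ) ≡ true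
      dst∈ : ∀ {τ} → τ ∈ I → lookup S (dst τ) ≡ true
      alive : ∀ {τ x} → τ ∈ I → x ∈ P → lookup S x ≡ true → killed τ x ≡ true → x ≡ src τ ⊎ x ≡ dst τ
      apart : AllPairs (Apart con) I
      dense : C * # P (lookup S) < length I

  module _ (0<k : 0 < k) (0<Q : 0 < Q)
    (distinct : ∀ {τ} → τ ∈ 𝒯 → src τ ≢ dst τ)
    (killed≤ : ∀ {τ} → τ ∈ 𝒯 → 4 * # P (killed τ) ≤ Q)
    (con-refl : ∀ τ → con τ τ ≡ true)
    (con≤ : ∀ {τ} → τ ∈ 𝒯 → 4 * ∑ 𝒯 (λ τ′ → χ (con τ τ′) * (weight τ (src τ′) * weight τ (dst τ′))) ≤ k * (Q * Q))
    (many : 4 * (C * k) * (length P * Q) < length 𝒯)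
    where

    kill≢ : ∀ {τ w} → w ∈ kill τ → w ≢ src τ × w ≢ dst τ
    kill≢ {τ} {w} h = ==-f (not-f (∧-t₁ p)) , ==-f (not-f (∧-t₂ {not (w == src τ)} p))
      where p = proj₂ (∈-sel⁻ (inner? τ) (sel (killed τ) P) h)

    kill≤ : ∀ {τ} → τ ∈ 𝒯 → 4 * length (kill τ) ≤ Q
    kill≤ {τ} τ∈ = ≤-trans (*-monoʳ-≤ 4 (≤-trans (≤-reflexive (length-sel (inner? τ) (sel (killed τ) P)))
      (≤-trans (#≤length (sel (killed τ) P) (inner? τ)) (≤-reflexive (length-sel (killed τ) P))))) (killed≤ τ∈)

    M : ℕ
    M = Ex q n (λ _ → 1)

    suc-q : suc q ≡ Q
    suc-q = suc-pred Q {{>-nonZero 0<Q}}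

    Ex-all : {xs : List (Fin n)} → Unique xs → Q ^ length xs * Ex q n (allIn xs) ≡ M
    Ex-all {xs} u = subst (λ z → z ^ length xs * Ex q n (allIn xs) ≡ M) suc-q (Ex-allIn q n u)

    Ex-one : ∀ p → Q * Ex q n (λ S → χ (lookup S p)) ≡ M
    Ex-one p = trans (cong (Q *_) (Ex-cong q n λ S → sym (*-identityʳ _)))
      (trans (cong (_* Ex q n (allIn (p ∷ []))) (sym (*-identityʳ Q))) (Ex-all ([] ∷ [])))

    ends : X → Vec Bool n → ℕ
    ends τ = allIn (src τ ∷ dst τ ∷ [])

    kills confs : X → Vec Bool n → ℕ
    kills τ S = ∑ (kill τ) (λ w → allIn (w ∷ src τ ∷ dst τ ∷ []) S)
    confs τ S = ∑ 𝒯 (λ τ′ → χ (con τ τ′) * (ends τ S * ends τ′ S))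

    uniq₂ : ∀ {τ} → τ ∈ 𝒯 → Unique (src τ ∷ dst τ ∷ [])
    uniq₂ τ∈ = (distinct τ∈ ∷ []) ∷ [] ∷ []

    Ex-ends : ∀ {τ} → τ ∈ 𝒯 → Q * Q * Ex q n (ends τ) ≡ M
    Ex-ends {τ} τ∈ = trans (cong (_* Ex q n (ends τ)) (lem Q)) (Ex-all (uniq₂ τ∈))
      where lem : ∀ a → a * a ≡ a * (a * 1)
            lem = solve-∀

    Ex-kills : ∀ {τ} → τ ∈ 𝒯 → Q * Q * Q * Ex q n (kills τ) ≡ length (kill τ) * M
    Ex-kills {τ} τ∈ = begin
      Q * Q * Q * Ex q n (kills τ) ≡⟨ cong (Q * Q * Q *_) (Ex-∑ q n (kill τ) _) ⟩
      Q * Q * Q * ∑ (kill τ) _ ≡⟨ ∑-*ˡ (kill τ) (Q * Q * Q) _ ⟨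
      ∑ (kill τ) (λ w → Q * Q * Q * Ex q n (allIn (w ∷ src τ ∷ dst τ ∷ []))) ≡⟨ ∑-cong (kill τ) (λ {w} w∈ →
          trans (cong (_* Ex q n (allIn (w ∷ src τ ∷ dst τ ∷ []))) (lem Q)) (Ex-all ((proj₁ (kill≢ {τ} w∈) ∷ proj₂ (kill≢ {τ} w∈) ∷ []) ∷ uniq₂ τ∈))) ⟩
      ∑ (kill τ) (λ _ → M) ≡⟨ ∑-const (kill τ) M ⟩
      length (kill τ) * M ∎
      where open ≡-Reasoning
            lem : ∀ a → a * a * a ≡ a * (a * (a * 1))
            lem = solve-∀

    four : ∀ p p′ r r′ → χ p * (χ p′ * 1) * (χ r * (χ r′ * 1)) ≤ χ r * (χ r′ * (χ p * (χ p′ * 1)))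
    four false p′ r r′ = z≤n
    four true false r r′ = z≤n
    four true true r r′ = ≤-reflexive (lem (χ r) (χ r′))
      where lem : ∀ a b → 1 * (1 * 1) * (a * (b * 1)) ≡ a * (b * (1 * (1 * 1)))
            lem = solve-∀

    Ex-conf : ∀ {τ τ′} → τ ∈ 𝒯 → τ′ ∈ 𝒯 →
      Q * Q * (Q * Q) * Ex q n (λ S → ends τ S * ends τ′ S) ≤ weight τ (src τ′) * weight τ (dst τ′) * M
    Ex-conf {τ} {τ′} τ∈ τ′∈ = conf-cases
      where
      fourS : ∀ S → ends τ S * ends τ′ S ≤ χ (lookup S (src τ′)) * (χ (lookup S (dst τ′)) * ends τ S)
      fourS S = four (lookup S (src τ)) (lookup S (dst τ)) (lookup S (src τ′)) (lookup S (dst τ′))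
      open ≤-Reasoning
      conf-cases : Q * Q * (Q * Q) * Ex q n (λ S → ends τ S * ends τ′ S) ≤ weight τ (src τ′) * weight τ (dst τ′) * M
      far : ∀ {x y z} → (x == y) ∨ (x == z) ≡ false → All (x ≢_) (y ∷ z ∷ [])
      far {x} {y} h = ==-f (¬t⇒f λ t → t≢f (∨-t₁ t) h) ∷ ==-f (¬t⇒f λ t → t≢f (∨-t₂ {x == y} t) h) ∷ []
      conf-cases with bool? ((src τ′ == src τ) ∨ (src τ′ == dst τ)) | bool? ((dst τ′ == src τ) ∨ (dst τ′ == dst τ))
      ... | inj₁ e | inj₁ e′ rewrite e | e′ = begin
        Q * Q * (Q * Q) * Ex q n (λ S → ends τ S * ends τ′ S) ≤⟨ *-monoʳ-≤ (Q * Q * (Q * Q)) (Ex-mono q n λ S →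
           ≤-trans (fourS S) (≤-trans (χ*≤ (lookup S (src τ′)) _) (χ*≤ (lookup S (dst τ′)) _))) ⟩
        Q * Q * (Q * Q) * Ex q n (ends τ) ≡⟨ lem (Q * Q) _ ⟩
        Q * Q * (Q * Q * Ex q n (ends τ)) ≡⟨ cong (Q * Q *_) (Ex-ends τ∈) ⟩
        Q * Q * M ∎
        where lem : ∀ a b → a * a * b ≡ a * (a * b)
              lem = solve-∀
      ... | inj₁ e | inj₂ e′ rewrite e | e′ = begin
        Q * Q * (Q * Q) * Ex q n (λ S → ends τ S * ends τ′ S) ≤⟨ *-monoʳ-≤ (Q * Q * (Q * Q)) (Ex-mono q n λ S →
           ≤-trans (fourS S) (χ*≤ (lookup S (src τ′)) _)) ⟩
        Q * Q * (Q * Q) * Ex q n (allIn (dst τ′ ∷ src τ ∷ dst τ ∷ [])) ≡⟨ lem Q _ ⟩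
        Q * (Q * (Q * (Q * 1)) * Ex q n (allIn (dst τ′ ∷ src τ ∷ dst τ ∷ []))) ≡⟨ cong (Q *_) (Ex-all (far e′ ∷ uniq₂ τ∈)) ⟩
        Q * M ≡⟨ cong (_* M) (*-identityʳ Q) ⟨
        Q * 1 * M ∎
        where lem : ∀ a b → a * a * (a * a) * b ≡ a * (a * (a * (a * 1)) * b)
              lem = solve-∀
      ... | inj₂ e | inj₁ e′ rewrite e | e′ = begin
        Q * Q * (Q * Q) * Ex q n (λ S → ends τ S * ends τ′ S) ≤⟨ *-monoʳ-≤ (Q * Q * (Q * Q)) (Ex-mono q n λ S →
           ≤-trans (fourS S) (*-monoʳ-≤ (χ (lookup S (src τ′))) (χ*≤ (lookup S (dst τ′)) _))) ⟩
        Q * Q * (Q * Q) * Ex q n (allIn (src τ′ ∷ src τ ∷ dst τ ∷ [])) ≡⟨ lem Q _ ⟩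
        Q * (Q * (Q * (Q * 1)) * Ex q n (allIn (src τ′ ∷ src τ ∷ dst τ ∷ []))) ≡⟨ cong (Q *_) (Ex-all (far e ∷ uniq₂ τ∈)) ⟩
        Q * M ≡⟨ cong (_* M) (*-identityˡ Q) ⟨
        1 * Q * M ∎
        where lem : ∀ a b → a * a * (a * a) * b ≡ a * (a * (a * (a * 1)) * b)
              lem = solve-∀
      ... | inj₂ e | inj₂ e′ rewrite e | e′ = begin
        Q * Q * (Q * Q) * Ex q n (λ S → ends τ S * ends τ′ S) ≤⟨ *-monoʳ-≤ (Q * Q * (Q * Q)) (Ex-mono q n λ S →
           fourS S) ⟩
        Q * Q * (Q * Q) * Ex q n (allIn (src τ′ ∷ dst τ′ ∷ src τ ∷ dst τ ∷ [])) ≡⟨ cong (_* Ex q n (allIn (src τ′ ∷ dst τ′ ∷ src τ ∷ dst τ ∷ []))) (lem Q) ⟩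
        Q * (Q * (Q * (Q * 1))) * Ex q n (allIn (src τ′ ∷ dst τ′ ∷ src τ ∷ dst τ ∷ []))
          ≡⟨ Ex-all ((distinct τ′∈ ∷ far e) ∷ far e′ ∷ uniq₂ τ∈) ⟩
        M ≡⟨ *-identityˡ M ⟨
        1 * 1 * M ∎
        where lem : ∀ a → a * a * (a * a) ≡ a * (a * (a * (a * 1)))
              lem = solve-∀

    Ex-confs : ∀ {τ} → τ ∈ 𝒯 → 4 * (Q * Q * Ex q n (confs τ)) ≤ k * M
    Ex-confs {τ} τ∈ = *-cancelˡ-≤ (Q * Q) {{>-nonZero (*-mono-≤ 0<Q 0<Q)}} (begin
      Q * Q * (4 * (Q * Q * Ex q n (confs τ))) ≡⟨ lem (Q * Q) _ ⟩
      4 * (Q * Q * (Q * Q) * Ex q n (confs τ)) ≡⟨ cong (λ e → 4 * (Q * Q * (Q * Q) * e)) (Ex-∑ q n 𝒯 _) ⟩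
      4 * (Q * Q * (Q * Q) * ∑ 𝒯 (λ τ′ → Ex q n (λ S → χ (con τ τ′) * (ends τ S * ends τ′ S)))) ≡⟨ cong (4 *_) (∑-*ˡ 𝒯 (Q * Q * (Q * Q)) _) ⟨
      4 * ∑ 𝒯 (λ τ′ → Q * Q * (Q * Q) * Ex q n (λ S → χ (con τ τ′) * (ends τ S * ends τ′ S))) ≤⟨ *-monoʳ-≤ 4 (∑-mono 𝒯 λ {τ′} τ′∈ → step τ′∈) ⟩
      4 * ∑ 𝒯 (λ τ′ → χ (con τ τ′) * (weight τ (src τ′) * weight τ (dst τ′)) * M) ≡⟨ cong (4 *_) (∑-*ʳ 𝒯 _ M) ⟩
      4 * (∑ 𝒯 (λ τ′ → χ (con τ τ′) * (weight τ (src τ′) * weight τ (dst τ′))) * M) ≡⟨ *-assoc 4 (∑ 𝒯 (λ τ′ → χ (con τ τ′) * (weight τ (src τ′) * weight τ (dst τ′)))) M ⟨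
      4 * ∑ 𝒯 (λ τ′ → χ (con τ τ′) * (weight τ (src τ′) * weight τ (dst τ′))) * M ≤⟨ *-monoˡ-≤ M (con≤ τ∈) ⟩
      k * (Q * Q) * M ≡⟨ lem′ k (Q * Q) M ⟩
      Q * Q * (k * M) ∎)
      where
      open ≤-Reasoning
      lem : ∀ a e → a * (4 * (a * e)) ≡ 4 * (a * a * e)
      lem = solve-∀
      lem′ : ∀ a b c → a * b * c ≡ b * (a * c)
      lem′ = solve-∀
      step : ∀ {τ′} → τ′ ∈ 𝒯 → Q * Q * (Q * Q) * Ex q n (λ S → χ (con τ τ′) * (ends τ S * ends τ′ S)) ≤
                               χ (con τ τ′) * (weight τ (src τ′) * weight τ (dst τ′)) * M
      step {τ′} τ′∈ = begin
        Q * Q * (Q * Q) * Ex q n (λ S → χ (con τ τ′) * (ends τ S * ends τ′ S)) ≡⟨ cong (Q * Q * (Q * Q) *_) (Ex-* q n (χ (con τ τ′)) _) ⟩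
        Q * Q * (Q * Q) * (χ (con τ τ′) * Ex q n (λ S → ends τ S * ends τ′ S)) ≡⟨ lem″ (Q * Q * (Q * Q)) (χ (con τ τ′)) _ ⟩
        χ (con τ τ′) * (Q * Q * (Q * Q) * Ex q n (λ S → ends τ S * ends τ′ S)) ≤⟨ *-monoʳ-≤ (χ (con τ τ′)) (Ex-conf τ∈ τ′∈) ⟩
        χ (con τ τ′) * (weight τ (src τ′) * weight τ (dst τ′) * M) ≡⟨ *-assoc (χ (con τ τ′)) _ M ⟨
        χ (con τ τ′) * (weight τ (src τ′) * weight τ (dst τ′)) * M ∎
        where lem″ : ∀ a b c → a * (b * c) ≡ b * (a * c)
              lem″ = solve-∀

    D : ℕ
    D = 2 * k * C * k

    Ex-pool : Q * Ex q n (λ S → # P (lookup S)) ≡ length P * M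
    Ex-pool = begin
      Q * Ex q n (λ S → # P (lookup S)) ≡⟨ cong (Q *_) (Ex-∑ q n P _) ⟩
      Q * ∑ P (λ p → Ex q n (λ S → χ (lookup S p))) ≡⟨ ∑-*ˡ P Q _ ⟨
      ∑ P (λ p → Q * Ex q n (λ S → χ (lookup S p))) ≡⟨ ∑-cong P (λ {p} _ → Ex-one p) ⟩
      ∑ P (λ _ → M) ≡⟨ ∑-const P M ⟩
      length P * M ∎
      where open ≡-Reasoning

    loss gain : Vec Bool n → ℕ
    loss S = ∑ 𝒯 (λ τ → k * kills τ S + confs τ S) + D * # P (lookup S)
    gain S = k * ∑ 𝒯 (λ τ → ends τ S)

    expected : Ex q n loss < Ex q n gain
    expected = *-cancelˡ-< (4 * (Q * Q)) _ _ (begin-strict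
      4 * (Q * Q) * Ex q n loss ≡⟨ cong (4 * (Q * Q) *_) (trans (Ex-+ q n _ _) (cong₂ _+_ (Ex-∑ q n 𝒯 _) (Ex-* q n D _))) ⟩
      4 * (Q * Q) * (∑ 𝒯 (λ τ → Ex q n (λ S → k * kills τ S + confs τ S)) + D * Ex q n (λ S → # P (lookup S)))
        ≡⟨ trans (*-distribˡ-+ (4 * (Q * Q)) _ _) (cong₂ _+_ (sym (∑-*ˡ 𝒯 (4 * (Q * Q)) _)) (lem₁ Q D _)) ⟩
      ∑ 𝒯 (λ τ → 4 * (Q * Q) * Ex q n (λ S → k * kills τ S + confs τ S)) + 4 * D * (Q * (Q * Ex q n (λ S → # P (lookup S))))
        ≤⟨ +-mono-≤ (∑≤ 𝒯 (2 * (k * M)) each) (≤-reflexive (cong (λ e → 4 * D * (Q * e)) Ex-pool)) ⟩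
      length 𝒯 * (2 * (k * M)) + 4 * D * (Q * (length P * M)) ≡⟨ lem₂ (length 𝒯) k M C Q (length P) ⟩
      2 * (k * M) * (length 𝒯 + 4 * (C * k) * (length P * Q)) <⟨ *-monoʳ-< (2 * (k * M)) {{km}} (+-monoʳ-< (length 𝒯) many) ⟩
      2 * (k * M) * (length 𝒯 + length 𝒯) ≡⟨ lem₃ k M (length 𝒯) ⟩
      4 * k * (length 𝒯 * M) ≡⟨ cong (4 * k *_) (trans (sym (∑-const 𝒯 M)) (∑-cong 𝒯 λ τ∈ → sym (Ex-ends τ∈))) ⟩
      4 * k * ∑ 𝒯 (λ τ → Q * Q * Ex q n (ends τ)) ≡⟨ cong (4 * k *_) (∑-*ˡ 𝒯 (Q * Q) _) ⟩
      4 * k * (Q * Q * ∑ 𝒯 (λ τ → Ex q n (ends τ))) ≡⟨ cong (λ e → 4 * k * (Q * Q * e)) (sym (Ex-∑ q n 𝒯 _)) ⟩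
      4 * k * (Q * Q * Ex q n (λ S → ∑ 𝒯 (λ τ → ends τ S))) ≡⟨ lem₄ k (Q * Q) _ ⟩
      4 * (Q * Q) * (k * Ex q n (λ S → ∑ 𝒯 (λ τ → ends τ S))) ≡⟨ cong (4 * (Q * Q) *_) (Ex-* q n k _) ⟨
      4 * (Q * Q) * Ex q n gain ∎)
      where
      open ≤-Reasoning
      km : NonZero (2 * (k * M))
      km = >-nonZero (*-mono-≤ (s≤s (z≤n {1})) (*-mono-≤ 0<k (Ex-pos q n)))
      lem₁ : ∀ a d e → 4 * (a * a) * (d * e) ≡ 4 * d * (a * (a * e))
      lem₁ = solve-∀
      lem₂ : ∀ t k m c a p → t * (2 * (k * m)) + 4 * (2 * k * c * k) * (a * (p * m)) ≡ 2 * (k * m) * (t + 4 * (c * k) * (p * a))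
      lem₂ = solve-∀
      lem₃ : ∀ k m t → 2 * (k * m) * (t + t) ≡ 4 * k * (t * m)
      lem₃ = solve-∀
      lem₄ : ∀ k a e → 4 * k * (a * e) ≡ 4 * a * (k * e)
      lem₄ = solve-∀
      each : ∀ {τ} → τ ∈ 𝒯 → 4 * (Q * Q) * Ex q n (λ S → k * kills τ S + confs τ S) ≤ 2 * (k * M)
      each {τ} τ∈ = begin
        4 * (Q * Q) * Ex q n (λ S → k * kills τ S + confs τ S)
          ≡⟨ cong (4 * (Q * Q) *_) (trans (Ex-+ q n _ _) (cong (_+ Ex q n (confs τ)) (Ex-* q n k _))) ⟩
        4 * (Q * Q) * (k * Ex q n (kills τ) + Ex q n (confs τ)) ≡⟨ lem₅ Q k _ _ ⟩
        k * (4 * (Q * Q * Ex q n (kills τ))) + 4 * (Q * Q * Ex q n (confs τ))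
          ≤⟨ +-mono-≤ (*-monoʳ-≤ k (*-cancelˡ-≤ Q {{>-nonZero 0<Q}} kills-M)) (Ex-confs τ∈) ⟩
        k * M + k * M ≡⟨ cong (k * M +_) (+-identityʳ (k * M)) ⟨
        2 * (k * M) ∎
        where
        lem₅ : ∀ a k x y → 4 * (a * a) * (k * x + y) ≡ k * (4 * (a * a * x)) + 4 * (a * a * y)
        lem₅ = solve-∀
        lem₆ : ∀ a x → a * (4 * (a * a * x)) ≡ 4 * (a * a * a * x)
        lem₆ = solve-∀
        kills-M : Q * (4 * (Q * Q * Ex q n (kills τ))) ≤ Q * M
        kills-M = begin
          Q * (4 * (Q * Q * Ex q n (kills τ))) ≡⟨ lem₆ Q _ ⟩
          4 * (Q * Q * Q * Ex q n (kills τ)) ≡⟨ cong (4 *_) (Ex-kills τ∈) ⟩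
          4 * (length (kill τ) * M) ≡⟨ *-assoc 4 (length (kill τ)) M ⟨
          4 * length (kill τ) * M ≤⟨ *-monoˡ-≤ M (kill≤ τ∈) ⟩
          Q * M ∎

    selected : Selected
    selected = record
      { S = S ; I = proj₁ ind
      ; I⊆ = λ h → proj₁ (parts h)
      ; src∈ = λ h → ∧-t₁ (proj₂ (parts h))
      ; dst∈ = λ {τ} h → ∧-t₁ (∧-t₂ {lookup S (src τ)} (proj₂ (parts h)))
      ; alive = λ h x∈ s kx → alive′ h x∈ s kx (bool? _) (bool? _)
      ; apart = proj₁ (proj₂ ind)
      ; dense = *-cancelˡ-< (2 * k * k) _ _ (begin-strict
          2 * k * k * (C * # P (lookup S)) ≡⟨ lem k C _ ⟩
          D * # P (lookup S) <⟨ +-cancelˡ-< (∑ 𝒯 (λ τ → k * kills τ S + confs τ S)) _ _ (≤-trans (proj₂ found) gain≤) ⟩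
          k * length (sel good 𝒯) ≤⟨ *-monoʳ-≤ k (proj₂ (proj₂ (proj₂ ind))) ⟩
          k * (2 * k * length (proj₁ ind)) ≡⟨ lem′ k _ ⟩
          2 * k * k * length (proj₁ ind) ∎)
      }
      where
      open ≤-Reasoning
      lem : ∀ k c p → 2 * k * k * (c * p) ≡ 2 * k * c * k * p
      lem = solve-∀
      lem′ : ∀ k p → k * (2 * k * p) ≡ 2 * k * k * p
      lem′ = solve-∀
      found = Ex-find q n loss gain expected
      S = proj₁ found
      conf₀ : X → ℕ
      conf₀ τ = ∑ 𝒯 (λ τ′ → χ (con τ τ′) * ends τ′ S)
      good : X → Bool
      good τ = lookup S (src τ) ∧ lookup S (dst τ) ∧ (# (kill τ) (lookup S) ≤ᵇ 0) ∧ (conf₀ τ ≤ᵇ k)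
      trichotomy : ∀ p p′ K c → k * (χ p * (χ p′ * 1)) ≤
        (k * (K * (χ p * (χ p′ * 1))) + χ p * (χ p′ * 1) * c) + k * χ (p ∧ p′ ∧ (K ≤ᵇ 0) ∧ (c ≤ᵇ k))
      trichotomy false p′ K c = ≤-trans (≤-reflexive (*-zeroʳ k)) z≤n
      trichotomy true false K c = ≤-trans (≤-reflexive (*-zeroʳ k)) z≤n
      trichotomy true true (suc K) c = ≤-trans (*-monoʳ-≤ k (s≤s z≤n)) (≤-trans (m≤m+n _ _) (m≤m+n _ _))
      trichotomy true true zero c with c ≤ᵇ k in eq
      ... | true = m≤n+m _ _
      ... | false = ≤-trans (≤-trans (≤-reflexive (*-identityʳ k)) (≤-trans k≤c (≤-reflexive (sym (*-identityˡ c))))) (≤-trans (m≤n+m _ (k * 0)) (m≤m+n _ _))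
        where k≤c : k ≤ c
              k≤c with ≤-total k c
              ... | inj₁ h = h
              ... | inj₂ h = ⊥-elim (t≢f (≤⇒≤ᵇ≡ h) eq)
      enough : ∀ τ → k * ends τ S ≤ (k * kills τ S + confs τ S) + k * χ (good τ)
      enough τ = begin
        k * ends τ S ≤⟨ trichotomy (lookup S (src τ)) (lookup S (dst τ)) (# (kill τ) (lookup S)) (conf₀ τ) ⟩
        (k * (# (kill τ) (lookup S) * ends τ S) + ends τ S * conf₀ τ) + k * χ (good τ)
          ≡⟨ cong (_+ k * χ (good τ)) (cong₂ (λ a b → k * a + b) (sym (∑-*ʳ (kill τ) _ (ends τ S)))
               (trans (sym (∑-*ˡ 𝒯 (ends τ S) _)) (∑-cong 𝒯 λ {τ′} _ → lem″ (ends τ S) (χ (con τ τ′)) (ends τ′ S)))) ⟩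
        (k * kills τ S + confs τ S) + k * χ (good τ) ∎
        where lem″ : ∀ a b c → a * (b * c) ≡ b * (a * c)
              lem″ = solve-∀
      gain≤ : gain S ≤ ∑ 𝒯 (λ τ → k * kills τ S + confs τ S) + k * length (sel good 𝒯)
      gain≤ = begin
        k * ∑ 𝒯 (λ τ → ends τ S) ≡⟨ ∑-*ˡ 𝒯 k _ ⟨
        ∑ 𝒯 (λ τ → k * ends τ S) ≤⟨ ∑-mono 𝒯 (λ {τ} _ → enough τ) ⟩
        ∑ 𝒯 (λ τ → (k * kills τ S + confs τ S) + k * χ (good τ)) ≡⟨ ∑-+ 𝒯 _ _ ⟩
        ∑ 𝒯 (λ τ → k * kills τ S + confs τ S) + ∑ 𝒯 (λ τ → k * χ (good τ)) ≡⟨ cong (∑ 𝒯 (λ τ → k * kills τ S + confs τ S) +_) (trans (∑-*ˡ 𝒯 k _) (cong (k *_) (sym (length-sel good 𝒯)))) ⟩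
        ∑ 𝒯 (λ τ → k * kills τ S + confs τ S) + k * length (sel good 𝒯) ∎
      outdeg : ∀ {τ} → τ ∈ sel good 𝒯 → # (sel good 𝒯) (con τ) ≤ k
      outdeg {τ} τ∈ = begin
        # (sel good 𝒯) (con τ) ≡⟨ ∑-sel good 𝒯 _ ⟩
        ∑ 𝒯 (λ τ′ → χ (good τ′) * χ (con τ τ′)) ≤⟨ ∑-mono 𝒯 (λ {τ′} _ → ≤-trans
            (≤-reflexive (*-comm (χ (good τ′)) _)) (*-monoʳ-≤ (χ (con τ τ′)) (ends≥ (lookup S (src τ′)) (lookup S (dst τ′)) _))) ⟩
        conf₀ τ ≤⟨ ≤ᵇ≡⇒≤ (∧-t₂ {# (kill τ) (lookup S) ≤ᵇ 0} (∧-t₂ {lookup S (dst τ)} (∧-t₂ {lookup S (src τ)} (proj₂ (∈-sel⁻ good 𝒯 τ∈))))) ⟩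
        k ∎
        where ends≥ : ∀ p p′ r → χ (p ∧ p′ ∧ r) ≤ χ p * (χ p′ * 1)
              ends≥ false p′ r = z≤n
              ends≥ true false r = z≤n
              ends≥ true true r = χ≤1 r
      ind = independent con k (length (sel good 𝒯)) (sel good 𝒯) ≤-refl con-refl outdeg
      kill∉ : ∀ {τ w} → good τ ≡ true → w ∈ kill τ → lookup S w ≡ false
      kill∉ {τ} g w∈ = #≡0 (kill τ) (lookup S) (n≤0⇒n≡0 (≤ᵇ≡⇒≤ (∧-t₁ (∧-t₂ {lookup S (dst τ)} (∧-t₂ {lookup S (src τ)} g))))) w∈
      parts : ∀ {τ} → τ ∈ proj₁ ind → τ ∈ 𝒯 × good τ ≡ true
      parts h = ∈-sel⁻ good 𝒯 (proj₁ (proj₂ (proj₂ ind)) h)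
      alive′ : ∀ {τ x} → τ ∈ proj₁ ind → x ∈ P → lookup S x ≡ true → killed τ x ≡ true →
               x == src τ ≡ true ⊎ x == src τ ≡ false → x == dst τ ≡ true ⊎ x == dst τ ≡ false → x ≡ src τ ⊎ x ≡ dst τ
      alive′ _ _ _ _ (inj₁ e) _ = inj₁ (==⇒≡ e)
      alive′ _ _ _ _ (inj₂ _) (inj₁ e) = inj₂ (==⇒≡ e)
      alive′ {τ} h x∈ s kx (inj₂ e) (inj₂ e′) = ⊥-elim (t≢f s (kill∉ (proj₂ (parts h))
        (∈-sel⁺ (inner? τ) (sel (killed τ) P) (∈-sel⁺ (killed τ) P x∈ kx) (∧-t (not-t e) (not-t e′)))))

-- Ramsey sets and sparse bipartite pairs

every : {A : Set} → (A → Bool) → List A → Bool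
every p [] = true
every p (x ∷ xs) = p x ∧ every p xs

every⁻ : {A : Set} (p : A → Bool) {xs : List A} → every p xs ≡ true → ∀ {x} → x ∈ xs → p x ≡ true
every⁻ p {y ∷ xs} h (here refl) = ∧-t₁ h
every⁻ p {y ∷ xs} h (there x∈) = every⁻ p (∧-t₂ {p y} h) x∈

every⁺ : {A : Set} (p : A → Bool) (xs : List A) → (∀ {x} → x ∈ xs → p x ≡ true) → every p xs ≡ true
every⁺ p [] h = refl
every⁺ p (x ∷ xs) h = ∧-t (h (here refl)) (every⁺ p xs (h ∘ there))

tuples : {A : Set} → ℕ → List A → List (List A)
tuples zero ys = [] ∷ []
tuples (suc h) ys = map (λ p → proj₁ p ∷ proj₂ p) (ys ⊗ λ _ → tuples h ys)

length-tuples : {A : Set} (h : ℕ) (ys : List A) → length (tuples h ys) ≡ length ys ^ h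
length-tuples zero ys = refl
length-tuples (suc h) ys = trans (length-map _ (ys ⊗ _)) (trans (length-⊗ ys _)
  (trans (∑-const ys _) (cong (length ys *_) (length-tuples h ys))))

∈-⊗⁺ : {A B : Set} (xs : List A) (ys : A → List B) {x : A} {y : B} → x ∈ xs → y ∈ ys x → (x , y) ∈ xs ⊗ ys
∈-⊗⁺ (x ∷ xs) ys (here refl) y∈ = ∈-++⁺ˡ (∈-map⁺ (x ,_) y∈)
∈-⊗⁺ (x ∷ xs) ys (there x∈) y∈ = ∈-++⁺ʳ (map (x ,_) (ys x)) (∈-⊗⁺ xs ys x∈ y∈)

∈-tuples : {A : Set} (h : ℕ) (ys : List A) {xs : List A} → length xs ≡ h → (∀ {x} → x ∈ xs → x ∈ ys) → xs ∈ tuples h ys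
∈-tuples zero ys {[]} refl h = here refl
∈-tuples (suc k) ys {x ∷ xs} refl h = ∈-map⁺ _ (∈-⊗⁺ ys _ (h (here refl)) (∈-tuples k ys refl (h ∘ there)))

module Sparse {n : ℕ} (E : Fin n → Fin n → Bool) (E-sym : ∀ x y → E x y ≡ E y x) where

  indep : List (Fin n) → Bool
  indep [] = true
  indep (x ∷ xs) = every (λ y → not (E x y) ∧ not (x == y)) xs ∧ indep xs

  clique : List (Fin n) → Bool
  clique [] = true
  clique (x ∷ xs) = every (E x) xs ∧ clique xs

  indep-take : ∀ k xs → indep xs ≡ true → indep (take k xs) ≡ true
  indep-take zero xs h = refl
  indep-take (suc k) [] h = refl
  indep-take (suc k) (x ∷ xs) h = ∧-t
    (every⁺ _ (take k xs) λ y∈ → every⁻ _ (∧-t₁ h) (∈-take k xs y∈))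
    (indep-take k xs (∧-t₂ {every _ xs} h))

  ramsey : ∀ h k S → Unique S → suc k ^ h ≤ length S →
    (∃ λ I → (∀ {x} → x ∈ I → x ∈ S) × indep I ≡ true × length I ≡ h) ⊎
    (∃ λ K → (∀ {x} → x ∈ K → x ∈ S) × clique K ≡ true × length K ≡ k)
  ramsey zero k S u le = inj₁ ([] , (λ ()) , refl , refl)
  ramsey (suc h) zero S u le = inj₂ ([] , (λ ()) , refl , refl)
  ramsey (suc h) (suc k) [] u le = contradiction (≤-trans (m^n>0 (suc (suc k)) (suc h)) le) λ ()
  ramsey (suc h) (suc k) (v ∷ S) (v∉ ∷ u) le with suc (suc k) ^ h ≤? length (sel (not ∘ E v) S)
  ... | yes big with ramsey h (suc k) (sel (not ∘ E v) S) (sel-unique _ u) big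
  ...   | inj₂ (K , K⊆ , c , l) = inj₂ (K , (λ x∈ → there (proj₁ (∈-sel⁻ _ S (K⊆ x∈)))) , c , l)
  ...   | inj₁ (I , I⊆ , i , l) = inj₁ (v ∷ I , (λ { (here e) → here e ; (there x∈) → there (proj₁ (∈-sel⁻ _ S (I⊆ x∈))) }) ,
            ∧-t (every⁺ _ I λ x∈ → ∧-t (proj₂ (∈-sel⁻ (not ∘ E v) S (I⊆ x∈)))
                    (not-t (≢⇒== (All.lookup v∉ (proj₁ (∈-sel⁻ _ S (I⊆ x∈))))))) i , cong suc l)
  ramsey (suc h) (suc k) (v ∷ S) (v∉ ∷ u) le | no small with ramsey (suc h) k (sel (E v) S) (sel-unique _ u) big
    where
    A = suc (suc k) ^ h
    big : suc k ^ suc h ≤ length (sel (E v) S)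
    big = ≤-trans (*-monoʳ-≤ (suc k) (^-monoˡ-≤ h (n≤1+n (suc k)))) (+-cancelˡ-≤ A _ _ (begin
      A + suc k * A ≤⟨ le ⟩
      suc (length S) ≡⟨ cong suc (#-compl S (E v)) ⟨
      suc (# S (E v) + # S (not ∘ E v)) ≡⟨ cong suc (cong₂ _+_ (length-sel (E v) S) (length-sel (not ∘ E v) S)) ⟨
      suc (length (sel (E v) S) + length (sel (not ∘ E v) S)) ≡⟨ +-comm (suc (length (sel (E v) S))) _ ⟩
      length (sel (not ∘ E v) S) + suc (length (sel (E v) S)) ≡⟨ +-suc _ _ ⟩
      suc (length (sel (not ∘ E v) S)) + length (sel (E v) S) ≤⟨ +-monoˡ-≤ _ (≰⇒> small) ⟩
      A + length (sel (E v) S) ∎))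
      where open ≤-Reasoning
  ... | inj₁ (I , I⊆ , i , l) = inj₁ (I , (λ x∈ → there (proj₁ (∈-sel⁻ _ S (I⊆ x∈)))) , i , l)
  ... | inj₂ (K , K⊆ , c , l) = inj₂ (v ∷ K , (λ { (here e) → here e ; (there x∈) → there (proj₁ (∈-sel⁻ _ S (K⊆ x∈))) }) ,
            ∧-t (every⁺ _ K λ x∈ → proj₂ (∈-sel⁻ (E v) S (K⊆ x∈))) c , cong suc l)

  module _ (r t w : ℕ)
    (no-clique : ∀ K → clique K ≡ true → length K ≡ suc w → ⊥)
    (no-biclique : ∀ I J → indep I ≡ true → indep J ≡ true → length I ≡ r → length J ≡ t →
                   (∀ {x y} → x ∈ I → y ∈ J → E x y ≡ true) → ⊥)
    where

    h ρ : ℕ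
    h = r + t
    ρ = suc (suc w) ^ h

    indepSet : ∀ S → Unique S → ρ ≤ length S → ∃ λ I → (∀ {x} → x ∈ I → x ∈ S) × indep I ≡ true × length I ≡ h
    indepSet S u le with ramsey h (suc w) S u le
    ... | inj₁ x = x
    ... | inj₂ (K , _ , c , l) = ⊥-elim (no-clique K c l)

    -- Kővári–Sós–Turán with independent sets: many x ∈ X see ρ vertices of Y, hence an independent
    -- h-set in Y; some h-set is seen by ρ of them, among which there is an independent h-set again.
    kst : ∀ Λ g X Y → Unique X → Unique Y → 0 < Λ → length X ≤ Λ * g →
          (∀ {y} → y ∈ Y → g ≤ # X (E y)) → length Y ≡ 2 * Λ * ρ → 2 * ρ * (2 * Λ * ρ) ^ h ≤ g → ⊥
    kst Λ g X Y uX uY 0<Λ X≤ deg≥ |Y| g≥ =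
      no-biclique (take r I) (take t J) (indep-take r I I-ind) (indep-take t J J-ind)
        (take-length r I (≤-trans (m≤m+n r t) (≤-reflexive (sym |I|))))
        (take-length t J (≤-trans (m≤n+m t r) (≤-reflexive (sym |J|))))
        λ {x} {y} x∈ y∈ → trans (E-sym x y) (every⁻ (E y) (∧-t₂ {indep I} (proj₂ (∈-sel⁻ _ X (J⊆ (∈-take t J y∈))))) (∈-take r I x∈))
      where
      open ≤-Reasoning
      take-length : ∀ k (xs : List (Fin n)) → k ≤ length xs → length (take k xs) ≡ k
      take-length k xs le = trans (length-take k xs) (m≤n⇒m⊓n≡m le)
      y₀ = 2 * Λ * ρ
      0<ρ : 0 < ρ
      0<ρ = m^n>0 (suc (suc w)) h
      0<y₀ : 0 < y₀
      0<y₀ = *-mono-≤ (*-mono-≤ (s≤s (z≤n {1})) 0<Λ) 0<ρ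
      rich : Fin n → Bool
      rich x = ρ ≤ᵇ # Y (E x)
      each : ∀ x → # Y (E x) ≤ ρ + χ (rich x) * y₀
      each x with ρ ≤ᵇ # Y (E x) in eq
      ... | true = ≤-trans (≤-trans (#≤length Y _) (≤-reflexive (trans |Y| (sym (*-identityˡ y₀))))) (m≤n+m _ ρ)
      ... | false with ≤-total (# Y (E x)) ρ
      ...   | inj₁ le = ≤-trans le (m≤m+n ρ _)
      ...   | inj₂ le = ⊥-elim (t≢f (≤⇒≤ᵇ≡ le) eq)
      counting : y₀ * g ≤ ρ * (Λ * g) + length (sel rich X) * y₀
      counting = begin
        y₀ * g ≡⟨ cong (_* g) |Y| ⟨
        length Y * g ≤⟨ ∑≥ Y g deg≥ ⟩
        ∑ Y (λ y → # X (E y)) ≡⟨ ∑-swap Y X _ ⟩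
        ∑ X (λ x → ∑ Y (λ y → χ (E y x))) ≡⟨ ∑-cong X (λ {x} _ → ∑-cong Y λ {y} _ → cong χ (E-sym y x)) ⟩
        ∑ X (λ x → # Y (E x)) ≤⟨ ∑-mono X (λ {x} _ → each x) ⟩
        ∑ X (λ x → ρ + χ (rich x) * y₀) ≡⟨ ∑-+ X _ _ ⟩
        ∑ X (λ _ → ρ) + ∑ X (λ x → χ (rich x) * y₀) ≡⟨ cong₂ _+_ (trans (∑-const X ρ) (*-comm (length X) ρ))
            (trans (∑-*ʳ X _ y₀) (cong (_* y₀) (sym (length-sel rich X)))) ⟩
        ρ * length X + length (sel rich X) * y₀ ≤⟨ +-monoˡ-≤ _ (*-monoʳ-≤ ρ X≤) ⟩
        ρ * (Λ * g) + length (sel rich X) * y₀ ∎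
      lem : ∀ a b c → 2 * a * b * c ≡ b * (a * c) + b * (a * c)
      lem = solve-∀
      lem₁ : ∀ a b c → a * (2 * b * c) ≡ (c * b) * (2 * a)
      lem₁ = solve-∀
      g≤ : g ≤ 2 * length (sel rich X)
      g≤ = *-cancelˡ-≤ (ρ * Λ) {{>-nonZero (*-mono-≤ 0<ρ 0<Λ)}} (+-cancelˡ-≤ (ρ * (Λ * g)) _ _ (begin
        ρ * (Λ * g) + ρ * Λ * g ≡⟨ cong (ρ * (Λ * g) +_) (*-assoc ρ Λ g) ⟩
        ρ * (Λ * g) + ρ * (Λ * g) ≡⟨ lem Λ ρ g ⟨
        y₀ * g ≤⟨ counting ⟩
        ρ * (Λ * g) + length (sel rich X) * y₀ ≡⟨ cong (ρ * (Λ * g) +_) (lem₁ (length (sel rich X)) Λ ρ) ⟩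
        ρ * (Λ * g) + ρ * Λ * (2 * length (sel rich X)) ∎))
      rich≥ : ρ * y₀ ^ h ≤ length (sel rich X)
      rich≥ = *-cancelˡ-≤ 2 (≤-trans (≤-reflexive (sym (*-assoc 2 ρ _))) (≤-trans g≥ g≤))
      sees : List (Fin n) → Fin n → Bool
      sees I x = indep I ∧ every (E x) I
      seen : ∀ {x} → x ∈ sel rich X → 1 ≤ ∑ (tuples h Y) (λ I → χ (sees I x))
      seen {x} x∈ with indepSet (sel (E x) Y) (sel-unique _ uY)
        (≤-trans (≤ᵇ≡⇒≤ (proj₂ (∈-sel⁻ rich X x∈))) (≤-reflexive (sym (length-sel (E x) Y))))
      ... | I , I⊆ , i , l = ≤-trans (≤-reflexive (cong χ (sym (∧-t {indep I} i (every⁺ _ I λ z → proj₂ (∈-sel⁻ _ Y (I⊆ z)))))))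
              (∑-∈ (tuples h Y) (λ I → χ (sees I x)) (∈-tuples h Y l λ z → proj₁ (∈-sel⁻ (E x) Y (I⊆ z))))
      |tuples| : length (tuples h Y) ≡ y₀ ^ h
      |tuples| = trans (length-tuples h Y) (cong (_^ h) |Y|)
      many : ∑ (tuples h Y) (λ _ → pred ρ) < ∑ (tuples h Y) (λ I → # X (sees I))
      many = begin-strict
        ∑ (tuples h Y) (λ _ → pred ρ) ≡⟨ ∑-const (tuples h Y) _ ⟩
        length (tuples h Y) * pred ρ ≡⟨ trans (cong (_* pred ρ) |tuples|) (*-comm _ (pred ρ)) ⟩
        pred ρ * y₀ ^ h <⟨ *-monoˡ-< (y₀ ^ h) {{m^n≢0 y₀ h {{>-nonZero 0<y₀}}}} (≤-reflexive (suc-pred ρ {{>-nonZero 0<ρ}})) ⟩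
        ρ * y₀ ^ h ≤⟨ rich≥ ⟩
        length (sel rich X) ≡⟨ length≡∑ (sel rich X) ⟩
        ∑ (sel rich X) (λ _ → 1) ≤⟨ ∑-mono (sel rich X) seen ⟩
        ∑ (sel rich X) (λ x → ∑ (tuples h Y) (λ I → χ (sees I x))) ≤⟨ sel-⊆-mono rich X _ ⟩
        ∑ X (λ x → ∑ (tuples h Y) (λ I → χ (sees I x))) ≡⟨ ∑-swap X (tuples h Y) _ ⟩
        ∑ (tuples h Y) (λ I → # X (sees I)) ∎
      found = ∑-find (tuples h Y) _ _ many
      I = proj₁ found
      ρ≤ : ρ ≤ # X (sees I)
      ρ≤ = ≤-trans (≤-reflexive (sym (suc-pred ρ {{>-nonZero 0<ρ}}))) (proj₂ (proj₂ found))
      second = indepSet (sel (sees I) X) (sel-unique _ uX) (≤-trans ρ≤ (≤-reflexive (sym (length-sel (sees I) X))))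
      J = proj₁ second
      J⊆ : ∀ {x} → x ∈ J → x ∈ sel (sees I) X
      J⊆ = proj₁ (proj₂ second)
      J-ind = proj₁ (proj₂ (proj₂ second))
      |J| = proj₂ (proj₂ (proj₂ second))
      some-x = 0<⇒member (sel (sees I) X) (≤-trans 0<ρ (≤-trans ρ≤ (≤-reflexive (sym (length-sel (sees I) X)))))
      I-ind : indep I ≡ true
      I-ind = ∧-t₁ (proj₂ (∈-sel⁻ (sees I) X (proj₂ some-x)))
      tuple-length : ∀ k {I} → I ∈ tuples k Y → length I ≡ k
      tuple-length zero (here refl) = refl
      tuple-length (suc k) {I} I∈ with ∈-map⁻ _ I∈
      ... | (y , I′) , z , refl = cong suc (tuple-length k (proj₂ (∈-⊗⁻ Y _ z)))
      |I| : length I ≡ h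
      |I| = tuple-length h (proj₁ (proj₂ found))

    few : ∀ Λ g X Y → Unique X → Unique Y → 0 < Λ → 0 < h → length X ≤ Λ * g → 2 * ρ * (2 * Λ * ρ) ^ h ≤ g →
          # Y (λ y → g ≤ᵇ # X (E y)) ≤ g
    few Λ g X Y uX uY 0<Λ 0<h X≤ g≥ with 2 * Λ * ρ ≤? # Y (λ y → g ≤ᵇ # X (E y))
    ... | no lt = ≤-trans (<⇒≤ (≰⇒> lt)) (≤-trans power g≥)
      where
      power : 2 * Λ * ρ ≤ 2 * ρ * (2 * Λ * ρ) ^ h
      power = ≤-trans (≤-trans (≤-reflexive (sym (^-identityʳ _)))
          (^-monoʳ-≤ (2 * Λ * ρ) {{>-nonZero (*-mono-≤ (*-mono-≤ (s≤s (z≤n {1})) 0<Λ) (m^n>0 (suc (suc w)) h))}} 0<h))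
        (m≤n*m _ (2 * ρ) {{>-nonZero (*-mono-≤ (s≤s (z≤n {1})) (m^n>0 (suc (suc w)) h))}})
    ... | yes ge = ⊥-elim (kst Λ g X (take y₀ (sel rich Y)) uX (Uᵖ.take⁺ y₀ (sel-unique rich uY)) 0<Λ X≤
        (λ y∈ → ≤ᵇ≡⇒≤ (proj₂ (∈-sel⁻ rich Y (∈-take y₀ (sel rich Y) y∈))))
        (trans (length-take y₀ (sel rich Y)) (m≤n⇒m⊓n≡m (≤-trans ge (≤-reflexive (sym (length-sel rich Y)))))) g≥)
      where
      y₀ = 2 * Λ * ρ
      rich : Fin n → Bool
      rich y = g ≤ᵇ # X (E y)

-- Degeneracy

∑-⊆ : ∀ {n} {xs ys : List (Fin n)} (f : Fin n → ℕ) → Unique xs → Unique ys → (∀ {x} → x ∈ xs → x ∈ ys) → ∑ xs f ≤ ∑ ys f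
∑-⊆ {xs = []} f ux uy sub = z≤n
∑-⊆ {xs = x ∷ xs} {ys} f (h ∷ ux) uy sub = ≤-trans
  (+-monoʳ-≤ (f x) (∑-⊆ f ux (sel-unique _ uy) λ {z} z∈ → ∈-sel⁺ _ ys (sub (there z∈))
    (not-t (≢⇒== (λ e → All.lookup h z∈ (sym e))))))
  (≤-reflexive (sym (∑-∖ f uy (sub (here refl)))))

length-⊆ : ∀ {n} {xs ys : List (Fin n)} → Unique xs → Unique ys → (∀ {x} → x ∈ xs → x ∈ ys) → length xs ≤ length ys
length-⊆ {xs = xs} {ys} ux uy sub = ≤-trans (≤-reflexive (length≡∑ xs)) (≤-trans (∑-⊆ _ ux uy sub) (≤-reflexive (sym (length≡∑ ys))))

search : {A : Set} (p : A → Bool) (xs : List A) → (∃ λ x → x ∈ xs × p x ≡ true) ⊎ (∀ {x} → x ∈ xs → p x ≡ false)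
search p [] = inj₂ λ ()
search p (x ∷ xs) with p x in eq
... | true = inj₁ (x , here refl , eq)
... | false with search p xs
...   | inj₁ (y , y∈ , e) = inj₁ (y , there y∈ , e)
...   | inj₂ none = inj₂ λ { (here refl) → eq ; (there h) → none h }

record Core {n : ℕ} (R : Fin n → Fin n → Bool) (d : Fin n → ℕ) (L : List (Fin n)) : Set where
  field
    verts : List (Fin n)
    unique : Unique verts
    inside : ∀ {v} → v ∈ verts → v ∈ L
    nonempty : 0 < length verts
    degrees : ∀ {v} → v ∈ verts → d v ≤ # verts (R v)

record Orientation {n : ℕ} (R : Fin n → Fin n → Bool) (d : Fin n → ℕ) (L : List (Fin n)) : Set where
  field
    out : Fin n → Fin n → Bool
    out< : ∀ {v} → v ∈ L → # L (out v) < d v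
    covers : ∀ {v w} → v ∈ L → w ∈ L → R v w ≡ true → out v w ∨ out w v ≡ true

peel : ∀ {n} (R : Fin n → Fin n → Bool) → (∀ x y → R x y ≡ R y x) → (d : Fin n → ℕ) →
       ∀ fuel L → length L ≤ fuel → Unique L → Core R d L ⊎ Orientation R d L
peel R R-sym d fuel [] le u = inj₂ record { out = λ _ _ → false ; out< = λ () ; covers = λ () }
peel R R-sym d (suc fuel) L@(_ ∷ _) le u with search (λ v → suc (# L (R v)) ≤ᵇ d v) L
... | inj₂ none = inj₁ record { verts = L ; unique = u ; inside = λ h → h ; nonempty = s≤s z≤n
        ; degrees = λ {v} v∈ → ≮⇒≥ λ lt → t≢f (≤⇒≤ᵇ≡ lt) (none v∈) }
... | inj₁ (v , v∈ , small) with peel R R-sym d fuel (L ∖ v) (s≤s⁻¹ (≤-trans (≤-reflexive (sym (length-∖ u v∈))) le)) (sel-unique _ u)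
...   | inj₁ c = inj₁ record { verts = Core.verts c ; unique = Core.unique c
          ; inside = λ h → proj₁ (∈-sel⁻ _ L (Core.inside c h)) ; nonempty = Core.nonempty c ; degrees = Core.degrees c }
...   | inj₂ o = inj₂ record { out = out′ ; out< = out<′ ; covers = covers′ }
  where
  open Orientation o
  out′ : _ → _ → Bool
  out′ x y = if x == v then R v y else (not (y == v) ∧ out x y)
  other : ∀ {x} → x ∈ L → x == v ≡ false → x ∈ L ∖ v
  other x∈ e = ∈-sel⁺ _ L x∈ (not-t e)
  out<′ : ∀ {x} → x ∈ L → # L (out′ x) < d x
  out<′ {x} x∈ with x == v in eq
  ... | true rewrite ==⇒≡ eq = ≤ᵇ≡⇒≤ small
  ... | false = ≤-trans (s≤s (≤-reflexive (sym (#-sel (λ y → not (y == v)) L (out x))))) (out< (other x∈ eq))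
  covers′ : ∀ {x y} → x ∈ L → y ∈ L → R x y ≡ true → out′ x y ∨ out′ y x ≡ true
  covers′ {x} {y} x∈ y∈ r with x == v in ex | y == v in ey
  ... | true | _ rewrite ==⇒≡ ex = ∨-t₁ r
  ... | false | true rewrite ==⇒≡ ey = ∨-t₂ {false} (trans (R-sym v x) r)
  ... | false | false = covers (other x∈ ex) (other y∈ ey) r

orientation-sum : ∀ {n} {R : Fin n → Fin n → Bool} {d L} (o : Orientation R d L) (xs ys : List (Fin n)) →
  (∀ {x} → x ∈ xs → x ∈ L) → (∀ {y} → y ∈ ys → y ∈ L) →
  ∑ xs (λ x → # ys (R x)) ≤ ∑ xs (λ x → # ys (Orientation.out o x)) + ∑ ys (λ y → # xs (Orientation.out o y))
orientation-sum {R = R} o xs ys xs⊆ ys⊆ = begin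
  ∑ xs (λ x → # ys (R x)) ≤⟨ ∑-mono xs (λ x∈ → ∑-mono ys λ y∈ → ≤-trans (χ-mono (covers (xs⊆ x∈) (ys⊆ y∈))) (χ-∨ (out _ _) (out _ _))) ⟩
  ∑ xs (λ x → ∑ ys (λ y → χ (out x y) + χ (out y x))) ≡⟨ trans (∑-cong xs λ _ → ∑-+ ys _ _) (∑-+ xs _ _) ⟩
  ∑ xs (λ x → # ys (out x)) + ∑ xs (λ x → ∑ ys (λ y → χ (out y x))) ≡⟨ cong (∑ xs (λ x → # ys (out x)) +_) (∑-swap xs ys _) ⟩
  ∑ xs (λ x → # ys (out x)) + ∑ ys (λ y → # xs (out y)) ∎
  where open Orientation o
        open ≤-Reasoning

maxCore : ∀ {n} (R : Fin n → Fin n → Bool) → (∀ x y → R x y ≡ R y x) → ∀ s → 0 < s → ∀ fuel g → n < g + fuel →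
  Core R (λ _ → s * g) (allFin n) →
  ∃ λ g′ → g ≤ g′ × Core R (λ _ → s * g′) (allFin n) × Orientation R (λ _ → s * suc g′) (allFin n)
maxCore {n} R R-sym s 0<s zero g lt c = contradiction (begin
  g ≤⟨ m≤n*m g s {{>-nonZero 0<s}} ⟩
  s * g ≤⟨ degrees (proj₂ (0<⇒member verts nonempty)) ⟩
  # verts (R _) ≤⟨ #≤length verts _ ⟩
  length verts ≤⟨ length-⊆ unique (Uᵖ.allFin⁺ n) (λ _ → ∈-allFin _) ⟩
  length (allFin n) ≡⟨ length-tabulate {n = n} (λ i → i) ⟩
  n ∎) (<⇒≱ (≤-trans lt (≤-reflexive (+-identityʳ g))))
  where open Core c
        open ≤-Reasoning
        open import Data.List.Properties using (length-tabulate)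
maxCore {n} R R-sym s 0<s (suc fuel) g lt c with peel R R-sym (λ _ → s * suc g) (length (allFin n)) (allFin n) ≤-refl (Uᵖ.allFin⁺ n)
... | inj₂ o = g , ≤-refl , c , o
... | inj₁ c′ with maxCore R R-sym s 0<s fuel (suc g) (≤-trans lt (≤-reflexive (+-suc g fuel))) c′
...   | g′ , le , c″ , o = g′ , ≤-trans (n≤1+n g) le , c″ , o

record Unbalanced {n : ℕ} (E : Fin n → Fin n → Bool) (m g K₁ : ℕ) (T : List (Fin n)) : Set where
  field
    A B : List (Fin n)
    uA : Unique A
    uB : Unique B
    A⊆ : ∀ {a} → a ∈ A → a ∈ T
    B⊆ : ∀ {u} → u ∈ B → u ∈ T
    disjoint : ∀ {x} → x ∈ A → x ∈ B → ⊥
    B≢[] : 0 < length B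
    A-deg : ∀ {a} → a ∈ A → # T (E a) ≤ 144 * m
    R : Fin n → Fin n → Bool
    R⇒E : ∀ {a u} → R a u ≡ true → E a u ≡ true
    R⇒codeg : ∀ {a u} → R a u ≡ true → # (sel (E a) T) (E u) ≤ g
    R-degA : ∀ {a} → a ∈ A → 4 * m ≤ # B (R a)
    R-degB : ∀ {u} → u ∈ B → K₁ * m ≤ # A (λ a → R a u)

record Regular {n : ℕ} (E : Fin n → Fin n → Bool) (m K₁ : ℕ) (T : List (Fin n)) : Set where
  field
    V : List (Fin n)
    uV : Unique V
    V⊆ : ∀ {v} → v ∈ V → v ∈ T
    V≢[] : 0 < length V
    V-deg≥ : ∀ {v} → v ∈ V → m ≤ # V (E v)
    V-deg≤ : ∀ {v} → v ∈ V → # V (E v) ≤ 36 * K₁ * m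

module Dichotomy {n : ℕ} (E : Fin n → Fin n → Bool) (E-sym : ∀ x y → E x y ≡ E y x)
  (m g K₁ : ℕ) (0<m : 0 < m) (g≤m : g ≤ m) (4<K₁ : 4 < K₁)
  (T : List (Fin n)) (uT : Unique T) (T≢[] : 0 < length T)
  (deg≥ : ∀ {v} → v ∈ T → 9 * m ≤ # T (E v))
  (deg-sum : ∑ T (λ v → # T (E v)) ≤ 36 * m * length T)
  (sparse : ∀ X → Unique X → length X ≤ 144 * m → # T (λ y → g ≤ᵇ # X (E y)) ≤ g)
  where

  deg : Fin n → ℕ
  deg v = # T (E v)

  low high : Fin n → Bool
  low v = deg v ≤ᵇ 144 * m
  high v = 36 * K₁ * m ≤ᵇ deg v

  Low High V₃ L : List (Fin n)
  Low = sel low T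
  High = sel high T
  V₃ = sel (not ∘ high) T
  L = sel (λ v → low v ∨ high v) T

  low⇒¬high : ∀ {v} → low v ≡ true → high v ≡ false
  low⇒¬high {v} lo = ¬t⇒f λ hi → <⇒≱ (begin-strict
    deg v ≤⟨ ≤ᵇ≡⇒≤ lo ⟩
    144 * m ≡⟨ cong (_* m) {144} {36 * 4} refl ⟩
    36 * 4 * m <⟨ *-monoˡ-< m {{>-nonZero 0<m}} (*-monoʳ-< 36 4<K₁) ⟩
    36 * K₁ * m ∎) (≤ᵇ≡⇒≤ hi)
    where open ≤-Reasoning

  R₀ R : Fin n → Fin n → Bool
  R₀ a u = low a ∧ high u ∧ E a u ∧ not (g ≤ᵇ # (sel (E a) T) (E u))
  R x y = R₀ x y ∨ R₀ y x

  R-sym : ∀ x y → R x y ≡ R y x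
  R-sym x y = ∨-comm (R₀ x y) (R₀ y x)
    where open import Data.Bool.Properties using (∨-comm)

  d : Fin n → ℕ
  d x = if low x then 4 * m else K₁ * m

  d-low : ∀ {x} → low x ≡ true → d x ≡ 4 * m
  d-low e rewrite e = refl

  d-high : ∀ {x} → high x ≡ true → d x ≡ K₁ * m
  d-high {x} e with low x in eq
  ... | true = ⊥-elim (t≢f e (low⇒¬high eq))
  ... | false = refl

  unbalanced : Core R d L → Unbalanced E m g K₁ T
  unbalanced c = record
    { A = sel low verts ; B = sel high verts ; uA = sel-unique _ unique ; uB = sel-unique _ unique
    ; A⊆ = λ h → proj₁ (∈-sel⁻ _ T (inside (proj₁ (∈-sel⁻ _ verts h))))
    ; B⊆ = λ h → proj₁ (∈-sel⁻ _ T (inside (proj₁ (∈-sel⁻ _ verts h))))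
    ; disjoint = λ hA hB → t≢f (proj₂ (∈-sel⁻ high verts hB)) (low⇒¬high (proj₂ (∈-sel⁻ low verts hA)))
    ; B≢[] = B≢[]
    ; A-deg = λ h → ≤ᵇ≡⇒≤ (proj₂ (∈-sel⁻ low verts h))
    ; R = R₀
    ; R⇒E = λ {a} {u} h → ∧-t₁ {E a u} (∧-t₂ {high u} (∧-t₂ {low a} h))
    ; R⇒codeg = λ {a} {u} h → <⇒≤ (≰⇒> λ le → t≢f (≤⇒≤ᵇ≡ le) (not-f (∧-t₂ {E a u} (∧-t₂ {high u} (∧-t₂ {low a} h)))))
    ; R-degA = λ h → degA (proj₁ (∈-sel⁻ low verts h)) (proj₂ (∈-sel⁻ low verts h))
    ; R-degB = λ h → degB (proj₁ (∈-sel⁻ high verts h)) (proj₂ (∈-sel⁻ high verts h))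
    }
    where
    open Core c
    open ≤-Reasoning
    degA : ∀ {a} → a ∈ verts → low a ≡ true → 4 * m ≤ # (sel high verts) (R₀ a)
    degA {a} a∈ lo = begin
      4 * m ≡⟨ d-low lo ⟨
      d a ≤⟨ degrees a∈ ⟩
      # verts (R a) ≤⟨ #-mono verts (λ {y} _ → pick y) ⟩
      # verts (λ y → high y ∧ R₀ a y) ≡⟨ #-sel high verts (R₀ a) ⟨
      # (sel high verts) (R₀ a) ∎
      where
      pick : ∀ y → R a y ≡ true → high y ∧ R₀ a y ≡ true
      pick y r with ∨-case {R₀ a y} r
      ... | inj₁ r₀ = ∧-t (∧-t₁ {high y} (∧-t₂ {low a} r₀)) r₀
      ... | inj₂ r₀ = ⊥-elim (t≢f (∧-t₁ {high a} (∧-t₂ {low y} r₀)) (low⇒¬high lo))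
    degB : ∀ {u} → u ∈ verts → high u ≡ true → K₁ * m ≤ # (sel low verts) (λ a → R₀ a u)
    degB {u} u∈ hi = begin
      K₁ * m ≡⟨ d-high hi ⟨
      d u ≤⟨ degrees u∈ ⟩
      # verts (R u) ≤⟨ #-mono verts (λ {y} _ → pick y) ⟩
      # verts (λ y → low y ∧ R₀ y u) ≡⟨ #-sel low verts (λ a → R₀ a u) ⟨
      # (sel low verts) (λ a → R₀ a u) ∎
      where
      pick : ∀ y → R u y ≡ true → low y ∧ R₀ y u ≡ true
      pick y r with ∨-case {R₀ u y} r
      ... | inj₁ r₀ = ⊥-elim (t≢f hi (low⇒¬high (∧-t₁ {low u} r₀)))
      ... | inj₂ r₀ = ∧-t (∧-t₁ {low y} r₀) r₀
    B≢[] : 0 < length (sel high verts)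
    B≢[] with 0<⇒member verts nonempty
    ... | v , v∈ with ∨-case {low v} (proj₂ (∈-sel⁻ _ T (inside v∈)))
    ...   | inj₁ lo = ≤-trans (≤-trans (*-mono-≤ (s≤s (z≤n {3})) 0<m) (degA v∈ lo)) (#≤length (sel high verts) (R₀ v))
    ...   | inj₂ hi = member⇒0< (∈-sel⁺ high verts v∈ hi)

  module _ (o : Orientation R d L) where
    open Orientation o
    open ≤-Reasoning

    Low⊆L : ∀ {v} → v ∈ Low → v ∈ L
    Low⊆L h = ∈-sel⁺ _ T (proj₁ (∈-sel⁻ low T h)) (∨-t₁ (proj₂ (∈-sel⁻ low T h)))

    High⊆L : ∀ {v} → v ∈ High → v ∈ L
    High⊆L {v} h = ∈-sel⁺ _ T (proj₁ (∈-sel⁻ high T h)) (∨-t₂ {low v} (proj₂ (∈-sel⁻ high T h)))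

    cross : ∑ Low (λ a → # High (R₀ a)) ≤ length Low * (4 * m) + length High * (K₁ * m)
    cross = begin
      ∑ Low (λ a → # High (R₀ a)) ≤⟨ ∑-mono Low (λ {a} _ → #-mono High λ {u} _ h → ∨-t₁ {R₀ a u} h) ⟩
      ∑ Low (λ a → # High (R a)) ≤⟨ orientation-sum o Low High Low⊆L High⊆L ⟩
      ∑ Low (λ a → # High (out a)) + ∑ High (λ u → # Low (out u)) ≤⟨ +-mono-≤
        (∑≤ Low (4 * m) λ h → ≤-trans (∑-⊆ _ (sel-unique _ uT) (sel-unique _ uT) High⊆L)
          (≤-trans (<⇒≤ (out< (Low⊆L h))) (≤-reflexive (d-low (proj₂ (∈-sel⁻ low T h))))))
        (∑≤ High (K₁ * m) λ h → ≤-trans (∑-⊆ _ (sel-unique _ uT) (sel-unique _ uT) Low⊆L)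
          (≤-trans (<⇒≤ (out< (High⊆L h))) (≤-reflexive (d-high (proj₂ (∈-sel⁻ high T h)))))) ⟩
      length Low * (4 * m) + length High * (K₁ * m) ∎

    NonLow≤ : 4 * length (sel (not ∘ low) T) ≤ length T
    NonLow≤ = *-cancelˡ-≤ (36 * m) {{>-nonZero (*-mono-≤ (s≤s (z≤n {35})) 0<m)}} (begin
      36 * m * (4 * length (sel (not ∘ low) T)) ≡⟨ lem m (length (sel (not ∘ low) T)) ⟩
      length (sel (not ∘ low) T) * (144 * m) ≤⟨ ∑≥ (sel (not ∘ low) T) (144 * m) (λ {v} h →
          <⇒≤ (≰⇒> λ le → t≢f (≤⇒≤ᵇ≡ le) (not-f (proj₂ (∈-sel⁻ (not ∘ low) T h))))) ⟩
      ∑ (sel (not ∘ low) T) deg ≤⟨ sel-⊆-mono _ T deg ⟩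
      ∑ T deg ≤⟨ deg-sum ⟩
      36 * m * length T ∎)
      where lem : ∀ m x → 36 * m * (4 * x) ≡ x * (144 * m)
            lem = solve-∀

    High≤ : K₁ * length High ≤ length T
    High≤ = *-cancelˡ-≤ (36 * m) {{>-nonZero (*-mono-≤ (s≤s (z≤n {35})) 0<m)}} (begin
      36 * m * (K₁ * length High) ≡⟨ lem m K₁ (length High) ⟩
      length High * (36 * K₁ * m) ≤⟨ ∑≥ High (36 * K₁ * m) (λ {v} h → ≤ᵇ≡⇒≤ (proj₂ (∈-sel⁻ high T h))) ⟩
      ∑ High deg ≤⟨ sel-⊆-mono _ T deg ⟩
      ∑ T deg ≤⟨ deg-sum ⟩
      36 * m * length T ∎)
      where lem : ∀ m k x → 36 * m * (k * x) ≡ x * (36 * k * m)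
            lem = solve-∀

    Low≥ : 3 * length T ≤ 4 * length Low
    Low≥ = +-cancelˡ-≤ (length T) _ _ (begin
      length T + 3 * length T ≡⟨⟩
      4 * length T ≡⟨ cong (4 *_) (#-compl T low) ⟨
      4 * (# T low + # T (not ∘ low)) ≡⟨ cong (4 *_) (cong₂ _+_ (length-sel low T) (length-sel (not ∘ low) T)) ⟨
      4 * (length Low + length (sel (not ∘ low) T)) ≡⟨ *-distribˡ-+ 4 (length Low) (length (sel (not ∘ low) T)) ⟩
      4 * length Low + 4 * length (sel (not ∘ low) T) ≤⟨ +-monoʳ-≤ (4 * length Low) NonLow≤ ⟩
      4 * length Low + length T ≡⟨ +-comm (4 * length Low) (length T) ⟩
      length T + 4 * length Low ∎)

    low-degree : ∀ {a} → a ∈ Low → 9 * m ≤ # V₃ (E a) + (# High (R₀ a) + m)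
    low-degree {a} a∈ = begin
      9 * m ≤⟨ deg≥ (proj₁ (∈-sel⁻ low T a∈)) ⟩
      # T (E a) ≤⟨ ∑-mono T (λ {x} _ → split x) ⟩
      ∑ T (λ x → χ (not (high x) ∧ E a x) + (χ (high x ∧ R₀ a x) + χ (rich x))) ≡⟨ trans (∑-+ T _ _) (cong (# T (λ x → not (high x) ∧ E a x) +_) (∑-+ T _ _)) ⟩
      # T (λ x → not (high x) ∧ E a x) + (# T (λ x → high x ∧ R₀ a x) + # T rich)
        ≡⟨ cong₂ (λ p q → p + (q + # T rich)) (#-sel (not ∘ high) T (E a)) (#-sel high T (R₀ a)) ⟨
      # V₃ (E a) + (# High (R₀ a) + # T rich)
        ≤⟨ +-monoʳ-≤ (# V₃ (E a)) (+-monoʳ-≤ (# High (R₀ a)) (≤-trans (sparse (sel (E a) T) (sel-unique _ uT)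
             (≤-trans (≤-reflexive (length-sel (E a) T)) (≤ᵇ≡⇒≤ lo))) g≤m)) ⟩
      # V₃ (E a) + (# High (R₀ a) + m) ∎
      where
      lo : low a ≡ true
      lo = proj₂ (∈-sel⁻ low T a∈)
      rich : Fin n → Bool
      rich x = g ≤ᵇ # (sel (E a) T) (E x)
      split : ∀ x → χ (E a x) ≤ χ (not (high x) ∧ E a x) + (χ (high x ∧ R₀ a x) + χ (rich x))
      split x rewrite lo with high x | E a x | g ≤ᵇ # (sel (E a) T) (E x)
      ... | _     | false | _     = z≤n
      ... | false | true  | _     = s≤s z≤n
      ... | true  | true  | false = s≤s z≤n
      ... | true  | true  | true  = s≤s z≤n

    e-V₃ : 2 * m * length T ≤ ∑ V₃ (λ v → # V₃ (E v))
    e-V₃ = +-cancelʳ-≤ (m * length T + length Low * (5 * m)) _ _ (begin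
      2 * m * length T + (m * length T + length Low * (5 * m)) ≡⟨ lem₁ m (length T) (length Low) ⟩
      m * (3 * length T) + length Low * (5 * m) ≤⟨ +-monoˡ-≤ _ (*-monoʳ-≤ m Low≥) ⟩
      m * (4 * length Low) + length Low * (5 * m) ≡⟨ lem₂ m (length Low) ⟩
      length Low * (9 * m) ≤⟨ ∑≥ Low (9 * m) low-degree ⟩
      ∑ Low (λ a → # V₃ (E a) + (# High (R₀ a) + m)) ≡⟨ trans (∑-+ Low _ _) (cong (∑ Low (λ a → # V₃ (E a)) +_)
          (trans (∑-+ Low _ _) (cong (∑ Low (λ a → # High (R₀ a)) +_) (∑-const Low m)))) ⟩
      ∑ Low (λ a → # V₃ (E a)) + (∑ Low (λ a → # High (R₀ a)) + length Low * m)
        ≤⟨ +-mono-≤ (∑-⊆ _ (sel-unique _ uT) (sel-unique _ uT) λ h → ∈-sel⁺ _ T (proj₁ (∈-sel⁻ low T h))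
              (not-t (low⇒¬high (proj₂ (∈-sel⁻ low T h))))) (+-monoˡ-≤ (length Low * m) cross) ⟩
      ∑ V₃ (λ v → # V₃ (E v)) + (length Low * (4 * m) + length High * (K₁ * m) + length Low * m)
        ≡⟨ cong (∑ V₃ (λ v → # V₃ (E v)) +_) (lem₃ m K₁ (length Low) (length High)) ⟩
      ∑ V₃ (λ v → # V₃ (E v)) + (m * (K₁ * length High) + length Low * (5 * m))
        ≤⟨ +-monoʳ-≤ (∑ V₃ (λ v → # V₃ (E v))) (+-monoˡ-≤ (length Low * (5 * m)) (*-monoʳ-≤ m High≤)) ⟩
      ∑ V₃ (λ v → # V₃ (E v)) + (m * length T + length Low * (5 * m)) ∎)
      where
      lem₁ : ∀ m t l → 2 * m * t + (m * t + l * (5 * m)) ≡ m * (3 * t) + l * (5 * m)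
      lem₁ = solve-∀
      lem₂ : ∀ m l → m * (4 * l) + l * (5 * m) ≡ l * (9 * m)
      lem₂ = solve-∀
      lem₃ : ∀ m k l h → l * (4 * m) + h * (k * m) + l * m ≡ m * (k * h) + l * (5 * m)
      lem₃ = solve-∀

    regular : Regular E m K₁ T
    regular with peel E E-sym (λ _ → m) (length V₃) V₃ ≤-refl (sel-unique _ uT)
    ... | inj₁ c = record
      { V = verts ; uV = unique ; V⊆ = λ h → proj₁ (∈-sel⁻ _ T (inside h)) ; V≢[] = nonempty ; V-deg≥ = degrees
      ; V-deg≤ = λ {v} h → ≤-trans (∑-⊆ _ unique uT λ h → proj₁ (∈-sel⁻ _ T (inside h)))
          (<⇒≤ (≰⇒> λ le → t≢f (≤⇒≤ᵇ≡ le) (not-f (proj₂ (∈-sel⁻ (not ∘ high) T (inside h)))))) }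
      where open Core c
    ... | inj₂ o′ = contradiction e-V₃ (<⇒≱ (begin-strict
      ∑ V₃ (λ v → # V₃ (E v)) ≤⟨ orientation-sum o′ V₃ V₃ (λ h → h) (λ h → h) ⟩
      ∑ V₃ (λ v → # V₃ (out′ v)) + ∑ V₃ (λ v → # V₃ (out′ v)) ≤⟨ +-mono-≤ half half ⟩
      length V₃ * pred m + length V₃ * pred m ≡⟨ lem (length V₃) (pred m) ⟩
      2 * pred m * length V₃ ≤⟨ *-monoʳ-≤ (2 * pred m) (≤-trans (≤-reflexive (length-sel (not ∘ high) T)) (#≤length T _)) ⟩
      2 * pred m * length T <⟨ *-monoˡ-< (length T) {{>-nonZero T≢[]}} (*-monoʳ-< 2 (≤-reflexive (suc-pred m {{>-nonZero 0<m}}))) ⟩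
      2 * m * length T ∎))
      where
      out′ = Orientation.out o′
      half : ∑ V₃ (λ v → # V₃ (out′ v)) ≤ length V₃ * pred m
      half = ∑≤ V₃ (pred m) λ h → s≤s⁻¹ (≤-trans (Orientation.out< o′ h) (≤-reflexive (sym (suc-pred m {{>-nonZero 0<m}}))))
      lem : ∀ a b → a * b + a * b ≡ 2 * b * a
      lem = solve-∀

  dichotomy : Unbalanced E m g K₁ T ⊎ Regular E m K₁ T
  dichotomy with peel R R-sym d (length L) L ≤-refl (sel-unique _ uT)
  ... | inj₁ c = inj₁ (unbalanced c)
  ... | inj₂ o = inj₂ (regular o)

-- Topological minors

some : {A : Set} → (A → Bool) → List A → Bool
some p [] = false
some p (x ∷ xs) = p x ∨ some p xs

some⁻ : {A : Set} (p : A → Bool) (xs : List A) → some p xs ≡ true → ∃ λ x → x ∈ xs × p x ≡ true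
some⁻ p (x ∷ xs) h with ∨-case {p x} h
... | inj₁ e = x , here refl , e
... | inj₂ e with some⁻ p xs e
...   | y , y∈ , q = y , there y∈ , q

some⁺ : {A : Set} (p : A → Bool) {xs : List A} {x : A} → x ∈ xs → p x ≡ true → some p xs ≡ true
some⁺ p (here refl) h = ∨-t₁ h
some⁺ p {y ∷ xs} (there k) h = ∨-t₂ {p y} (some⁺ p k h)

unique-++ : {A : Set} {xs ys : List A} → Unique xs → Unique ys → (∀ {z} → z ∈ xs → z ∈ ys → ⊥) → Unique (xs ++ ys)
unique-++ ux uy dj = Uᵖ.++⁺ ux uy λ (a , b) → dj a b

lookup-injective : {A : Set} {xs : List A} → Unique xs → ∀ {i j} → L.lookup xs i ≡ L.lookup xs j → i ≡ j
lookup-injective (h ∷ u) {zero} {zero} q = refl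
lookup-injective (h ∷ u) {zero} {suc j} q = ⊥-elim (All.lookup h (∈-lookup j) q)
lookup-injective (h ∷ u) {suc i} {zero} q = ⊥-elim (All.lookup h (∈-lookup i) (sym q))
lookup-injective (h ∷ u) {suc i} {suc j} q = cong suc (lookup-injective u q)

maderBound : ℕ → ℕ → ℕ → ℕ
maderBound r t zero = r + t
maderBound r t (suc k) = 2 * maderBound r t k + 2

Walk : {n : ℕ} → (Fin n → Fin n → Bool) → Fin n → List (Fin n) → Set
Walk e x [] = ⊤
Walk e x (y ∷ ys) = e x y ≡ true × Walk e y ys

record Model {n : ℕ} (e : Fin n → Fin n → Bool) (r t : ℕ) (ps : List (Fin r × Fin t)) (W : List (Fin n)) : Set where
  field
    δ : Fin r ⊎ Fin t → Fin n
    δ∈ : ∀ a → δ a ∈ W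
    δ-injective : ∀ {a b} → δ a ≡ δ b → a ≡ b
    P : Fin r × Fin t → List (Fin n)
    P-walk : ∀ {p} → p ∈ ps → Walk e (δ (inj₁ (proj₁ p))) (P p ++ [ δ (inj₂ (proj₂ p)) ])
    P-unique : ∀ {p} → p ∈ ps → Unique (P p)
    P∈ : ∀ {p z} → p ∈ ps → z ∈ P p → z ∈ W
    P≢δ : ∀ {p z} → p ∈ ps → z ∈ P p → ∀ a → z ≢ δ a
    P-disjoint : ∀ {p p′ z} → p ∈ ps → p′ ∈ ps → z ∈ P p → z ∈ P p′ → p ≡ p′

module Minors {n : ℕ} (e : Fin n → Fin n → Bool) (e-sym : ∀ x y → e x y ≡ e y x) (e-irr : ∀ x → e x x ≡ false)
              (r t : ℕ) where

  end : Fin n → List (Fin n) → Fin n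
  end x [] = x
  end x (y ∷ ys) = end y ys

  walk-∷ʳ : ∀ x ys {z} → Walk e x ys → e (end x ys) z ≡ true → Walk e x (ys ++ [ z ])
  walk-∷ʳ x [] w h = h , _
  walk-∷ʳ x (y ∷ ys) (a , w) h = a , walk-∷ʳ y ys w h

  end-∷ʳ : ∀ x ys z → end x (ys ++ [ z ]) ≡ z
  end-∷ʳ x [] z = refl
  end-∷ʳ x (y ∷ ys) z = end-∷ʳ y ys z

  record Path (U : List (Fin n)) (u u′ : Fin n) : Set where
    field
      steps : List (Fin n)
      walk : Walk e u steps
      ends : end u steps ≡ u′
      inside : ∀ {z} → z ∈ u ∷ steps → z ∈ U
      simple : Unique (u ∷ steps)

  Connected : List (Fin n) → Set
  Connected U = ∀ {u u′} → u ∈ U → u′ ∈ U → Path U u u′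

  connected-[] : ∀ v → Connected [ v ]
  connected-[] v (here refl) (here refl) =
    record { steps = [] ; walk = _ ; ends = refl ; inside = λ h → h ; simple = [] ∷ [] }

  connected-∷ : ∀ {U} v {u₀} → v ∉ U → u₀ ∈ U → e v u₀ ≡ true → Connected U → Connected (v ∷ U)
  connected-∷ v v∉ u₀∈ ev con (here refl) (here refl) =
    record { steps = [] ; walk = _ ; ends = refl ; inside = λ { (here q) → here q } ; simple = [] ∷ [] }
  connected-∷ v v∉ u₀∈ ev con (here refl) (there u′∈) =
    record { steps = _ ∷ P.steps ; walk = ev , P.walk ; ends = P.ends
           ; inside = λ { (here q) → here q ; (there h) → there (P.inside h) }
           ; simple = All.tabulate (λ h q → v∉ (subst (_∈ _) (sym q) (P.inside h))) ∷ P.simple }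
    where module P = Path (con u₀∈ u′∈)
  connected-∷ {U} v {u₀} v∉ u₀∈ ev con {u} (there u∈) (here refl) =
    record { steps = P.steps ++ [ v ]
           ; walk = walk-∷ʳ u P.steps P.walk (trans (cong (λ a → e a v) P.ends) (trans (e-sym u₀ v) ev))
           ; ends = end-∷ʳ u P.steps v
           ; inside = inside′
           ; simple = unique-++ P.simple ([] ∷ []) λ { h (here refl) → v∉ (P.inside h) } }
    where
    module P = Path (con u∈ u₀∈)
    inside′ : ∀ {z} → z ∈ u ∷ P.steps ++ [ v ] → z ∈ v ∷ U
    inside′ h with ∈-++-case (u ∷ P.steps) h
    ... | inj₁ k = there (P.inside k)
    ... | inj₂ (here q) = here q
  connected-∷ v v∉ u₀∈ ev con (there u∈) (there u′∈) =
    record { steps = P.steps ; walk = P.walk ; ends = P.ends ; inside = λ h → there (P.inside h) ; simple = P.simple }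
    where module P = Path (con u∈ u′∈)

  degSum : List (Fin n) → ℕ
  degSum W = ∑ W (λ x → # W (e x))

  degSum-∖ : ∀ {R v} → Unique R → v ∈ R → degSum R ≡ degSum (R ∖ v) + 2 * # (R ∖ v) (e v)
  degSum-∖ {R} {v} u v∈ = begin
    ∑ R (λ x → # R (e x)) ≡⟨ ∑-∖ _ u v∈ ⟩
    # R (e v) + ∑ (R ∖ v) (λ x → # R (e x)) ≡⟨ cong₂ _+_ (trans (∑-∖ _ u v∈) (cong (λ b → χ b + # (R ∖ v) (e v)) (e-irr v)))
       (trans (∑-cong (R ∖ v) λ {x} _ → trans (∑-∖ _ u v∈) (cong (λ b → χ b + # (R ∖ v) (e x)) (e-sym x v))) (∑-+ (R ∖ v) _ _)) ⟩
    # (R ∖ v) (e v) + (# (R ∖ v) (e v) + degSum (R ∖ v)) ≡⟨ lem (# (R ∖ v) (e v)) (degSum (R ∖ v)) ⟩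
    degSum (R ∖ v) + 2 * # (R ∖ v) (e v) ∎
    where open ≡-Reasoning
          lem : ∀ a b → a + (a + b) ≡ b + 2 * a
          lem = solve-∀

  record Hub (c : ℕ) (W : List (Fin n)) : Set where
    field
      U N : List (Fin n)
      U⊆ : ∀ {v} → v ∈ U → v ∈ W
      N⊆ : ∀ {v} → v ∈ N → v ∈ W
      uN : Unique N
      N≢[] : 0 < length N
      U∩N : ∀ {v} → v ∈ U → v ∈ N → ⊥
      connected : Connected U
      attached : ∀ {v} → v ∈ N → ∃ λ u → u ∈ U × e v u ≡ true
      degrees : ∀ {v} → v ∈ N → suc c ≤ # N (e v)

  -- Mader's argument: U is grown as long as contracting it leaves a graph with more than
  -- (c + 1) (1 + |R|) edges, R being the remaining vertices.
  grow : ∀ c W fuel (U R : List (Fin n)) → length R ≤ fuel →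
         (∀ {v} → v ∈ U → v ∈ W) → (∀ {v} → v ∈ R → v ∈ W) → Unique R → (∀ {v} → v ∈ U → v ∈ R → ⊥) → Connected U →
         (2 * c + 2) * suc (length R) < degSum R + 2 * # R (λ x → some (e x) U) → Hub c W
  grow c W zero U [] le U⊆ R⊆ uR dj con lt = contradiction lt λ ()
  grow c W (suc fuel) U R le U⊆ R⊆ uR dj con lt
    with search (λ v → # (sel (λ x → some (e x) U) R) (e v) ≤ᵇ c) (sel (λ x → some (e x) U) R)
  ... | inj₁ (v , v∈N , small) = grow c W fuel (v ∷ U) (R ∖ v)
        (s≤s⁻¹ (≤-trans (≤-reflexive (sym (length-∖ uR v∈))) le))
        (λ { (here refl) → R⊆ v∈ ; (there h) → U⊆ h }) (λ h → R⊆ (proj₁ (∈-sel⁻ _ R h))) (sel-unique _ uR)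
        (λ { (here refl) h → ==-f (not-f (proj₂ (∈-sel⁻ _ R h))) refl ; (there k) h → dj k (proj₁ (∈-sel⁻ _ R h)) })
        (connected-∷ v (λ k → dj k v∈) (proj₁ (proj₂ nbr)) (proj₂ (proj₂ nbr)) con)
        (+-cancelʳ-< (2 * c + 2) _ _ (begin-strict
          (2 * c + 2) * suc (length R′) + (2 * c + 2) ≡⟨ lem₁ c (length R′) ⟩
          (2 * c + 2) * suc (suc (length R′)) ≡⟨ cong (λ l → (2 * c + 2) * suc l) (length-∖ uR v∈) ⟨
          (2 * c + 2) * suc (length R) <⟨ lt ⟩
          degSum R + 2 * # R adj ≡⟨ cong₂ (λ a b → a + 2 * b) (degSum-∖ uR v∈) (trans (∑-∖ _ uR v∈) (cong (λ b → χ b + # R′ adj) adj-v)) ⟩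
          degSum R′ + 2 * # R′ (e v) + 2 * (1 + # R′ adj) ≡⟨ lem₂ (degSum R′) (# R′ (e v)) (# R′ adj) ⟩
          degSum R′ + 2 * (# R′ adj + # R′ (e v)) + 2 ≤⟨ +-monoˡ-≤ 2 (+-monoʳ-≤ (degSum R′) (*-monoʳ-≤ 2 gain)) ⟩
          degSum R′ + 2 * (# R′ adj′ + c) + 2 ≡⟨ lem₃ (degSum R′) (# R′ adj′) c ⟩
          degSum R′ + 2 * # R′ adj′ + (2 * c + 2) ∎))
    where
    open ≤-Reasoning
    R′ = R ∖ v
    adj adj′ : Fin n → Bool
    adj x = some (e x) U
    adj′ x = some (e x) (v ∷ U)
    v∈ : v ∈ R
    v∈ = proj₁ (∈-sel⁻ adj R v∈N)
    adj-v : adj v ≡ true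
    adj-v = proj₂ (∈-sel⁻ adj R v∈N)
    nbr = some⁻ (e v) U adj-v
    lem₁ : ∀ c l → (2 * c + 2) * suc l + (2 * c + 2) ≡ (2 * c + 2) * suc (suc l)
    lem₁ = solve-∀
    lem₂ : ∀ a b d → a + 2 * b + 2 * (1 + d) ≡ a + 2 * (d + b) + 2
    lem₂ = solve-∀
    lem₃ : ∀ a b c → a + 2 * (b + c) + 2 ≡ a + 2 * b + (2 * c + 2)
    lem₃ = solve-∀
    common : # R′ (λ x → adj x ∧ e v x) ≤ c
    common = ≤-trans (sel-⊆-mono _ R _) (≤-trans (≤-reflexive (sym (#-sel adj R (e v)))) (≤ᵇ≡⇒≤ small))
    gain : # R′ adj + # R′ (e v) ≤ # R′ adj′ + c
    gain = begin
      # R′ adj + # R′ (e v) ≡⟨ ∑-+ R′ _ _ ⟨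
      ∑ R′ (λ x → χ (adj x) + χ (e v x)) ≤⟨ ∑-mono R′ (λ {x} _ → ≤-trans (split (adj x) (e v x))
          (≤-reflexive (cong (λ b → χ (b ∨ adj x) + χ (adj x ∧ e v x)) (e-sym v x)))) ⟩
      ∑ R′ (λ x → χ (adj′ x) + χ (adj x ∧ e v x)) ≡⟨ ∑-+ R′ _ _ ⟩
      # R′ adj′ + # R′ (λ x → adj x ∧ e v x) ≤⟨ +-monoʳ-≤ (# R′ adj′) common ⟩
      # R′ adj′ + c ∎
      where split : ∀ p q → χ p + χ q ≤ χ (q ∨ p) + χ (p ∧ q)
            split true true = ≤-refl
            split true false = ≤-refl
            split false true = ≤-refl
            split false false = ≤-refl
  ... | inj₂ none with sel (λ x → some (e x) U) R in eq
  ...   | (x₀ ∷ N₀) = record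
          { U = U ; N = N ; U⊆ = U⊆ ; N⊆ = λ h → R⊆ (proj₁ (N⁻ h)) ; uN = subst Unique eq (sel-unique _ uR)
          ; N≢[] = s≤s z≤n ; U∩N = λ k h → dj k (proj₁ (N⁻ h)) ; connected = con
          ; attached = λ {v} h → some⁻ (e v) U (proj₂ (N⁻ h))
          ; degrees = λ {v} h → ≰⇒> λ le → t≢f (≤⇒≤ᵇ≡ le) (none h) }
    where
    N = x₀ ∷ N₀
    N⁻ : ∀ {v} → v ∈ N → v ∈ R × some (e v) U ≡ true
    N⁻ h = ∈-sel⁻ (λ x → some (e x) U) R (subst (_ ∈_) (sym eq) h)
  ...   | [] = restart R le R⊆ uR (<-≤-trans (≤-<-trans (*-monoʳ-≤ (2 * c + 2) (n≤1+n _)) lt)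
                 (≤-reflexive (trans (cong (λ a → degSum R + 2 * a) (trans (sym (length-sel _ R)) (cong length eq))) (+-identityʳ _))))
    where
    restart : ∀ R → length R ≤ suc fuel → (∀ {v} → v ∈ R → v ∈ W) → Unique R → (2 * c + 2) * length R < degSum R → Hub c W
    restart [] _ _ _ lt = contradiction lt λ ()
    restart R@(v ∷ _) le R⊆ uR lt = grow c W fuel [ v ] (R ∖ v)
      (s≤s⁻¹ (≤-trans (≤-reflexive (sym (length-∖ uR (here refl)))) le))
      (λ { (here refl) → R⊆ (here refl) }) (λ h → R⊆ (proj₁ (∈-sel⁻ _ R h))) (sel-unique _ uR)
      (λ { (here refl) h → ==-f (not-f (proj₂ (∈-sel⁻ (λ x → not (x == v)) R h))) refl })
      (connected-[] v)
      (begin-strict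
        (2 * c + 2) * suc (length (R ∖ v)) ≡⟨ cong ((2 * c + 2) *_) (length-∖ uR (here refl)) ⟨
        (2 * c + 2) * length R <⟨ lt ⟩
        degSum R ≡⟨ degSum-∖ uR (here refl) ⟩
        degSum (R ∖ v) + 2 * # (R ∖ v) (e v) ≤⟨ +-monoʳ-≤ (degSum (R ∖ v)) (*-monoʳ-≤ 2
           (#-mono (R ∖ v) λ {x} _ h → ∨-t₁ (trans (e-sym x v) h))) ⟩
        degSum (R ∖ v) + 2 * # (R ∖ v) (λ x → some (e x) [ v ]) ∎)
      where open ≤-Reasoning

  hub : ∀ c W → Unique W → (2 * c + 2) * length W < degSum W → Hub c W
  hub c [] uW lt = contradiction lt λ ()
  hub c W@(v ∷ _) uW lt = grow c W (length W) [ v ] (W ∖ v)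
      (≤-trans (n≤1+n _) (≤-reflexive (sym (length-∖ uW (here refl)))))
      (λ { (here refl) → here refl }) (λ h → proj₁ (∈-sel⁻ _ W h)) (sel-unique _ uW)
      (λ { (here refl) h → ==-f (not-f (proj₂ (∈-sel⁻ (λ x → not (x == v)) W h))) refl })
      (connected-[] v)
      (begin-strict
        (2 * c + 2) * suc (length (W ∖ v)) ≡⟨ cong ((2 * c + 2) *_) (length-∖ uW (here refl)) ⟨
        (2 * c + 2) * length W <⟨ lt ⟩
        degSum W ≡⟨ degSum-∖ uW (here refl) ⟩
        degSum (W ∖ v) + 2 * # (W ∖ v) (e v) ≤⟨ +-monoʳ-≤ (degSum (W ∖ v)) (*-monoʳ-≤ 2
           (#-mono (W ∖ v) λ {x} _ h → ∨-t₁ (trans (e-sym x v) h))) ⟩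
        degSum (W ∖ v) + 2 * # (W ∖ v) (λ x → some (e x) [ v ]) ∎)
      where open ≤-Reasoning

  mader : ∀ ps W → Unique W → maderBound r t (length ps) * length W < degSum W → Model e r t ps W
  mader [] W uW lt = record
    { δ = λ a → L.lookup W (Fin.inject≤ (Fin.join r t a) enough)
    ; δ∈ = λ a → ∈-lookup _
    ; δ-injective = λ {a} {b} q → trans (sym (Fᵖ.splitAt-join r t a)) (trans (cong (Fin.splitAt r)
        (Fᵖ.inject≤-injective enough enough _ _ (lookup-injective uW q))) (Fᵖ.splitAt-join r t b))
    ; P = λ _ → [] ; P-walk = λ () ; P-unique = λ () ; P∈ = λ () ; P≢δ = λ () ; P-disjoint = λ () }
    where
    import Data.Fin as Fin
    enough : r + t ≤ length W
    enough with ∑-find W (λ _ → r + t) (λ x → # W (e x)) (subst (_< degSum W) (trans (*-comm (r + t) _) (sym (∑-const W (r + t)))) lt)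
    ... | x , _ , h = ≤-trans (<⇒≤ h) (#≤length W (e x))
  mader (p₀ ∷ ps) W uW lt = extend (mader ps N uN dense)
    where
    open Hub (hub (maderBound r t (length ps)) W uW lt)
    dense : maderBound r t (length ps) * length N < degSum N
    dense = begin-strict
      maderBound r t (length ps) * length N ≡⟨ *-comm (maderBound r t (length ps)) (length N) ⟩
      length N * maderBound r t (length ps) <⟨ *-monoʳ-< (length N) {{>-nonZero N≢[]}} (n<1+n (maderBound r t (length ps))) ⟩
      length N * suc (maderBound r t (length ps)) ≤⟨ ∑≥ N (suc (maderBound r t (length ps))) degrees ⟩
      degSum N ∎
      where open ≤-Reasoning
    extend : Model e r t ps N → Model e r t (p₀ ∷ ps) W
    extend M = record
      { δ = δ ; δ∈ = λ a → N⊆ (δ∈ a) ; δ-injective = δ-injective ; P = P′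
      ; P-walk = λ h → walk′ (member h) ; P-unique = λ h → unique′ (member h)
      ; P∈ = λ h → P∈′ (member h) ; P≢δ = λ h → P≢δ′ (member h)
      ; P-disjoint = λ h h′ → disjoint′ (member h) (member h′) }
      where
      open Model M
      x y : Fin n
      x = δ (inj₁ (proj₁ p₀))
      y = δ (inj₂ (proj₂ p₀))
      u = proj₁ (attached (δ∈ (inj₁ (proj₁ p₀))))
      v = proj₁ (attached (δ∈ (inj₂ (proj₂ p₀))))
      open Path (connected (proj₁ (proj₂ (attached (δ∈ (inj₁ (proj₁ p₀)))))) (proj₁ (proj₂ (attached (δ∈ (inj₂ (proj₂ p₀)))))))
      same? : (p : Fin r × Fin t) → Dec (p ≡ p₀)
      same? p = ≡-dec Fᵖ._≟_ Fᵖ._≟_ p p₀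
        where open import Data.Product.Properties using (≡-dec)
      P′ : Fin r × Fin t → List (Fin n)
      P′ p with same? p
      ... | yes _ = u ∷ steps
      ... | no _ = P p
      -- Each pair uses either the new path through U, or an old one inside N.
      data Status (p : Fin r × Fin t) : Set where
        new : p ≡ p₀ → P′ p ≡ u ∷ steps → Status p
        old : p ∈ ps → P′ p ≡ P p → Status p
      member : ∀ {p} → p ∈ p₀ ∷ ps → Status p
      member {p} h with same? p in q
      ... | yes refl = new refl (lem q)
        where lem : ∀ {s} → same? p₀ ≡ yes s → P′ p₀ ≡ u ∷ steps
              lem q rewrite q = refl
      member {p} (here h) | no ne = ⊥-elim (ne h)
      member {p} (there h) | no ne = old h lem
        where lem : P′ p ≡ P p
              lem rewrite q = refl
      walk′ : ∀ {p} → Status p → Walk e (δ (inj₁ (proj₁ p))) (P′ p ++ [ δ (inj₂ (proj₂ p)) ])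
      walk′ (new refl q) rewrite q = proj₂ (proj₂ (attached (δ∈ (inj₁ (proj₁ p₀))))) ,
        walk-∷ʳ u steps walk (trans (cong (λ a → e a y) ends) (trans (e-sym v y) (proj₂ (proj₂ (attached (δ∈ (inj₂ (proj₂ p₀))))))))
      walk′ (old h q) rewrite q = P-walk h
      unique′ : ∀ {p} → Status p → Unique (P′ p)
      unique′ (new _ q) rewrite q = simple
      unique′ (old h q) rewrite q = P-unique h
      P∈′ : ∀ {p z} → Status p → z ∈ P′ p → z ∈ W
      P∈′ (new _ q) z∈ rewrite q = U⊆ (inside z∈)
      P∈′ (old h q) z∈ rewrite q = N⊆ (P∈ h z∈)
      P≢δ′ : ∀ {p z} → Status p → z ∈ P′ p → ∀ a → z ≢ δ a
      P≢δ′ (new _ q) z∈ a refl rewrite q = U∩N (inside z∈) (δ∈ a)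
      P≢δ′ (old h q) z∈ rewrite q = P≢δ h z∈
      disjoint′ : ∀ {p p′ z} → Status p → Status p′ → z ∈ P′ p → z ∈ P′ p′ → p ≡ p′
      disjoint′ (new a _) (new b _) _ _ = trans a (sym b)
      disjoint′ (new _ q) (old h q′) z∈ z∈′ rewrite q | q′ = ⊥-elim (U∩N (inside z∈) (P∈ h z∈′))
      disjoint′ (old h q) (new _ q′) z∈ z∈′ rewrite q | q′ = ⊥-elim (U∩N (inside z∈′) (P∈ h z∈))
      disjoint′ (old h q) (old h′ q′) z∈ z∈′ rewrite q | q′ = P-disjoint h h′ z∈ z∈′

-- From topological minors to induced subdivisions

data Next {A : Set} : List A → A → A → Set where
  here : ∀ {x y xs} → Next (x ∷ y ∷ xs) x y
  there : ∀ {x xs u v} → Next xs u v → Next (x ∷ xs) u v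

next-∈ˡ : {A : Set} {xs : List A} {u v : A} → Next xs u v → u ∈ xs
next-∈ˡ here = here refl
next-∈ˡ (there h) = there (next-∈ˡ h)

next-∈ʳ : {A : Set} {xs : List A} {u v : A} → Next xs u v → v ∈ xs
next-∈ʳ here = there (here refl)
next-∈ʳ (there h) = there (next-∈ʳ h)

next-≢ : {A : Set} {xs : List A} {u v : A} → Unique xs → Next xs u v → u ≢ v
next-≢ (h ∷ _) here q = All.lookup h (here refl) q
next-≢ (_ ∷ u) (there h) = next-≢ u h

next-++ˡ : {A : Set} (xs : List A) {z : A} {zs : List A} {u v : A} → Next (xs ++ [ z ]) u v → Next (xs ++ z ∷ zs) u v
next-++ˡ [] (there ())
next-++ˡ (x ∷ []) here = here
next-++ˡ (x ∷ []) (there (there ()))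
next-++ˡ (x ∷ y ∷ xs) here = here
next-++ˡ (x ∷ y ∷ xs) (there h) = there (next-++ˡ (y ∷ xs) h)

next-++ʳ : {A : Set} (xs : List A) {ys : List A} {u v : A} → Next ys u v → Next (xs ++ ys) u v
next-++ʳ [] h = h
next-++ʳ (x ∷ xs) h = there (next-++ʳ xs h)

lastOr : {A : Set} (L : List A) (y : A) → Fin (suc (length L)) → A
lastOr [] y zero = y
lastOr (z ∷ L) y zero = z
lastOr (z ∷ L) y (suc k) = lastOr L y k

node : {A : Set} (x : A) (L : List A) (y : A) → Fin (suc (suc (length L))) → A
node x L y zero = x
node x L y (suc k) = lastOr L y k

lastOr-lowerM : {A : Set} (L : List A) (y : A) (k : Fin (suc (length L))) →
                maybe (L.lookup L) y (lowerM (length L) k) ≡ lastOr L y k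
lastOr-lowerM [] y zero = refl
lastOr-lowerM (z ∷ L) y zero = refl
lastOr-lowerM (z ∷ L) y (suc k) = trans (lem (lowerM (length L) k)) (lastOr-lowerM L y k)
  where lem : ∀ m → maybe (L.lookup (z ∷ L)) y (Maybe.map suc m) ≡ maybe (L.lookup L) y m
        lem (just _) = refl
        lem nothing = refl

next-node : {A : Set} (x : A) (L : List A) (y : A) {u v : A} → Next (x ∷ L ++ [ y ]) u v →
            ∃ λ k → node x L y (inject₁ k) ≡ u × node x L y (suc k) ≡ v
next-node x [] y here = zero , refl , refl
next-node x [] y (there (there ()))
next-node x (z ∷ L) y here = zero , refl , refl
next-node x (z ∷ L) y (there h) with next-node z L y h
... | zero , a , b = suc zero , a , b
... | suc k , a , b = suc (suc k) , a , b

Consecutive : {A : Set} → List A → A → A → Set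
Consecutive xs u v = Next xs u v ⊎ Next xs v u

Placed : {n : ℕ} → (Fin n → Fin n → Bool) → (Fin n → Fin n → List (Fin n)) → List (Fin n) → Fin n → Set
Placed e inner W v = v ∈ W ⊎ (∃ λ x → ∃ λ y → e x y ≡ true × v ∈ inner x y)

SubdivisionIn : {n : ℕ} → (Fin n → Fin n → Bool) → ℕ → ℕ → Set
SubdivisionIn {n} E r t = Σ (Fin r → Fin t → ℕ) λ len → Σ (SubdivV r t len → Fin n) λ f →
  Injective _≡_ _≡_ f ×
  (∀ x y → SubdivAdj len x y → E (f x) (f y) ≡ true) ×
  (∀ x y → E (f x) (f y) ≡ true → SubdivAdj len x y)

module Subdivide {n : ℕ} (E : Fin n → Fin n → Bool) (E-sym : ∀ x y → E x y ≡ E y x)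
  (e : Fin n → Fin n → Bool) (r t : ℕ) (inner : Fin n → Fin n → List (Fin n)) (W : List (Fin n)) where

  module _
    (inner-walk : ∀ {x y} → e x y ≡ true → Walk E x (inner x y ++ [ y ]))
    (inner-unique : ∀ {x y} → e x y ≡ true → Unique (inner x y))
    (inner∉W : ∀ {x y z} → e x y ≡ true → z ∈ inner x y → z ∉ W)
    (inner-disjoint : ∀ {x y x′ y′ z} → e x y ≡ true → e x′ y′ ≡ true → z ∈ inner x y → z ∈ inner x′ y′ →
                      (x ≡ x′ × y ≡ y′) ⊎ (x ≡ y′ × y ≡ x′))
    (W-independent : ∀ {x y} → x ∈ W → y ∈ W → E x y ≡ false)
    (inner-adjacent : ∀ {x y z v} → e x y ≡ true → z ∈ inner x y → Placed e inner W v → E z v ≡ true →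
                      Consecutive (x ∷ inner x y ++ [ y ]) z v)
    where

    expand : Fin n → List (Fin n) → Fin n → List (Fin n)
    expand x [] y = inner x y
    expand x (z ∷ zs) y = inner x z ++ z ∷ expand z zs y

    walk-++ : ∀ x xs {z ys} → Walk E x (xs ++ [ z ]) → Walk E z ys → Walk E x (xs ++ z ∷ ys)
    walk-++ x [] (h , _) w = h , w
    walk-++ x (x′ ∷ xs) (h , w′) w = h , walk-++ x′ xs w′ w

    expand-walk : ∀ x zs y → Walk e x (zs ++ [ y ]) → Walk E x (expand x zs y ++ [ y ])
    expand-walk x [] y (h , _) = inner-walk h
    expand-walk x (z ∷ zs) y (h , w) = subst (Walk E x) (sym (++-assoc (inner x z) (z ∷ expand z zs y) [ y ]))
      (walk-++ x (inner x z) (inner-walk h) (expand-walk z zs y w))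

    walk-next : ∀ x zs → Walk e x zs → ∀ {a b} → Next (x ∷ zs) a b → e a b ≡ true
    walk-next x (z ∷ zs) (h , w) here = h
    walk-next x (z ∷ zs) (h , w) (there k) = walk-next z zs w k

    expand-∈ : ∀ x zs y {v} → v ∈ expand x zs y → v ∈ zs ⊎ (∃ λ a → ∃ λ b → Next (x ∷ zs ++ [ y ]) a b × v ∈ inner a b)
    expand-∈ x [] y h = inj₂ (x , y , here , h)
    expand-∈ x (z ∷ zs) y h with ∈-++-case (inner x z) h
    ... | inj₁ k = inj₂ (x , z , here , k)
    ... | inj₂ (here q) = inj₁ (here q)
    ... | inj₂ (there k) with expand-∈ z zs y k
    ...   | inj₁ k′ = inj₁ (there k′)
    ...   | inj₂ (a , b , nx , k′) = inj₂ (a , b , there nx , k′)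

    expand-next : ∀ x zs y {a b u v} → Next (x ∷ zs ++ [ y ]) a b → Next (a ∷ inner a b ++ [ b ]) u v →
                  Next (x ∷ expand x zs y ++ [ y ]) u v
    expand-next x [] y here h = h
    expand-next x [] y (there (there ()))
    expand-next x (z ∷ zs) y here h =
      subst (λ l → Next (x ∷ l) _ _) (sym (++-assoc (inner x z) (z ∷ expand z zs y) [ y ])) (next-++ˡ (x ∷ inner x z) h)
    expand-next x (z ∷ zs) y (there k) h =
      subst (λ l → Next (x ∷ l) _ _) (sym (++-assoc (inner x z) (z ∷ expand z zs y) [ y ]))
        (next-++ʳ (x ∷ inner x z) (expand-next z zs y k h))

    expand-unique : ∀ x zs y → Unique (x ∷ zs ++ [ y ]) → Walk e x (zs ++ [ y ]) → (∀ {v} → v ∈ zs → v ∈ W) → Unique (expand x zs y)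
    expand-unique x [] y u (h , _) inW = inner-unique h
    expand-unique x (z ∷ zs) y (x∉ ∷ z∉ ∷ u) (h , w) inW =
      unique-++ (inner-unique h) (All.tabulate fresh ∷ expand-unique z zs y (z∉ ∷ u) w (inW ∘ there)) apart
      where
      fresh : ∀ {v} → v ∈ expand z zs y → z ≢ v
      fresh k q with expand-∈ z zs y k
      ... | inj₁ k′ = All.lookup z∉ (∈-++⁺ˡ k′) q
      ... | inj₂ (a , b , nx , k′) = inner∉W (walk-next z (zs ++ [ y ]) w nx) k′ (subst (_∈ W) q (inW (here refl)))
      apart : ∀ {v} → v ∈ inner x z → v ∈ z ∷ expand z zs y → ⊥
      apart k (here refl) = inner∉W h k (inW (here refl))
      apart k (there k′) with expand-∈ z zs y k′
      ... | inj₁ k″ = inner∉W h k (inW (there k″))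
      ... | inj₂ (a , b , nx , k″) with inner-disjoint h (walk-next z (zs ++ [ y ]) w nx) k k″
      ...   | inj₁ (q , _) = All.lookup x∉ (next-∈ˡ nx) q
      ...   | inj₂ (q , _) = All.lookup x∉ (next-∈ʳ nx) q

    module _ (ps : List (Fin r × Fin t)) (all-ps : ∀ p → p ∈ ps) (M : Model e r t ps W) where
      open Model M

      src dst : Fin r × Fin t → Fin n
      src p = δ (inj₁ (proj₁ p))
      dst p = δ (inj₂ (proj₂ p))

      chain link : Fin r × Fin t → List (Fin n)
      chain p = src p ∷ P p ++ [ dst p ]
      link p = expand (src p) (P p) (dst p)

      chain-∈ : ∀ {p z} → z ∈ chain p → z ≡ src p ⊎ z ∈ P p ⊎ z ≡ dst p
      chain-∈ (here q) = inj₁ q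
      chain-∈ {p} (there h) with ∈-++-case (P p) h
      ... | inj₁ k = inj₂ (inj₁ k)
      ... | inj₂ (here q) = inj₂ (inj₂ q)

      src≢dst : ∀ p p′ → src p ≢ dst p′
      src≢dst p p′ q with δ-injective q
      ... | ()

      chain-unique : ∀ p → Unique (chain p)
      chain-unique p = All.tabulate fresh ∷ unique-++ (P-unique (all-ps p)) ([] ∷ [])
          λ { h (here refl) → P≢δ (all-ps p) h _ refl }
        where fresh : ∀ {z} → z ∈ P p ++ [ dst p ] → src p ≢ z
              fresh h q with ∈-++-case (P p) h
              ... | inj₁ k = P≢δ (all-ps p) k _ (sym q)
              ... | inj₂ (here refl) = src≢dst p p q

      edge : ∀ p {a b} → Next (chain p) a b → e a b ≡ true
      edge p nx = walk-next (src p) (P p ++ [ dst p ]) (P-walk (all-ps p)) nx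

      link-∈ : ∀ p {z} → z ∈ link p → z ∈ P p ⊎ (∃ λ a → ∃ λ b → Next (chain p) a b × z ∈ inner a b)
      link-∈ p h = expand-∈ (src p) (P p) (dst p) h

      link-unique : ∀ p → Unique (link p)
      link-unique p = expand-unique (src p) (P p) (dst p) (chain-unique p) (P-walk (all-ps p)) (P∈ (all-ps p))

      link≢δ : ∀ p {z} → z ∈ link p → ∀ a → z ≢ δ a
      link≢δ p h a q with link-∈ p h
      ... | inj₁ k = P≢δ (all-ps p) k a q
      ... | inj₂ (x , y , nx , k) = inner∉W (edge p nx) k (subst (_∈ W) (sym q) (δ∈ a))

      src-≡ : ∀ {p p′} → src p ∈ chain p′ → proj₁ p ≡ proj₁ p′
      src-≡ {p} {p′} h with chain-∈ {p′} h
      ... | inj₁ q with δ-injective q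
      ...   | refl = refl
      src-≡ {p} {p′} h | inj₂ (inj₁ k) = ⊥-elim (P≢δ (all-ps p′) k _ refl)
      src-≡ {p} {p′} h | inj₂ (inj₂ q) = ⊥-elim (src≢dst p p′ q)

      dst-≡ : ∀ {p p′} → dst p ∈ chain p′ → proj₂ p ≡ proj₂ p′
      dst-≡ {p} {p′} h with chain-∈ {p′} h
      ... | inj₁ q = ⊥-elim (src≢dst p′ p (sym q))
      ... | inj₂ (inj₁ k) = ⊥-elim (P≢δ (all-ps p′) k _ refl)
      ... | inj₂ (inj₂ q) with δ-injective q
      ...   | refl = refl

      P-chain : ∀ {p p′ z} → z ∈ P p → z ∈ chain p′ → p ≡ p′
      P-chain {p} {p′} h k with chain-∈ {p′} k
      ... | inj₁ q = ⊥-elim (P≢δ (all-ps p) h _ q)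
      ... | inj₂ (inj₁ k′) = P-disjoint (all-ps p) (all-ps p′) h k′
      ... | inj₂ (inj₂ q) = ⊥-elim (P≢δ (all-ps p) h _ q)

      -- An edge on the chain of p either has an end point in P p or joins src p to dst p.
      shared-edge : ∀ {p p′ a b} → Next (chain p) a b → a ∈ chain p′ → b ∈ chain p′ → p ≡ p′
      shared-edge {p} {p′} nx ha hb with chain-∈ {p} (next-∈ˡ nx) | chain-∈ {p} (next-∈ʳ nx)
      ... | inj₂ (inj₁ k) | _ = P-chain k ha
      ... | _ | inj₂ (inj₁ k) = P-chain k hb
      ... | inj₁ refl | inj₁ q = ⊥-elim (next-≢ (chain-unique p) nx (sym q))
      ... | inj₁ refl | inj₂ (inj₂ refl) = cong₂ _,_ (src-≡ {p} {p′} ha) (dst-≡ {p} {p′} hb)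
      ... | inj₂ (inj₂ refl) | inj₁ refl = cong₂ _,_ (src-≡ {p} {p′} hb) (dst-≡ {p} {p′} ha)
      ... | inj₂ (inj₂ refl) | inj₂ (inj₂ q) = ⊥-elim (next-≢ (chain-unique p) nx (sym q))

      link-disjoint : ∀ p p′ {z} → z ∈ link p → z ∈ link p′ → p ≡ p′
      link-disjoint p p′ h h′ with link-∈ p h | link-∈ p′ h′
      ... | inj₁ k | inj₁ k′ = P-disjoint (all-ps p) (all-ps p′) k k′
      ... | inj₁ k | inj₂ (_ , _ , nx , k′) = ⊥-elim (inner∉W (edge p′ nx) k′ (P∈ (all-ps p) k))
      ... | inj₂ (_ , _ , nx , k) | inj₁ k′ = ⊥-elim (inner∉W (edge p nx) k (P∈ (all-ps p′) k′))
      ... | inj₂ (_ , _ , nx , k) | inj₂ (_ , _ , nx′ , k′) with inner-disjoint (edge p nx) (edge p′ nx′) k k′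
      ...   | inj₁ (refl , refl) = shared-edge {p} {p′} nx (next-∈ˡ nx′) (next-∈ʳ nx′)
      ...   | inj₂ (refl , refl) = shared-edge {p} {p′} nx (next-∈ʳ nx′) (next-∈ˡ nx′)

      len : Fin r → Fin t → ℕ
      len i j = length (link (i , j))

      f : SubdivV r t len → Fin n
      f (inj₁ i) = δ (inj₁ i)
      f (inj₂ (inj₁ j)) = δ (inj₂ j)
      f (inj₂ (inj₂ (p , k))) = L.lookup (link p) k

      f-injective : ∀ {x y} → f x ≡ f y → x ≡ y
      f-injective {inj₁ i} {inj₁ j} q with δ-injective q
      ... | refl = refl
      f-injective {inj₁ i} {inj₂ (inj₁ j)} q with δ-injective q
      ... | ()
      f-injective {inj₁ i} {inj₂ (inj₂ (p , k))} q = ⊥-elim (link≢δ p (∈-lookup k) _ (sym q))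
      f-injective {inj₂ (inj₁ i)} {inj₁ j} q with δ-injective q
      ... | ()
      f-injective {inj₂ (inj₁ i)} {inj₂ (inj₁ j)} q with δ-injective q
      ... | refl = refl
      f-injective {inj₂ (inj₁ i)} {inj₂ (inj₂ (p , k))} q = ⊥-elim (link≢δ p (∈-lookup k) _ (sym q))
      f-injective {inj₂ (inj₂ (p , k))} {inj₁ j} q = ⊥-elim (link≢δ p (∈-lookup k) _ q)
      f-injective {inj₂ (inj₂ (p , k))} {inj₂ (inj₁ j)} q = ⊥-elim (link≢δ p (∈-lookup k) _ q)
      f-injective {inj₂ (inj₂ (p , k))} {inj₂ (inj₂ (p′ , k′))} q
        with link-disjoint p p′ (∈-lookup k) (subst (_∈ link p′) (sym q) (∈-lookup k′))
      ... | refl with lookup-injective (link-unique p) {k} {k′} q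
      ...   | refl = refl

      f-node : ∀ i j k → f (pathVertex len i j k) ≡ node (δ (inj₁ i)) (link (i , j)) (δ (inj₂ j)) k
      f-node i j zero = refl
      f-node i j (suc k) with lowerM (len i j) k | lastOr-lowerM (link (i , j)) (δ (inj₂ j)) k
      ... | just m | q = q
      ... | nothing | q = q

      walk-node : ∀ x L y → Walk E x (L ++ [ y ]) → ∀ k → E (node x L y (inject₁ k)) (node x L y (suc k)) ≡ true
      walk-node x [] y (h , _) zero = h
      walk-node x (z ∷ L) y (h , w) zero = h
      walk-node x (z ∷ L) y (h , w) (suc zero) = walk-node z L y w zero
      walk-node x (z ∷ L) y (h , w) (suc (suc k)) = walk-node z L y w (suc k)

      step-adj : ∀ {x y} → Step len x y → E (f x) (f y) ≡ true
      step-adj (i , j , k , refl , refl) = trans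
        (cong₂ E (f-node i j (inject₁ k)) (f-node i j (suc k)))
        (walk-node (δ (inj₁ i)) (link (i , j)) (δ (inj₂ j)) (expand-walk _ (P (i , j)) _ (P-walk (all-ps (i , j)))) k)

      next-step : ∀ i j {x y} → Next (src (i , j) ∷ link (i , j) ++ [ dst (i , j) ]) (f x) (f y) → Step len x y
      next-step i j nx with next-node (src (i , j)) (link (i , j)) (dst (i , j)) nx
      ... | k , a , b = i , j , k , f-injective (trans (sym a) (sym (f-node i j (inject₁ k)))) ,
                                    f-injective (trans (sym b) (sym (f-node i j (suc k))))

      Located : Fin n → Set
      Located v = v ∈ W ⊎ (∃ λ p → ∃ λ a → ∃ λ b → Next (chain p) a b × v ∈ inner a b)

      locate : ∀ x → Located (f x)
      locate (inj₁ i) = inj₁ (δ∈ _)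
      locate (inj₂ (inj₁ j)) = inj₁ (δ∈ _)
      locate (inj₂ (inj₂ (p , k))) with link-∈ p (∈-lookup k)
      ... | inj₁ h = inj₁ (P∈ (all-ps p) h)
      ... | inj₂ h = inj₂ (p , h)

      placed : ∀ {v} → Located v → Placed e inner W v
      placed (inj₁ h) = inj₁ h
      placed (inj₂ (p , a , b , nx , h)) = inj₂ (a , b , edge p nx , h)

      adj-step : ∀ x y → E (f x) (f y) ≡ true → SubdivAdj len x y
      adj-step x y h with locate x | locate y
      ... | inj₁ a | inj₁ b = ⊥-elim (t≢f h (W-independent a b))
      ... | inj₂ ((i , j) , a , b , nx , k) | l with inner-adjacent (edge (i , j) nx) k (placed l) h
      ...   | inj₁ c = inj₁ (next-step i j (expand-next _ (P (i , j)) _ nx c))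
      ...   | inj₂ c = inj₂ (next-step i j (expand-next _ (P (i , j)) _ nx c))
      adj-step x y h | l@(inj₁ _) | inj₂ ((i , j) , a , b , nx , k)
        with inner-adjacent (edge (i , j) nx) k (placed l) (trans (E-sym (f y) (f x)) h)
      ...   | inj₁ c = inj₂ (next-step i j (expand-next _ (P (i , j)) _ nx c))
      ...   | inj₂ c = inj₁ (next-step i j (expand-next _ (P (i , j)) _ nx c))

      copy : SubdivisionIn E r t
      copy = len , f , f-injective ,
        (λ { x y (inj₁ s) → step-adj s ; x y (inj₂ s) → trans (E-sym (f x) (f y)) (step-adj s) }) , adj-step

-- Assembling an induced subdivision from selected connecting paths

pairwise : {A : Set} {D : A → A → Set} → (∀ {x y} → D x y → D y x) → {xs : List A} → AllPairs D xs →
           ∀ {x y} → x ∈ xs → y ∈ xs → x ≡ y ⊎ D x y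
pairwise D-sym (h ∷ ap) (here refl) (here refl) = inj₁ refl
pairwise D-sym (h ∷ ap) (here refl) (there k) = inj₂ (All.lookup h k)
pairwise D-sym (h ∷ ap) (there k) (here refl) = inj₂ (D-sym (All.lookup h k))
pairwise D-sym (h ∷ ap) (there k) (there k′) = pairwise D-sym ap k k′

if-t : {A : Set} {b : Bool} {x y : A} → b ≡ true → (if b then x else y) ≡ x
if-t refl = refl

if-f : {A : Set} {b : Bool} {x y : A} → b ≡ false → (if b then x else y) ≡ y
if-f refl = refl

edges : (r t : ℕ) → List (Fin r × Fin t)
edges r t = allFin r ⊗ λ _ → allFin t

minorBound : ℕ → ℕ → ℕ
minorBound r t = maderBound r t (length (edges r t))

record Separate {n : ℕ} (E : Fin n → Fin n → Bool) {X : Set} (src dst : X → Fin n) (inn : X → List (Fin n)) (τ τ′ : X) : Set where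
  field
    pair≢ : ¬ (src τ ≡ src τ′ × dst τ ≡ dst τ′)
    pair≢′ : ¬ (src τ ≡ dst τ′ × dst τ ≡ src τ′)
    inn≢ : ∀ {z z′} → z ∈ inn τ → z′ ∈ inn τ′ → z ≢ z′
    inn≁ : ∀ {z z′} → z ∈ inn τ → z′ ∈ inn τ′ → E z z′ ≡ false

module Assemble {n : ℕ} (E : Fin n → Fin n → Bool) (E-sym : ∀ x y → E x y ≡ E y x)
  (r t : ℕ) {X : Set} (src dst : X → Fin n) (inn : X → List (Fin n)) (rev : X → X)
  (rev-src : ∀ τ → src (rev τ) ≡ dst τ) (rev-dst : ∀ τ → dst (rev τ) ≡ src τ)
  (rev-inn : ∀ {τ z} → z ∈ inn (rev τ) → z ∈ inn τ)
  (I : List X) (W : List (Fin n)) (uW : Unique W)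
  where

  separate-sym : ∀ {τ τ′} → Separate E src dst inn τ τ′ → Separate E src dst inn τ′ τ
  separate-sym s = record
    { pair≢ = λ (a , b) → pair≢ (sym a , sym b) ; pair≢′ = λ (a , b) → pair≢′ (sym b , sym a)
    ; inn≢ = λ h h′ q → inn≢ h′ h (sym q) ; inn≁ = λ {z} {z′} h h′ → trans (E-sym z z′) (inn≁ h′ h) }
    where open Separate s

  joins : Fin n → Fin n → X → Bool
  joins x y τ = (src τ == x) ∧ (dst τ == y)

  edgeIn : List X → Fin n → Fin n → Bool
  edgeIn J x y = some (λ τ → joins x y τ ∨ joins y x τ) J

  innerIn : List X → Fin n → Fin n → List (Fin n)
  innerIn [] x y = []
  innerIn (τ ∷ J) x y = if joins x y τ then inn τ else if joins y x τ then inn (rev τ) else innerIn J x y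

  edgeIn-sym : ∀ J x y → edgeIn J x y ≡ edgeIn J y x
  edgeIn-sym [] x y = refl
  edgeIn-sym (τ ∷ J) x y = cong₂ _∨_ (∨-comm (joins x y τ) (joins y x τ)) (edgeIn-sym J x y)
    where open import Data.Bool.Properties using (∨-comm)

  e : Fin n → Fin n → Bool
  e = edgeIn I

  inner : Fin n → Fin n → List (Fin n)
  inner = innerIn I

  joins⁻ : ∀ {x y τ} → joins x y τ ≡ true → src τ ≡ x × dst τ ≡ y
  joins⁻ {x} {y} {τ} h = ==⇒≡ (∧-t₁ h) , ==⇒≡ (∧-t₂ {src τ == x} h)

  record Joined (J : List X) (x y : Fin n) : Set where
    field
      τ σ : X
      τ∈ : τ ∈ J
      σ≡ : σ ≡ τ ⊎ σ ≡ rev τ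
      src≡ : src σ ≡ x
      dst≡ : dst σ ≡ y
      inner≡ : innerIn J x y ≡ inn σ

  joined : ∀ J {x y} → edgeIn J x y ≡ true → Joined J x y
  joined (τ ∷ J) {x} {y} h with joins x y τ in p
  ... | true = record { τ = τ ; σ = τ ; τ∈ = here refl ; σ≡ = inj₁ refl ; src≡ = proj₁ (joins⁻ {τ = τ} p)
                      ; dst≡ = proj₂ (joins⁻ {τ = τ} p) ; inner≡ = if-t p }
  ... | false with joins y x τ in q
  ...   | true = record { τ = τ ; σ = rev τ ; τ∈ = here refl ; σ≡ = inj₂ refl
            ; src≡ = trans (rev-src τ) (proj₂ (joins⁻ {τ = τ} q)) ; dst≡ = trans (rev-dst τ) (proj₁ (joins⁻ {τ = τ} q))
            ; inner≡ = trans (if-f p) (if-t q) }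
  ...   | false = record { τ = J′.τ ; σ = J′.σ ; τ∈ = there J′.τ∈ ; σ≡ = J′.σ≡ ; src≡ = J′.src≡ ; dst≡ = J′.dst≡
            ; inner≡ = trans (if-f p) (trans (if-f q) J′.inner≡) }
    where module J′ = Joined (joined J h)

  Consec : X → Fin n → Fin n → Set
  Consec σ = Consecutive (src σ ∷ inn σ ++ [ dst σ ])

  module _ (good : X → Set) (good-τ : ∀ {τ} → τ ∈ I → good τ) (good-rev : ∀ {τ} → τ ∈ I → good (rev τ))
    (src≢dst : ∀ {τ} → good τ → src τ ≢ dst τ)
    (src∈ : ∀ {τ} → τ ∈ I → src τ ∈ W)
    (dst∈ : ∀ {τ} → τ ∈ I → dst τ ∈ W)
    (inn-walk : ∀ {τ} → good τ → Walk E (src τ) (inn τ ++ [ dst τ ]))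
    (inn-unique : ∀ {τ} → good τ → Unique (inn τ))
    (inn∉W : ∀ {τ z} → good τ → z ∈ inn τ → z ∉ W)
    (W-indep : ∀ {x y} → x ∈ W → y ∈ W → E x y ≡ false)
    (end-adj : ∀ {τ z v} → good τ → z ∈ inn τ → v ∈ W → E z v ≡ true → Consec τ z v)
    (inn-adj : ∀ {τ z v} → good τ → z ∈ inn τ → v ∈ inn τ → E z v ≡ true → Consec τ z v)
    (rev-inn′ : ∀ {τ z} → z ∈ inn τ → z ∈ inn (rev τ))
    (separate : AllPairs (Separate E src dst inn) I)
    (many : minorBound r t * length W < length I)
    where

    good-either : ∀ {τ σ} → τ ∈ I → σ ≡ τ ⊎ σ ≡ rev τ → good σ
    good-either h (inj₁ refl) = good-τ h
    good-either h (inj₂ refl) = good-rev h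

    e-irr : ∀ x → e x x ≡ false
    e-irr x = ¬t⇒f λ h → let open Joined (joined I {x} {x} h) in
      src≢dst (good-either τ∈ σ≡) (trans src≡ (sym dst≡))

    module _ {x y : Fin n} (h : e x y ≡ true) where
      open Joined (joined I h) public

      good-σ : good σ
      good-σ = good-either τ∈ σ≡

      inner-τ : ∀ {z} → z ∈ inner x y → z ∈ inn τ
      inner-τ {z} z∈ = lem σ≡ (subst (z ∈_) inner≡ z∈)
        where lem : σ ≡ τ ⊎ σ ≡ rev τ → z ∈ inn σ → z ∈ inn τ
              lem (inj₁ q) k = subst (λ s → z ∈ inn s) q k
              lem (inj₂ q) k = rev-inn (subst (λ s → z ∈ inn s) q k)

      τ-inner : ∀ {z} → z ∈ inn τ → z ∈ inn σ
      τ-inner {z} z∈ with σ≡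
      ... | inj₁ q = subst (λ s → z ∈ inn s) (sym q) z∈
      ... | inj₂ q = subst (λ s → z ∈ inn s) (sym q) (rev-inn′ z∈)

      ends-τ : (x ≡ src τ × y ≡ dst τ) ⊎ (x ≡ dst τ × y ≡ src τ)
      ends-τ = lem σ≡ src≡ dst≡
        where
        lem : ∀ {s} → s ≡ τ ⊎ s ≡ rev τ → src s ≡ x → dst s ≡ y → (x ≡ src τ × y ≡ dst τ) ⊎ (x ≡ dst τ × y ≡ src τ)
        lem (inj₁ refl) a b = inj₁ (sym a , sym b)
        lem (inj₂ refl) a b = inj₂ (trans (sym a) (rev-src τ) , trans (sym b) (rev-dst τ))

    same-τ : ∀ {x y x′ y′} (h : e x y ≡ true) (h′ : e x′ y′ ≡ true) → τ h ≡ τ h′ → (x ≡ x′ × y ≡ y′) ⊎ (x ≡ y′ × y ≡ x′)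
    same-τ h h′ q with ends-τ h | ends-τ h′
    ... | inj₁ (a , b) | inj₁ (c , d) = inj₁ (trans a (trans (cong src q) (sym c)) , trans b (trans (cong dst q) (sym d)))
    ... | inj₁ (a , b) | inj₂ (c , d) = inj₂ (trans a (trans (cong src q) (sym d)) , trans b (trans (cong dst q) (sym c)))
    ... | inj₂ (a , b) | inj₁ (c , d) = inj₂ (trans a (trans (cong dst q) (sym d)) , trans b (trans (cong src q) (sym c)))
    ... | inj₂ (a , b) | inj₂ (c , d) = inj₁ (trans a (trans (cong dst q) (sym c)) , trans b (trans (cong src q) (sym d)))

    degSum≥ : ∀ J → (∀ {τ} → τ ∈ J → τ ∈ I) → AllPairs (Separate E src dst inn) J → length J ≤ ∑ W (λ x → # W (edgeIn J x))
    degSum≥ [] sub ap = z≤n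
    degSum≥ (τ₀ ∷ J) sub (h ∷ ap) = begin
      1 + length J ≤⟨ +-mono-≤ one (degSum≥ J (sub ∘ there) ap) ⟩
      ∑ W (λ x → # W (λ y → joins x y τ₀)) + ∑ W (λ x → # W (edgeIn J x)) ≡⟨ trans (∑-cong W λ _ → ∑-+ W _ _) (∑-+ W _ _) ⟨
      ∑ W (λ x → ∑ W (λ y → χ (joins x y τ₀) + χ (edgeIn J x y))) ≤⟨ ∑-mono W (λ {x} _ → ∑-mono W λ {y} _ → exclusive x y) ⟩
      ∑ W (λ x → # W (edgeIn (τ₀ ∷ J) x)) ∎
      where
      open ≤-Reasoning
      one : 1 ≤ ∑ W (λ x → # W (λ y → joins x y τ₀))
      one = ≤-trans (≤-trans (≤-reflexive (cong χ (sym (∧-t (==-refl (src τ₀)) (==-refl (dst τ₀))))))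
          (∑-∈ W (λ y → χ (joins (src τ₀) y τ₀)) (dst∈ (sub (here refl)))))
        (∑-∈ W (λ x → # W (λ y → joins x y τ₀)) (src∈ (sub (here refl))))
      exclusive : ∀ x y → χ (joins x y τ₀) + χ (edgeIn J x y) ≤ χ ((joins x y τ₀ ∨ joins y x τ₀) ∨ edgeIn J x y)
      exclusive x y with joins x y τ₀ in p | edgeIn J x y in q
      ... | true | false = ≤-refl
      ... | false | true = χ-mono {true} λ _ → ∨-t₂ {joins y x τ₀} refl
      ... | false | false = z≤n
      ... | true | true with joins⁻ {τ = τ₀} p | joined J {x} {y} q
      ...   | a , b | record { τ = τ ; τ∈ = τ∈ ; σ≡ = inj₁ refl ; src≡ = c ; dst≡ = d } =
               ⊥-elim (Separate.pair≢ (All.lookup h τ∈) (trans a (sym c) , trans b (sym d)))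
      ...   | a , b | record { τ = τ ; τ∈ = τ∈ ; σ≡ = inj₂ refl ; src≡ = c ; dst≡ = d } =
               ⊥-elim (Separate.pair≢′ (All.lookup h τ∈) (trans a (trans (sym c) (rev-src τ)) , trans b (trans (sym d) (rev-dst τ))))

    inner∉W : ∀ {x y z} → e x y ≡ true → z ∈ inner x y → z ∉ W
    inner∉W h z∈ = inn∉W (good-τ (τ∈ h)) (inner-τ h z∈)

    inner-disjoint : ∀ {x y x′ y′ z} → e x y ≡ true → e x′ y′ ≡ true → z ∈ inner x y → z ∈ inner x′ y′ →
                     (x ≡ x′ × y ≡ y′) ⊎ (x ≡ y′ × y ≡ x′)
    inner-disjoint h h′ z∈ z∈′ with pairwise separate-sym separate (τ∈ h) (τ∈ h′)
    ... | inj₁ q = same-τ h h′ q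
    ... | inj₂ s = ⊥-elim (Separate.inn≢ s (inner-τ h z∈) (inner-τ h′ z∈′) refl)

    inner-adjacent : ∀ {x y z v} → e x y ≡ true → z ∈ inner x y → Placed e inner W v → E z v ≡ true →
                     Consecutive (x ∷ inner x y ++ [ y ]) z v
    inner-adjacent {x} {y} {z} {v} h z∈ pl a = transport (cases pl)
      where
      z∈σ : z ∈ inn (σ h)
      z∈σ = subst (z ∈_) (inner≡ h) z∈
      transport : Consec (σ h) z v → Consecutive (x ∷ inner x y ++ [ y ]) z v
      transport c = subst (λ l → Consecutive l z v)
        (cong₂ _∷_ (src≡ h) (cong₂ (λ l w → l ++ [ w ]) (sym (inner≡ h)) (dst≡ h))) c
      cases : Placed e inner W v → Consec (σ h) z v
      cases (inj₁ v∈) = end-adj (good-σ h) z∈σ v∈ a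
      cases (inj₂ (x′ , y′ , h′ , v∈)) with pairwise separate-sym separate (τ∈ h) (τ∈ h′)
      ... | inj₁ q = inn-adj (good-σ h) z∈σ (τ-inner h (subst (λ s → v ∈ inn s) (sym q) (inner-τ h′ v∈))) a
      ... | inj₂ s = ⊥-elim (t≢f a (Separate.inn≁ s (inner-τ h z∈) (inner-τ h′ v∈)))

    copy : SubdivisionIn E r t
    copy = Subdivide.copy E E-sym e r t inner W
      (λ {x} {y} h → subst (λ l → Walk E x (l ++ [ y ])) (sym (inner≡ h))
        (subst₂ (λ a b → Walk E a (inn (σ h) ++ [ b ])) (src≡ h) (dst≡ h) (inn-walk (good-σ h))))
      (λ h → subst Unique (sym (inner≡ h)) (inn-unique (good-σ h)))
      inner∉W inner-disjoint W-indep inner-adjacent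
      (edges r t) (λ (i , j) → ∈-⊗⁺ (allFin r) (λ _ → allFin t) (∈-allFin i) (∈-allFin j))
      (Minors.mader e (edgeIn-sym I) e-irr r t (edges r t) W uW (≤-trans many (degSum≥ I (λ h → h) separate)))

-- The unbalanced case: a 1-subdivision

allPairs-map : {A : Set} {D D′ : A → A → Set} {xs : List A} → (∀ {x y} → x ∈ xs → y ∈ xs → D x y → D′ x y) →
               AllPairs D xs → AllPairs D′ xs
allPairs-map h [] = []
allPairs-map {xs = x ∷ xs} h (d ∷ ap) =
  All.tabulate (λ y∈ → h (here refl) (there y∈) (All.lookup d y∈)) ∷ allPairs-map (λ a b → h (there a) (there b)) ap

∨-f₁ : {p q : Bool} → p ∨ q ≡ false → p ≡ false
∨-f₁ {false} h = refl

∨-f₂ : {p q : Bool} → p ∨ q ≡ false → q ≡ false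
∨-f₂ {false} h = h

χ*-mono : ∀ {p q} {a b} → (p ≡ true → q ≡ true) → (p ≡ true → a ≤ b) → χ p * a ≤ χ q * b
χ*-mono {true} h k = *-mono-≤ (χ-mono h) (k refl)
χ*-mono {false} h k = z≤n

#-sub : ∀ {n} {xs ys : List (Fin n)} (p : Fin n → Bool) → Unique xs → Unique ys → (∀ {x} → x ∈ xs → x ∈ ys) → # xs p ≤ # ys p
#-sub p = ∑-⊆ (χ ∘ p)

module Ends {X : Set} {n : ℕ} (src dst : X → Fin n) (I : List X) (P : List (Fin n)) (S : Vec Bool n) where

  isEnd : Fin n → Bool
  isEnd x = some (λ τ → (src τ == x) ∨ (dst τ == x)) I

  W : List (Fin n)
  W = sel isEnd (sel (lookup S) P)

  |W|≤ : length W ≤ # P (lookup S)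
  |W|≤ = ≤-trans (≤-reflexive (length-sel isEnd (sel (lookup S) P)))
    (≤-trans (#≤length (sel (lookup S) P) isEnd) (≤-reflexive (length-sel (lookup S) P)))

  W⁻ : ∀ {x} → x ∈ W → x ∈ P × lookup S x ≡ true × (∃ λ τ → τ ∈ I × (x ≡ src τ ⊎ x ≡ dst τ))
  W⁻ {x} h = proj₁ (∈-sel⁻ (lookup S) P (proj₁ (∈-sel⁻ isEnd (sel (lookup S) P) h))) , proj₂ (∈-sel⁻ (lookup S) P (proj₁ (∈-sel⁻ isEnd (sel (lookup S) P) h))) ,
    τ , τ∈ , split (∨-case {src τ == x} e)
    where
    found = some⁻ (λ τ → (src τ == x) ∨ (dst τ == x)) I (proj₂ (∈-sel⁻ isEnd (sel (lookup S) P) h))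
    τ = proj₁ found
    τ∈ = proj₁ (proj₂ found)
    e = proj₂ (proj₂ found)
    split : src τ == x ≡ true ⊎ dst τ == x ≡ true → x ≡ src τ ⊎ x ≡ dst τ
    split (inj₁ q) = inj₁ (sym (==⇒≡ q))
    split (inj₂ q) = inj₂ (sym (==⇒≡ q))

  src∈W : ∀ {τ} → τ ∈ I → src τ ∈ P → lookup S (src τ) ≡ true → src τ ∈ W
  src∈W {τ} τ∈ p s = ∈-sel⁺ isEnd (sel (lookup S) P) (∈-sel⁺ (lookup S) P p s) (some⁺ _ τ∈ (∨-t₁ (==-refl (src τ))))

  dst∈W : ∀ {τ} → τ ∈ I → dst τ ∈ P → lookup S (dst τ) ≡ true → dst τ ∈ W
  dst∈W {τ} τ∈ p s = ∈-sel⁺ isEnd (sel (lookup S) P) (∈-sel⁺ (lookup S) P p s) (some⁺ _ τ∈ (∨-t₂ {src τ == dst τ} (==-refl (dst τ))))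

module UnbalancedCase {n : ℕ} (E : Fin n → Fin n → Bool) (E-sym : ∀ x y → E x y ≡ E y x) (E-irr : ∀ x → E x x ≡ false)
  (r t m g K₁ : ℕ) (0<m : 0 < m) (g≤m : g ≤ m) (T : List (Fin n)) (uT : Unique T)
  (out : Fin n → Fin n → Bool) (out≤ : ∀ {v} → v ∈ T → # T (out v) ≤ 18 * m)
  (covers : ∀ {v w} → v ∈ T → w ∈ T → E v w ≡ true → out v w ∨ out w v ≡ true)
  (sparse : ∀ X → Unique X → length X ≤ K₁ * m → # T (λ y → g ≤ᵇ # X (E y)) ≤ g)
  (K₁-large : 4 * (minorBound r t * (692 * 720)) < K₁)
  (U : Unbalanced E m g K₁ T) where

  open Unbalanced U
  open ≤-Reasoning

  -- Vertices are sampled with probability 1 / Q, where Q is four times the number 180 m of vertices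
  -- that the ends of a path exclude from the sample; a surviving path has k / 4 expected conflicts.
  C Q k : ℕ
  C = minorBound r t
  Q = 720 * m
  k = 692 * m

  Obj : Set
  Obj = Fin n × Fin n × Fin n

  src mid dst : Obj → Fin n
  src = proj₁
  mid τ = proj₁ (proj₂ τ)
  dst τ = proj₂ (proj₂ τ)

  F : Fin n → List (Fin n)
  F u = take (K₁ * m) (sel (λ a → R a u) A)

  F⁻ : ∀ {u a} → a ∈ F u → a ∈ A × R a u ≡ true
  F⁻ {u} h = ∈-sel⁻ (λ a → R a u) A (∈-take (K₁ * m) _ h)

  uF : ∀ u → Unique (F u)
  uF u = Uᵖ.take⁺ (K₁ * m) (sel-unique _ uA)

  F-length : ∀ {u} → u ∈ B → length (F u) ≡ K₁ * m
  F-length {u} u∈ = trans (length-take (K₁ * m) _) (m≤n⇒m⊓n≡m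
    (≤-trans (R-degB u∈) (≤-reflexive (sym (length-sel (λ a → R a u) A)))))

  rich : Fin n → Fin n → Bool
  rich u v = g ≤ᵇ # (F u) (E v)

  fits : Fin n → Fin n → Fin n → Bool
  fits u a v = R a v ∧ not (v == u) ∧ not (E u v) ∧ not (rich u v)

  N : Fin n → Fin n → List (Fin n)
  N u a = sel (fits u a) B

  𝒯 : List Obj
  𝒯 = B ⊗ λ u → F u ⊗ λ a → N u a

  record Facts (τ : Obj) : Set where
    field
      src∈ : src τ ∈ B
      dst∈ : dst τ ∈ B
      mid∈ : mid τ ∈ A
      src≢dst : src τ ≢ dst τ
      src≁dst : E (src τ) (dst τ) ≡ false
      mid~src : E (mid τ) (src τ) ≡ true
      mid~dst : E (mid τ) (dst τ) ≡ true

  facts : ∀ {τ} → τ ∈ 𝒯 → Facts τ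
  facts {u , a , v} h = record
    { src∈ = proj₁ z ; dst∈ = proj₁ v⁻ ; mid∈ = proj₁ (F⁻ a∈)
    ; src≢dst = λ q → ==-f {x = v} {u} (not-f (∧-t₁ (∧-t₂ {R a v} (proj₂ v⁻)))) (sym q)
    ; src≁dst = not-f (∧-t₁ (∧-t₂ {not (v == u)} (∧-t₂ {R a v} (proj₂ v⁻))))
    ; mid~src = R⇒E (proj₂ (F⁻ a∈)) ; mid~dst = R⇒E (∧-t₁ (proj₂ v⁻)) }
    where
    z = ∈-⊗⁻ B (λ u → F u ⊗ λ a → N u a) h
    z′ = ∈-⊗⁻ (F u) (λ a → N u a) (proj₂ z)
    a∈ : a ∈ F u
    a∈ = proj₁ z′
    v⁻ = ∈-sel⁻ (fits u a) B (proj₂ z′)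

  N-length : ∀ {u a} → u ∈ B → a ∈ F u → m ≤ length (N u a)
  N-length {u} {a} u∈ a∈ = +-cancelʳ-≤ (m + (m + m)) _ _ (begin
    m + (m + (m + m)) ≡⟨ lem m ⟩
    4 * m ≤⟨ R-degA (proj₁ (F⁻ a∈)) ⟩
    # B (R a) ≤⟨ ∑-mono B (λ {v} _ → split v) ⟩
    ∑ B (λ v → χ (fits u a v) + (χ (v == u) + (χ (E a v ∧ E u v) + χ (rich u v))))
      ≡⟨ trans (∑-+ B _ _) (cong (# B (fits u a) +_) (trans (∑-+ B _ _) (cong (# B (_== u) +_) (∑-+ B _ _)))) ⟩
    # B (fits u a) + (# B (_== u) + (# B (λ v → E a v ∧ E u v) + # B (rich u)))
      ≤⟨ +-mono-≤ (≤-reflexive (sym (length-sel (fits u a) B))) (+-mono-≤ (≤-trans (#-point u uB) 0<m) (+-mono-≤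
           (≤-trans (#-sub _ uB uT B⊆) (≤-trans (≤-reflexive (sym (#-sel (E a) T (E u)))) (≤-trans (R⇒codeg (proj₂ (F⁻ a∈))) g≤m)))
           (≤-trans (#-sub _ uB uT B⊆) (≤-trans (sparse (F u) (uF u) (≤-reflexive (F-length u∈))) g≤m)))) ⟩
    length (N u a) + (m + (m + m)) ∎)
    where
    lem : ∀ m → m + (m + (m + m)) ≡ 4 * m
    lem = solve-∀
    split : ∀ v → χ (R a v) ≤ χ (fits u a v) + (χ (v == u) + (χ (E a v ∧ E u v) + χ (rich u v)))
    split v with R a v in q
    ... | false = z≤n
    ... | true rewrite R⇒E {a} {v} q with v == u | E u v | rich u v
    ...   | true | _ | _ = s≤s z≤n
    ...   | false | true | _ = s≤s z≤n
    ...   | false | false | true = s≤s z≤n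
    ...   | false | false | false = s≤s z≤n

  𝒯-length : length B * (K₁ * m * m) ≤ length 𝒯
  𝒯-length = begin
    length B * (K₁ * m * m) ≤⟨ ∑≥ B (K₁ * m * m) (λ {u} u∈ → ≤-trans (≤-reflexive (cong (_* m) (sym (F-length u∈))))
        (≤-trans (∑≥ (F u) m (N-length u∈)) (≤-reflexive (sym (length-⊗ (F u) (N u)))))) ⟩
    ∑ B (λ u → length (F u ⊗ N u)) ≡⟨ length-⊗ B (λ u → F u ⊗ N u) ⟨
    length 𝒯 ∎

  killed : Obj → Fin n → Bool
  killed (u , a , v) x = E a x ∨ (out u x ∨ out v x)

  killed≤ : ∀ {τ} → τ ∈ 𝒯 → 4 * # B (killed τ) ≤ Q
  killed≤ {τ@(u , a , v)} h = begin
    4 * # B (killed τ) ≤⟨ *-monoʳ-≤ 4 (≤-trans (#-∨ B _ _) (+-mono-≤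
         (≤-trans (#-sub _ uB uT B⊆) (A-deg mid∈))
         (≤-trans (#-∨ B _ _) (+-mono-≤ (≤-trans (#-sub _ uB uT B⊆) (out≤ (B⊆ src∈))) (≤-trans (#-sub _ uB uT B⊆) (out≤ (B⊆ dst∈))))))) ⟩
    4 * (144 * m + (18 * m + 18 * m)) ≡⟨ lem m ⟩
    Q ∎
    where
    open Facts (facts h)
    lem : ∀ m → 4 * (144 * m + (18 * m + 18 * m)) ≡ 720 * m
    lem = solve-∀

  near : Fin n → Fin n → Bool
  near a a′ = out a a′ ∨ a′ == a

  same : Obj → Obj → Bool
  same (u , a , v) (u′ , a′ , v′) = u′ == u ∧ v′ == v ∨ u′ == v ∧ v′ == u

  con : Obj → Obj → Bool
  con τ τ′ = near (mid τ) (mid τ′) ∨ same τ τ′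

  open Selection Q k C 𝒯 B src dst killed con using (weight; weight≤; weight≤Q; Selected; selected)

  0<Q : 0 < Q
  0<Q = *-mono-≤ (s≤s (z≤n {719})) 0<m

  weights : ∀ τ {a} → a ∈ A → ∑ B (λ v → χ (E a v) * weight τ v) ≤ 3 * Q
  weights τ {a} a∈ = begin
    ∑ B (λ v → χ (E a v) * weight τ v) ≤⟨ ∑-mono B (λ {v} _ → each v) ⟩
    ∑ B (λ v → χ (E a v) + (χ (v == src τ) * Q + χ (v == dst τ) * Q)) ≡⟨ trans (∑-+ B _ _) (cong (# B (E a) +_) (∑-+ B _ _)) ⟩
    # B (E a) + (∑ B (λ v → χ (v == src τ) * Q) + ∑ B (λ v → χ (v == dst τ) * Q)) ≤⟨ +-mono-≤
        (≤-trans (#-sub _ uB uT B⊆) (≤-trans (A-deg a∈) (*-monoˡ-≤ m (m≤m+n 144 576))))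
        (+-mono-≤ (∑-point (src τ) (λ _ → Q) uB) (∑-point (dst τ) (λ _ → Q) uB)) ⟩
    Q + (Q + Q) ≡⟨ lem Q ⟩
    3 * Q ∎
    where
    lem : ∀ q → q + (q + q) ≡ 3 * q
    lem = solve-∀
    each : ∀ v → χ (E a v) * weight τ v ≤ χ (E a v) + (χ (v == src τ) * Q + χ (v == dst τ) * Q)
    each v with E a v
    ... | true = ≤-trans (≤-reflexive (*-identityˡ _)) (weight≤ τ v)
    ... | false = z≤n

  pair-count : ∀ x y → ∑ (F x) (λ a → # (N x a) (_== y)) ≤ g
  pair-count x y with rich x y in q
  ... | true = ≤-trans (≤-reflexive (trans (∑-cong (F x) λ {a} _ → zero′ a) (∑-zero (F x)))) z≤n
    where
    zero′ : ∀ a → # (N x a) (_== y) ≡ 0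
    zero′ a = trans (∑-cong (N x a) λ {z} z∈ → cong χ (≢⇒== λ { refl →
        t≢f q (not-f (∧-t₂ {not (E x z)} (∧-t₂ {not (z == x)} (∧-t₂ {R a z} (proj₂ (∈-sel⁻ (fits x a) B z∈)))))) })) (∑-zero (N x a))
  ... | false = ≤-trans (∑-mono (F x) λ {a} _ → each a) (<⇒≤ (≰⇒> λ le → t≢f (≤⇒≤ᵇ≡ le) q))
    where
    each : ∀ a → # (N x a) (_== y) ≤ χ (E y a)
    each a with E y a in h
    ... | true = #-point y (sel-unique _ uB)
    ... | false = ≤-reflexive (trans (∑-cong (N x a) λ {z} z∈ → cong χ (≢⇒== λ { refl →
        t≢f (trans (E-sym z a) (R⇒E (∧-t₁ (proj₂ (∈-sel⁻ (fits x a) B z∈))))) h })) (∑-zero (N x a)))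

  pairs≤ : ∀ τ x y → ∑ 𝒯 (λ τ′ → χ (src τ′ == x ∧ dst τ′ == y) * (weight τ (src τ′) * weight τ (dst τ′))) ≤ g * (Q * Q)
  pairs≤ τ x y = begin
    ∑ 𝒯 (λ τ′ → χ (src τ′ == x ∧ dst τ′ == y) * (weight τ (src τ′) * weight τ (dst τ′)))
      ≤⟨ ∑-mono 𝒯 (λ {τ′} _ → *-mono-≤ (≤-reflexive (χ-∧ (src τ′ == x) (dst τ′ == y))) (*-mono-≤ (weight≤Q 0<Q τ (src τ′)) (weight≤Q 0<Q τ (dst τ′)))) ⟩
    ∑ 𝒯 (λ τ′ → χ (src τ′ == x) * χ (dst τ′ == y) * (Q * Q)) ≡⟨ ∑-*ʳ 𝒯 _ (Q * Q) ⟩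
    ∑ 𝒯 (λ τ′ → χ (src τ′ == x) * χ (dst τ′ == y)) * (Q * Q) ≤⟨ *-monoˡ-≤ (Q * Q) (begin
      ∑ 𝒯 (λ τ′ → χ (src τ′ == x) * χ (dst τ′ == y)) ≡⟨ trans (∑-⊗ B _ _) (∑-cong B λ {u} _ → ∑-⊗ (F u) (N u) _) ⟩
      ∑ B (λ u → ∑ (F u) (λ a → ∑ (N u a) (λ v → χ (u == x) * χ (v == y))))
        ≡⟨ ∑-cong B (λ {u} _ → trans (∑-cong (F u) λ {a} _ → ∑-*ˡ (N u a) (χ (u == x)) _) (∑-*ˡ (F u) (χ (u == x)) _)) ⟩
      ∑ B (λ u → χ (u == x) * ∑ (F u) (λ a → # (N u a) (_== y))) ≤⟨ ∑-point x _ uB ⟩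
      ∑ (F x) (λ a → # (N x a) (_== y)) ≤⟨ pair-count x y ⟩
      g ∎) ⟩
    g * (Q * Q) ∎

  near≤ : ∀ {τ} → τ ∈ 𝒯 → ∑ 𝒯 (λ τ′ → χ (near (mid τ) (mid τ′)) * (weight τ (src τ′) * weight τ (dst τ′))) ≤ 19 * m * (3 * Q * (3 * Q))
  near≤ {τ} τ∈ = begin
    ∑ 𝒯 (λ τ′ → χ (near (mid τ) (mid τ′)) * (weight τ (src τ′) * weight τ (dst τ′)))
      ≡⟨ trans (∑-⊗ B _ _) (∑-cong B λ {u} _ → ∑-⊗ (F u) (N u) _) ⟩
    ∑ B (λ u → ∑ (F u) (λ a → ∑ (N u a) (λ v → χ (near (mid τ) a) * (weight τ u * weight τ v)))) ≤⟨ ∑-mono B (λ {u} _ → per-u u) ⟩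
    ∑ B (λ u → ∑ A (λ a → χ (near (mid τ) a) * (χ (E a u) * weight τ u * (3 * Q)))) ≡⟨ ∑-swap B A _ ⟩
    ∑ A (λ a → ∑ B (λ u → χ (near (mid τ) a) * (χ (E a u) * weight τ u * (3 * Q))))
      ≡⟨ ∑-cong A (λ {a} _ → trans (∑-*ˡ B (χ (near (mid τ) a)) _) (cong (χ (near (mid τ) a) *_) (∑-*ʳ B _ (3 * Q)))) ⟩
    ∑ A (λ a → χ (near (mid τ) a) * (∑ B (λ u → χ (E a u) * weight τ u) * (3 * Q)))
      ≤⟨ ∑-mono A (λ {a} a∈ → *-monoʳ-≤ (χ (near (mid τ) a)) (*-monoˡ-≤ (3 * Q) (weights τ a∈))) ⟩
    ∑ A (λ a → χ (near (mid τ) a) * (3 * Q * (3 * Q))) ≡⟨ ∑-*ʳ A _ (3 * Q * (3 * Q)) ⟩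
    # A (near (mid τ)) * (3 * Q * (3 * Q)) ≤⟨ *-monoˡ-≤ (3 * Q * (3 * Q)) (≤-trans (#-∨ A (out (mid τ)) (_== mid τ)) (+-mono-≤
        (≤-trans (#-sub _ uA uT A⊆) (out≤ (A⊆ (Facts.mid∈ (facts τ∈))))) (≤-trans (#-point (mid τ) uA) 0<m))) ⟩
    (18 * m + m) * (3 * Q * (3 * Q)) ≡⟨ cong (_* (3 * Q * (3 * Q))) (lem m) ⟩
    19 * m * (3 * Q * (3 * Q)) ∎
    where
    lem : ∀ m → 18 * m + m ≡ 19 * m
    lem = solve-∀
    lem′ : ∀ p w s → p * (w * s) ≡ p * w * s
    lem′ = solve-∀
    lem″ : ∀ p q w s → p * (q * (w * s)) ≡ q * (p * w * s)
    lem″ = solve-∀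
    per-u : ∀ u → ∑ (F u) (λ a → ∑ (N u a) (λ v → χ (near (mid τ) a) * (weight τ u * weight τ v))) ≤
                  ∑ A (λ a → χ (near (mid τ) a) * (χ (E a u) * weight τ u * (3 * Q)))
    per-u u = begin
      ∑ (F u) (λ a → ∑ (N u a) (λ v → χ (near (mid τ) a) * (weight τ u * weight τ v))) ≤⟨ ∑-mono (F u) (λ {a} a∈ → per-a a a∈) ⟩
      ∑ (F u) (λ a → χ (near (mid τ) a) * (weight τ u * (3 * Q))) ≤⟨ ∑-take≤ (K₁ * m) (sel (λ a → R a u) A) _ ⟩
      ∑ (sel (λ a → R a u) A) (λ a → χ (near (mid τ) a) * (weight τ u * (3 * Q))) ≡⟨ ∑-sel _ A _ ⟩
      ∑ A (λ a → χ (R a u) * (χ (near (mid τ) a) * (weight τ u * (3 * Q)))) ≤⟨ ∑-mono A (λ {a} _ →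
          ≤-trans (*-monoˡ-≤ (χ (near (mid τ) a) * (weight τ u * (3 * Q))) (χ-mono (R⇒E {a} {u})))
            (≤-reflexive (lem″ (χ (E a u)) (χ (near (mid τ) a)) (weight τ u) (3 * Q)))) ⟩
      ∑ A (λ a → χ (near (mid τ) a) * (χ (E a u) * weight τ u * (3 * Q))) ∎
      where
      per-a : ∀ a → a ∈ F u → ∑ (N u a) (λ v → χ (near (mid τ) a) * (weight τ u * weight τ v)) ≤ χ (near (mid τ) a) * (weight τ u * (3 * Q))
      per-a a a∈ = begin
        ∑ (N u a) (λ v → χ (near (mid τ) a) * (weight τ u * weight τ v)) ≡⟨ trans (∑-*ˡ (N u a) (χ (near (mid τ) a)) _)
            (cong (χ (near (mid τ) a) *_) (∑-*ˡ (N u a) (weight τ u) _)) ⟩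
        χ (near (mid τ) a) * (weight τ u * ∑ (N u a) (weight τ)) ≤⟨ *-monoʳ-≤ (χ (near (mid τ) a)) (*-monoʳ-≤ (weight τ u)
            (≤-trans (≤-reflexive (∑-sel (fits u a) B _)) (≤-trans (∑-mono B λ {v} _ →
               *-monoˡ-≤ (weight τ v) (χ-mono λ h → R⇒E {a} {v} (∧-t₁ {R a v} h))) (weights τ (proj₁ (F⁻ a∈)))))) ⟩
        χ (near (mid τ) a) * (weight τ u * (3 * Q)) ∎

  con≤ : ∀ {τ} → τ ∈ 𝒯 → 4 * ∑ 𝒯 (λ τ′ → χ (con τ τ′) * (weight τ (src τ′) * weight τ (dst τ′))) ≤ k * (Q * Q)
  con≤ {τ} τ∈ = begin
    4 * ∑ 𝒯 (λ τ′ → χ (con τ τ′) * w τ′) ≤⟨ *-monoʳ-≤ 4 (∑-mono 𝒯 λ {τ′} _ → split τ′) ⟩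
    4 * ∑ 𝒯 (λ τ′ → χ (near (mid τ) (mid τ′)) * w τ′ + (χ (joined (src τ) (dst τ) τ′) * w τ′ + χ (joined (dst τ) (src τ) τ′) * w τ′))
      ≡⟨ cong (4 *_) (trans (∑-+ 𝒯 _ _) (cong (∑ 𝒯 (λ τ′ → χ (near (mid τ) (mid τ′)) * w τ′) +_) (∑-+ 𝒯 _ _))) ⟩
    4 * (∑ 𝒯 (λ τ′ → χ (near (mid τ) (mid τ′)) * w τ′) + (∑ 𝒯 (λ τ′ → χ (joined (src τ) (dst τ) τ′) * w τ′) + ∑ 𝒯 (λ τ′ → χ (joined (dst τ) (src τ) τ′) * w τ′)))
      ≤⟨ *-monoʳ-≤ 4 (+-mono-≤ (near≤ τ∈) (+-mono-≤
           (≤-trans (pairs≤ τ (src τ) (dst τ)) (*-monoˡ-≤ (Q * Q) g≤m)) (≤-trans (pairs≤ τ (dst τ) (src τ)) (*-monoˡ-≤ (Q * Q) g≤m)))) ⟩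
    4 * (19 * m * (3 * Q * (3 * Q)) + (m * (Q * Q) + m * (Q * Q))) ≡⟨ lem m Q ⟩
    k * (Q * Q) ∎
    where
    w : Obj → ℕ
    w τ′ = weight τ (src τ′) * weight τ (dst τ′)
    joined : Fin n → Fin n → Obj → Bool
    joined x y τ′ = src τ′ == x ∧ dst τ′ == y
    lem : ∀ m q → 4 * (19 * m * (3 * q * (3 * q)) + (m * (q * q) + m * (q * q))) ≡ 692 * m * (q * q)
    lem = solve-∀
    split : ∀ τ′ → χ (con τ τ′) * w τ′ ≤ χ (near (mid τ) (mid τ′)) * w τ′ + (χ (joined (src τ) (dst τ) τ′) * w τ′ + χ (joined (dst τ) (src τ) τ′) * w τ′)
    split τ′ with near (mid τ) (mid τ′) | joined (src τ) (dst τ) τ′ | joined (dst τ) (src τ) τ′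
    ... | true | _ | _ = m≤m+n (1 * w τ′) _
    ... | false | true | _ = m≤m+n (1 * w τ′) _
    ... | false | false | _ = ≤-refl

  many : 4 * (C * k) * (length B * Q) < length 𝒯
  many = begin-strict
    4 * (C * (692 * m)) * (length B * (720 * m)) ≡⟨ lem C m (length B) 692 720 ⟩
    4 * (C * (692 * 720)) * (length B * (m * m)) <⟨ *-monoˡ-< (length B * (m * m)) {{>-nonZero (*-mono-≤ B≢[] (*-mono-≤ 0<m 0<m))}} K₁-large ⟩
    K₁ * (length B * (m * m)) ≡⟨ lem′ K₁ (length B) m ⟩
    length B * (K₁ * m * m) ≤⟨ 𝒯-length ⟩
    length 𝒯 ∎
    where
    lem : ∀ c m b x y → 4 * (c * (x * m)) * (b * (y * m)) ≡ 4 * (c * (x * y)) * (b * (m * m))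
    lem = solve-∀
    lem′ : ∀ x b m → x * (b * (m * m)) ≡ b * (x * m * m)
    lem′ = solve-∀

  abstract
    selection : Selected
    selection = selected (*-mono-≤ (s≤s (z≤n {691})) 0<m) 0<Q (λ h → Facts.src≢dst (facts h))
      killed≤ (λ τ → ∨-t₁ (∨-t₂ {out (mid τ) (mid τ)} (==-refl (mid τ)))) con≤ many

  open Selected selection

  open Ends src dst I B S

  record Good (τ : Obj) : Set where
    field
      mid∈ : mid τ ∈ A
      src≢dst : src τ ≢ dst τ
      mid~src : E (mid τ) (src τ) ≡ true
      mid~dst : E (mid τ) (dst τ) ≡ true
      only : ∀ {x} → x ∈ W → E (mid τ) x ≡ true → x ≡ src τ ⊎ x ≡ dst τ

  good : ∀ {τ} → τ ∈ I → Good τ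
  good τ∈ = record { mid∈ = mid∈ ; src≢dst = src≢dst ; mid~src = mid~src ; mid~dst = mid~dst
    ; only = λ x∈ h → alive τ∈ (proj₁ (W⁻ x∈)) (proj₁ (proj₂ (W⁻ x∈))) (∨-t₁ h) }
    where open Facts (facts (I⊆ τ∈))

  rev : Obj → Obj
  rev (u , a , v) = v , a , u

  good-rev : ∀ {τ} → τ ∈ I → Good (rev τ)
  good-rev τ∈ = record { mid∈ = mid∈ ; src≢dst = src≢dst ∘ sym ; mid~src = mid~dst ; mid~dst = mid~src
    ; only = λ x∈ h → swap (only x∈ h) }
    where open Good (good τ∈)
          open import Data.Sum using (swap)

  W-indep : ∀ {x y} → x ∈ W → y ∈ W → E x y ≡ false
  W-indep {x} {y} x∈ y∈ = ¬t⇒f λ h → half h (∨-case (covers (B⊆ (proj₁ (W⁻ x∈))) (B⊆ (proj₁ (W⁻ y∈))) h))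
    where
    one-way : ∀ {x y} → x ∈ W → y ∈ W → out x y ≡ true → E x y ≡ false
    one-way {x} {y} x∈ y∈ o with W⁻ x∈
    ... | _ , _ , τ@(u , a , v) , τ∈ , inj₁ refl with alive τ∈ (proj₁ (W⁻ y∈)) (proj₁ (proj₂ (W⁻ y∈))) (∨-t₂ {E a y} (∨-t₁ o))
    ...   | inj₁ refl = E-irr _
    ...   | inj₂ refl = Facts.src≁dst (facts (I⊆ τ∈))
    one-way {x} {y} x∈ y∈ o | _ , _ , τ@(u , a , v) , τ∈ , inj₂ refl
      with alive τ∈ (proj₁ (W⁻ y∈)) (proj₁ (proj₂ (W⁻ y∈))) (∨-t₂ {E a y} (∨-t₂ {out u y} o))
    ...   | inj₁ refl = trans (E-sym _ _) (Facts.src≁dst (facts (I⊆ τ∈)))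
    ...   | inj₂ refl = E-irr _
    half : E x y ≡ true → out x y ≡ true ⊎ out y x ≡ true → ⊥
    half h (inj₁ o) = t≢f h (one-way x∈ y∈ o)
    half h (inj₂ o) = t≢f (trans (E-sym y x) h) (one-way y∈ x∈ o)

  inn : Obj → List (Fin n)
  inn τ = [ mid τ ]

  separate : ∀ {τ τ′} → τ ∈ I → τ′ ∈ I → Apart con τ τ′ → Separate E src dst inn τ τ′
  separate {τ@(u , a , v)} {τ′@(u′ , a′ , v′)} τ∈ τ′∈ (p , q) = record
    { pair≢ = λ { (refl , refl) → t≢f (∨-t₁ (∧-t (==-refl u) (==-refl v))) (∨-f₂ {near a a′} p) }
    ; pair≢′ = λ { (refl , refl) → t≢f (∨-t₂ {u′ == u ∧ v′ == v} (∧-t (==-refl v) (==-refl u))) (∨-f₂ {near a a′} p) }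
    ; inn≢ = λ { (here refl) (here refl) refl → t≢f (==-refl a) (∨-f₂ {out a a} (∨-f₁ p)) }
    ; inn≁ = λ { (here refl) (here refl) → ¬t⇒f λ h → far (∨-case (covers (mid∈T τ∈) (mid∈T τ′∈) h)) } }
    where
    mid∈T : ∀ {τ} → τ ∈ I → mid τ ∈ T
    mid∈T h = A⊆ (Good.mid∈ (good h))
    far : out a a′ ≡ true ⊎ out a′ a ≡ true → ⊥
    far (inj₁ o) = t≢f o (∨-f₁ (∨-f₁ p))
    far (inj₂ o) = t≢f o (∨-f₁ (∨-f₁ q))

  subdivision : SubdivisionIn E r t
  subdivision = Assemble.copy E E-sym r t src dst inn rev (λ _ → refl) (λ _ → refl) (λ h → h) I W (sel-unique _ (sel-unique _ uB)) Good good good-rev Good.src≢dst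
    (λ h → src∈W h (Facts.src∈ (facts (I⊆ h))) (src∈ h)) (λ h → dst∈W h (Facts.dst∈ (facts (I⊆ h))) (dst∈ h))
    (λ {τ} G → trans (E-sym (src τ) (mid τ)) (Good.mid~src G) , Good.mid~dst G , _)
    (λ _ → [] ∷ [])
    (λ { G (here refl) w∈ → disjoint (Good.mid∈ G) (proj₁ (W⁻ w∈)) })
    W-indep
    (λ { G (here refl) v∈ h → ends (Good.only G v∈ h) })
    (λ { G (here refl) (here refl) h → ⊥-elim (t≢f h (E-irr _)) })
    (λ h → h)
    (allPairs-map separate apart)
    (≤-<-trans (*-monoʳ-≤ C |W|≤) dense)
    where
    ends : ∀ {τ x} → x ≡ src τ ⊎ x ≡ dst τ → Consecutive (src τ ∷ inn τ ++ [ dst τ ]) (mid τ) x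
    ends (inj₁ refl) = inj₂ here
    ends (inj₂ refl) = inj₁ (there here)

-- The regular case: a 2-subdivision

∑-sel-mono : {A : Set} {p q : A → Bool} (xs : List A) {f g : A → ℕ} → (∀ {x} → x ∈ xs → p x ≡ true → q x ≡ true) →
             (∀ {x} → x ∈ xs → p x ≡ true → f x ≤ g x) → ∑ (sel p xs) f ≤ ∑ (sel q xs) g
∑-sel-mono {p = p} {q} xs h k = ≤-trans (≤-reflexive (∑-sel p xs _))
  (≤-trans (∑-mono xs λ x∈ → χ*-mono (h x∈) (k x∈)) (≤-reflexive (sym (∑-sel q xs _))))

module RegularCase {n : ℕ} (E : Fin n → Fin n → Bool) (E-sym : ∀ x y → E x y ≡ E y x) (E-irr : ∀ x → E x x ≡ false)
  (r t g p K : ℕ) (0<g : 0 < g) (0<K : 0 < K) (16≤p : 16 ≤ p)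
  (p-large : 1024 * (minorBound r t * (2 * K * (2 * K) * (2 * K))) < p)
  (m : ℕ) (m≡ : m ≡ 2 * (p * (p * g)))
  (V : List (Fin n)) (uV : Unique V) (V≢[] : 0 < length V)
  (deg≥ : ∀ {v} → v ∈ V → m ≤ # V (E v)) (deg≤ : ∀ {v} → v ∈ V → # V (E v) ≤ K * m)
  (sparse : ∀ X → Unique X → length X ≤ K * m → # V (λ y → g ≤ᵇ # X (E y)) ≤ g)
  where

  open ≤-Reasoning

  -- Sampling with probability 1 / (p Δ) rather than 1 / Δ makes paths rarer by p², but conflicts
  -- between them rarer by p⁴; this gain of p beats the sample size for p large.
  C ℓ D Δ Q k : ℕ
  C = minorBound r t
  ℓ = p * (p * g)
  D = K * (2 * (p * g))
  Δ = K * m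
  Q = p * Δ
  k = 256 * (D * D)

  0<p : 0 < p
  0<p = ≤-trans (s≤s z≤n) 16≤p

  Δ≡ : Δ ≡ p * D
  Δ≡ = trans (cong (K *_) m≡) (lem K p (p * g))
    where lem : ∀ K p x → K * (2 * (p * x)) ≡ p * (K * (2 * x))
          lem = solve-∀

  gp≤D : g * p ≤ D
  gp≤D = ≤-trans (≤-reflexive (*-comm g p)) (≤-trans (m≤n*m (p * g) 2) (m≤n*m (2 * (p * g)) K {{>-nonZero 0<K}}))

  g≤D : g ≤ D
  g≤D = ≤-trans (m≤m*n g p {{>-nonZero 0<p}}) gp≤D

  0<Δ : 0 < Δ
  0<Δ = ≤-trans (*-mono-≤ 0<p (≤-trans 0<g g≤D)) (≤-reflexive (sym Δ≡))

  g≤Δ : g ≤ Δ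
  g≤Δ = ≤-trans g≤D (≤-trans (m≤n*m D p {{>-nonZero 0<p}}) (≤-reflexive (sym Δ≡)))

  0<Q : 0 < Q
  0<Q = *-mono-≤ 0<p 0<Δ

  ℓ+6g≤m : ℓ + 6 * g ≤ m
  ℓ+6g≤m = begin
    ℓ + 6 * g ≤⟨ +-monoʳ-≤ ℓ (*-mono-≤ (≤-trans (m≤m+n 6 10) 16≤p) (m≤n*m g p {{>-nonZero 0<p}})) ⟩
    ℓ + ℓ ≡⟨ lem ℓ ⟩
    2 * ℓ ≡⟨ m≡ ⟨
    m ∎
    where lem : ∀ l → l + l ≡ 2 * l
          lem = solve-∀

  Obj : Set
  Obj = Fin n × Fin n × Fin n × Fin n

  left right src dst : Obj → Fin n
  left (y , y′ , b , b′) = y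
  right (y , y′ , b , b′) = y′
  src (y , y′ , b , b′) = b
  dst (y , y′ , b , b′) = b′

  nb : Fin n → List (Fin n)
  nb v = sel (E v) V

  nb-length : ∀ {v} → v ∈ V → length (nb v) ≤ Δ
  nb-length {v} h = ≤-trans (≤-reflexive (length-sel (E v) V)) (deg≤ h)

  rich : Fin n → Fin n → Bool
  rich x y = g ≤ᵇ # (nb x) (E y)

  rich≤ : ∀ {x} → x ∈ V → # V (rich x) ≤ g
  rich≤ {x} h = sparse (nb x) (sel-unique _ uV) (nb-length h)

  poor⇒ : ∀ {x y} → rich x y ≡ false → # (nb x) (E y) ≤ g
  poor⇒ h = <⇒≤ (≰⇒> λ le → t≢f (≤⇒≤ᵇ≡ le) h)

  codeg : ∀ x y → # (nb x) (E y) ≡ # V (λ z → E x z ∧ E y z)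
  codeg x y = #-sel (E x) V (E y)

  codeg-sym : ∀ x y → # (nb x) (E y) ≡ # (nb y) (E x)
  codeg-sym x y = trans (codeg x y) (trans (∑-cong V λ {z} _ → cong χ (∧-comm (E x z) (E y z))) (sym (codeg y x)))
    where open import Data.Bool.Properties using (∧-comm)

  fits₁ : Fin n → Fin n → Bool
  fits₁ y y′ = E y y′ ∧ not (rich y y′)

  fits₂ : Fin n → Fin n → Fin n → Bool
  fits₂ y y′ b = E y b ∧ not (rich y b) ∧ not (rich y′ b) ∧ not (b == y′) ∧ not (E y′ b)

  fits₃ : Fin n → Fin n → Fin n → Fin n → Bool
  fits₃ y y′ b b′ = E y′ b′ ∧ not (rich y b′) ∧ not (rich y′ b′) ∧ not (b′ == y) ∧ not (E y b′) ∧ not (b′ == b) ∧ not (E b b′)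

  Y : Fin n → List (Fin n)
  Y y = sel (fits₁ y) V

  B₁ : Fin n → Fin n → List (Fin n)
  B₁ y y′ = sel (fits₂ y y′) V

  B₂ : Fin n → Fin n → Fin n → List (Fin n)
  B₂ y y′ b = sel (fits₃ y y′ b) V

  𝒯 : List Obj
  𝒯 = V ⊗ λ y → Y y ⊗ λ y′ → B₁ y y′ ⊗ B₂ y y′

  record Facts (τ : Obj) : Set where
    field
      left∈ : left τ ∈ V
      right∈ : right τ ∈ V
      src∈ : src τ ∈ V
      dst∈ : dst τ ∈ V
      left~right : E (left τ) (right τ) ≡ true
      left~src : E (left τ) (src τ) ≡ true
      right~dst : E (right τ) (dst τ) ≡ true
      right≁src : E (right τ) (src τ) ≡ false
      left≁dst : E (left τ) (dst τ) ≡ false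
      src≁dst : E (src τ) (dst τ) ≡ false
      src≢dst : src τ ≢ dst τ
      src≢right : src τ ≢ right τ
      dst≢left : dst τ ≢ left τ
      left-src : # (nb (left τ)) (E (src τ)) ≤ g
      right-src : # (nb (right τ)) (E (src τ)) ≤ g
      left-dst : # (nb (left τ)) (E (dst τ)) ≤ g
      right-dst : # (nb (right τ)) (E (dst τ)) ≤ g

  facts : ∀ {τ} → τ ∈ 𝒯 → Facts τ
  facts {y , y′ , b , b′} h = record
    { left∈ = proj₁ h₁ ; right∈ = proj₁ y′⁻ ; src∈ = proj₁ b⁻ ; dst∈ = proj₁ b′⁻
    ; left~right = ∧-t₁ (proj₂ y′⁻) ; left~src = proj₁ c₂ ; right~dst = proj₁ c₃
    ; right≁src = proj₂ (proj₂ (proj₂ (proj₂ c₂))) ; left≁dst = proj₁ (proj₂ (proj₂ (proj₂ (proj₂ c₃))))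
    ; src≁dst = proj₂ (proj₂ (proj₂ (proj₂ (proj₂ (proj₂ c₃))))) ; src≢dst = ==-f (proj₁ (proj₂ (proj₂ (proj₂ (proj₂ (proj₂ c₃)))))) ∘ sym
    ; src≢right = ==-f (proj₁ (proj₂ (proj₂ (proj₂ c₂)))) ; dst≢left = ==-f (proj₁ (proj₂ (proj₂ (proj₂ c₃))))
    ; left-src = poor⇒ (proj₁ (proj₂ c₂)) ; right-src = poor⇒ (proj₁ (proj₂ (proj₂ c₂)))
    ; left-dst = poor⇒ (proj₁ (proj₂ c₃)) ; right-dst = poor⇒ (proj₁ (proj₂ (proj₂ c₃))) }
    where
    conj₂ : ∀ p q r s u → p ∧ not q ∧ not r ∧ not s ∧ not u ≡ true → p ≡ true × q ≡ false × r ≡ false × s ≡ false × u ≡ false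
    conj₂ true false false false false refl = refl , refl , refl , refl , refl
    conj₃ : ∀ p q r s u v x → p ∧ not q ∧ not r ∧ not s ∧ not u ∧ not v ∧ not x ≡ true →
            p ≡ true × q ≡ false × r ≡ false × s ≡ false × u ≡ false × v ≡ false × x ≡ false
    conj₃ true false false false false false false refl = refl , refl , refl , refl , refl , refl , refl
    h₁ : y ∈ V × (y′ , b , b′) ∈ (Y y ⊗ λ y′ → B₁ y y′ ⊗ B₂ y y′)
    h₁ = ∈-⊗⁻ V (λ y → Y y ⊗ λ y′ → B₁ y y′ ⊗ B₂ y y′) h
    h₂ : y′ ∈ Y y × (b , b′) ∈ (B₁ y y′ ⊗ B₂ y y′)
    h₂ = ∈-⊗⁻ (Y y) (λ y′ → B₁ y y′ ⊗ B₂ y y′) (proj₂ h₁)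
    h₃ : b ∈ B₁ y y′ × b′ ∈ B₂ y y′ b
    h₃ = ∈-⊗⁻ (B₁ y y′) (B₂ y y′) (proj₂ h₂)
    y′⁻ : y′ ∈ V × fits₁ y y′ ≡ true
    y′⁻ = ∈-sel⁻ (fits₁ y) V (proj₁ h₂)
    b⁻ : b ∈ V × fits₂ y y′ b ≡ true
    b⁻ = ∈-sel⁻ (fits₂ y y′) V (proj₁ h₃)
    b′⁻ : b′ ∈ V × fits₃ y y′ b b′ ≡ true
    b′⁻ = ∈-sel⁻ (fits₃ y y′ b) V (proj₂ h₃)
    c₂ : E y b ≡ true × rich y b ≡ false × rich y′ b ≡ false × b == y′ ≡ false × E y′ b ≡ false
    c₂ = conj₂ (E y b) (rich y b) (rich y′ b) (b == y′) (E y′ b) (proj₂ b⁻)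
    c₃ : E y′ b′ ≡ true × rich y b′ ≡ false × rich y′ b′ ≡ false × b′ == y ≡ false × E y b′ ≡ false × b′ == b ≡ false × E b b′ ≡ false
    c₃ = conj₃ (E y′ b′) (rich y b′) (rich y′ b′) (b′ == y) (E y b′) (b′ == b) (E b b′) (proj₂ b′⁻)

  Y-length : ∀ {y} → y ∈ V → ℓ ≤ length (Y y)
  Y-length {y} y∈ = +-cancelʳ-≤ (6 * g) _ _ (begin
    ℓ + 6 * g ≤⟨ ℓ+6g≤m ⟩
    m ≤⟨ deg≥ y∈ ⟩
    # V (E y) ≤⟨ ∑-mono V (λ {x} _ → split (E y x) (rich y x)) ⟩
    ∑ V (λ x → χ (fits₁ y x) + χ (rich y x)) ≡⟨ ∑-+ V _ _ ⟩
    # V (fits₁ y) + # V (rich y) ≤⟨ +-mono-≤ (≤-reflexive (sym (length-sel (fits₁ y) V))) (≤-trans (rich≤ y∈) (m≤n*m g 6)) ⟩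
    length (Y y) + 6 * g ∎)
    where
    split : ∀ a c → χ a ≤ χ (a ∧ not c) + χ c
    split false c = z≤n
    split true true = s≤s z≤n
    split true false = s≤s z≤n

  point≤g : ∀ x → # V (_== x) ≤ g
  point≤g x = ≤-trans (#-point x uV) 0<g

  B₁-length : ∀ {y y′} → y ∈ V → y′ ∈ Y y → ℓ ≤ length (B₁ y y′)
  B₁-length {y} {y′} y∈ y′∈ = +-cancelʳ-≤ (6 * g) _ _ (begin
    ℓ + 6 * g ≤⟨ ℓ+6g≤m ⟩
    m ≤⟨ deg≥ y∈ ⟩
    # V (E y) ≤⟨ ∑-mono V (λ {x} _ → split (E y x) (rich y x) (rich y′ x) (x == y′) (E y′ x)) ⟩
    ∑ V (λ x → χ (fits₂ y y′ x) + (χ (rich y x) + (χ (rich y′ x) + (χ (x == y′) + χ (E y x ∧ E y′ x)))))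
      ≡⟨ trans (∑-+ V _ _) (cong (# V (fits₂ y y′) +_) (trans (∑-+ V _ _) (cong (# V (rich y) +_) (trans (∑-+ V _ _) (cong (# V (rich y′) +_) (∑-+ V _ _)))))) ⟩
    # V (fits₂ y y′) + (# V (rich y) + (# V (rich y′) + (# V (_== y′) + # V (λ x → E y x ∧ E y′ x))))
      ≤⟨ +-mono-≤ (≤-reflexive (sym (length-sel (fits₂ y y′) V))) (≤-trans (+-mono-≤ (rich≤ y∈) (+-mono-≤ (rich≤ (proj₁ y′⁻)) (+-mono-≤ (point≤g y′)
           (≤-trans (≤-reflexive (sym (codeg y y′))) (poor⇒ (not-f (∧-t₂ {E y y′} (proj₂ y′⁻)))))))) (≤-trans (m≤m+n _ (2 * g)) (≤-reflexive (lem g)))) ⟩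
    length (B₁ y y′) + 6 * g ∎)
    where
    y′⁻ = ∈-sel⁻ (fits₁ y) V y′∈
    lem : ∀ g → g + (g + (g + g)) + 2 * g ≡ 6 * g
    lem = solve-∀
    split : ∀ a c d e f → χ a ≤ χ (a ∧ not c ∧ not d ∧ not e ∧ not f) + (χ c + (χ d + (χ e + χ (a ∧ f))))
    split false c d e f = z≤n
    split true true d e f = s≤s z≤n
    split true false true e f = s≤s z≤n
    split true false false true f = s≤s z≤n
    split true false false false true = s≤s z≤n
    split true false false false false = s≤s z≤n

  B₂-length : ∀ {y y′ b} → y ∈ V → y′ ∈ Y y → b ∈ B₁ y y′ → ℓ ≤ length (B₂ y y′ b)
  B₂-length {y} {y′} {b} y∈ y′∈ b∈ = +-cancelʳ-≤ (6 * g) _ _ (begin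
    ℓ + 6 * g ≤⟨ ℓ+6g≤m ⟩
    m ≤⟨ deg≥ (proj₁ y′⁻) ⟩
    # V (E y′) ≤⟨ ∑-mono V (λ {x} _ → split (E y′ x) (rich y x) (rich y′ x) (x == y) (E y x) (x == b) (E b x)) ⟩
    ∑ V (λ x → χ (fits₃ y y′ b x) + (χ (rich y x) + (χ (rich y′ x) + (χ (x == y) + (χ (E y′ x ∧ E y x) + (χ (x == b) + χ (E y′ x ∧ E b x)))))))
      ≡⟨ trans (∑-+ V _ _) (cong (# V (fits₃ y y′ b) +_) (trans (∑-+ V _ _) (cong (# V (rich y) +_) (trans (∑-+ V _ _) (cong (# V (rich y′) +_)
          (trans (∑-+ V _ _) (cong (# V (_== y) +_) (trans (∑-+ V _ _) (cong (# V (λ x → E y′ x ∧ E y x) +_) (∑-+ V _ _)))))))))) ⟩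
    # V (fits₃ y y′ b) + (# V (rich y) + (# V (rich y′) + (# V (_== y) + (# V (λ x → E y′ x ∧ E y x) + (# V (_== b) + # V (λ x → E y′ x ∧ E b x))))))
      ≤⟨ +-mono-≤ (≤-reflexive (sym (length-sel (fits₃ y y′ b) V))) (≤-trans (+-mono-≤ (rich≤ y∈) (+-mono-≤ (rich≤ (proj₁ y′⁻)) (+-mono-≤ (point≤g y)
           (+-mono-≤ (≤-trans (≤-reflexive (trans (sym (codeg y′ y)) (codeg-sym y′ y))) (poor⇒ (not-f (∧-t₂ {E y y′} (proj₂ y′⁻)))))
             (+-mono-≤ (point≤g b) (≤-trans (≤-reflexive (sym (codeg y′ b))) (poor⇒ (not-f (∧-t₁ (∧-t₂ {not (rich y b)} (∧-t₂ {E y b} (proj₂ b⁻)))))))))))) (≤-reflexive (lem g))) ⟩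
    length (B₂ y y′ b) + 6 * g ∎)
    where
    y′⁻ = ∈-sel⁻ (fits₁ y) V y′∈
    b⁻ = ∈-sel⁻ (fits₂ y y′) V b∈
    lem : ∀ g → g + (g + (g + (g + (g + g)))) ≡ 6 * g
    lem = solve-∀
    split : ∀ a c d e f h i → χ a ≤ χ (a ∧ not c ∧ not d ∧ not e ∧ not f ∧ not h ∧ not i) + (χ c + (χ d + (χ e + (χ (a ∧ f) + (χ h + χ (a ∧ i))))))
    split false c d e f h i = z≤n
    split true true d e f h i = s≤s z≤n
    split true false true e f h i = s≤s z≤n
    split true false false true f h i = s≤s z≤n
    split true false false false true h i = s≤s z≤n
    split true false false false false true i = s≤s z≤n
    split true false false false false false true = s≤s z≤n
    split true false false false false false false = s≤s z≤n

  𝒯-length : length V * (ℓ * (ℓ * ℓ)) ≤ length 𝒯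
  𝒯-length = begin
    length V * (ℓ * (ℓ * ℓ)) ≤⟨ ∑≥ V _ (λ {y} y∈ → begin
      ℓ * (ℓ * ℓ) ≤⟨ *-monoˡ-≤ (ℓ * ℓ) (Y-length y∈) ⟩
      length (Y y) * (ℓ * ℓ) ≤⟨ ∑≥ (Y y) _ (λ {y′} y′∈ → begin
        ℓ * ℓ ≤⟨ *-monoˡ-≤ ℓ (B₁-length y∈ y′∈) ⟩
        length (B₁ y y′) * ℓ ≤⟨ ∑≥ (B₁ y y′) ℓ (λ b∈ → B₂-length y∈ y′∈ b∈) ⟩
        ∑ (B₁ y y′) (λ b → length (B₂ y y′ b)) ≡⟨ length-⊗ (B₁ y y′) (B₂ y y′) ⟨
        length (B₁ y y′ ⊗ B₂ y y′) ∎) ⟩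
      ∑ (Y y) (λ y′ → length (B₁ y y′ ⊗ B₂ y y′)) ≡⟨ length-⊗ (Y y) _ ⟨
      length (Y y ⊗ λ y′ → B₁ y y′ ⊗ B₂ y y′) ∎) ⟩
    ∑ V (λ y → length (Y y ⊗ λ y′ → B₁ y y′ ⊗ B₂ y y′)) ≡⟨ length-⊗ V _ ⟨
    length 𝒯 ∎

  killed : Obj → Fin n → Bool
  killed (y , y′ , b , b′) x = (E y x ∨ E y′ x) ∨ (E b x ∨ E b′ x)

  killed≤ : ∀ {τ} → τ ∈ 𝒯 → 4 * # V (killed τ) ≤ Q
  killed≤ {τ@(y , y′ , b , b′)} h = begin
    4 * # V (killed τ) ≤⟨ *-monoʳ-≤ 4 (≤-trans (#-∨ V _ _) (+-mono-≤
         (≤-trans (#-∨ V (E y) (E y′)) (+-mono-≤ (deg≤ left∈) (deg≤ right∈)))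
         (≤-trans (#-∨ V (E b) (E b′)) (+-mono-≤ (deg≤ src∈) (deg≤ dst∈))))) ⟩
    4 * (Δ + Δ + (Δ + Δ)) ≡⟨ lem Δ ⟩
    16 * Δ ≤⟨ *-monoˡ-≤ Δ 16≤p ⟩
    Q ∎
    where
    open Facts (facts h)
    lem : ∀ d → 4 * (d + d + (d + d)) ≡ 16 * d
    lem = solve-∀

  near : Obj → Fin n → Bool
  near (y , y′ , b , b′) z = (z == y ∨ z == y′) ∨ (E y z ∨ E y′ z)

  joins : Fin n → Fin n → Obj → Bool
  joins x x′ τ = src τ == x ∧ dst τ == x′

  con : Obj → Obj → Bool
  con τ τ′ = (near τ (left τ′) ∨ near τ (right τ′)) ∨ (joins (src τ) (dst τ) τ′ ∨ joins (dst τ) (src τ) τ′)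

  open Selection Q k C 𝒯 V src dst killed con using (weight; weight≤; weight≤Q; Selected; selected)

  at-most : ∀ z x → # (nb z) (_== x) ≤ χ (E x z)
  at-most z x with E x z in q
  ... | true = #-point x (sel-unique _ uV)
  ... | false = ≤-reflexive (trans (∑-cong (nb z) λ {c} c∈ → cong χ (≢⇒== λ { refl →
                  t≢f (trans (E-sym c z) (proj₂ (∈-sel⁻ (E z) V c∈))) q })) (∑-zero (nb z)))

  walks : (Fin n → Fin n → Fin n → Fin n → ℕ) → ℕ
  walks f = ∑ V λ z → ∑ (nb z) λ z′ → ∑ (nb z) λ c → ∑ (nb z′) λ c′ → f z z′ c c′

  𝒯≤walks : ∀ f → ∑ 𝒯 (λ (z , z′ , c , c′) → f z z′ c c′) ≤ walks f
  𝒯≤walks f = begin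
    ∑ 𝒯 _ ≡⟨ trans (∑-⊗ V _ _) (∑-cong V λ {y} _ → trans (∑-⊗ (Y y) _ _) (∑-cong (Y y) λ {y′} _ → ∑-⊗ (B₁ y y′) (B₂ y y′) _)) ⟩
    ∑ V (λ y → ∑ (Y y) λ y′ → ∑ (B₁ y y′) λ b → ∑ (B₂ y y′ b) λ b′ → f y y′ b b′)
      ≤⟨ ∑-mono V (λ {y} _ → ∑-sel-mono V (λ _ → ∧-t₁) λ {y′} _ _ → ∑-sel-mono V (λ _ → ∧-t₁) λ {b} _ _ → ∑-sel-mono V (λ _ → ∧-t₁) λ _ _ → ≤-refl) ⟩
    walks f ∎

  two-step : ∀ x z → x ∈ V → # (nb z) (E x) ≤ g + χ (rich x z) * Δ
  two-step x z x∈ with rich x z in q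
  ... | true = ≤-trans (≤-trans (≤-reflexive (codeg-sym z x)) (≤-trans (#≤length (nb x) (E z)) (nb-length x∈)))
                 (≤-trans (≤-reflexive (sym (*-identityˡ Δ))) (m≤n+m (1 * Δ) g))
  ... | false = ≤-trans (≤-trans (≤-reflexive (codeg-sym z x)) (poor⇒ q)) (m≤m+n g _)

  sum-two-step : ∀ {x} → x ∈ V → (p : Fin n → Bool) (c : ℕ) → # V p ≤ c * Δ → ∑ V (λ z → χ (p z) * # (nb z) (E x)) ≤ suc c * (g * Δ)
  sum-two-step {x} x∈ p c p≤ = begin
    ∑ V (λ z → χ (p z) * # (nb z) (E x)) ≤⟨ ∑-mono V (λ {z} _ → ≤-trans (*-monoʳ-≤ (χ (p z)) (two-step x z x∈))
        (≤-trans (≤-reflexive (*-distribˡ-+ (χ (p z)) g _)) (+-monoʳ-≤ (χ (p z) * g) (χ*≤ (p z) _)))) ⟩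
    ∑ V (λ z → χ (p z) * g + χ (rich x z) * Δ) ≡⟨ trans (∑-+ V _ _) (cong₂ _+_ (∑-*ʳ V _ g) (∑-*ʳ V _ Δ)) ⟩
    # V p * g + # V (rich x) * Δ ≤⟨ +-mono-≤ (*-monoˡ-≤ g p≤) (*-monoˡ-≤ Δ (rich≤ x∈)) ⟩
    c * Δ * g + g * Δ ≡⟨ lem c Δ g ⟩
    suc c * (g * Δ) ∎
    where lem : ∀ c d g → c * d * g + g * d ≡ suc c * (g * d)
          lem = solve-∀

  module Conflicts {τ : Obj} (τ∈ : τ ∈ 𝒯) where
    open Facts (facts τ∈)

    y y′ b b′ : Fin n
    y = left τ
    y′ = right τ
    b = src τ
    b′ = dst τ

    w : Fin n → ℕ
    w = weight τ

    β : Fin n → ℕ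
    β z = χ (E b z) + χ (E b′ z)

    near-count : # V (near τ) ≤ 4 * Δ
    near-count = begin
      # V (near τ) ≤⟨ ≤-trans (#-∨ V _ _) (+-mono-≤ (#-∨ V (_== y) (_== y′)) (#-∨ V (E y) (E y′))) ⟩
      # V (_== y) + # V (_== y′) + (# V (E y) + # V (E y′)) ≤⟨ +-mono-≤ (+-mono-≤ (≤-trans (point≤g y) g≤Δ) (≤-trans (point≤g y′) g≤Δ)) (+-mono-≤ (deg≤ left∈) (deg≤ right∈)) ⟩
      Δ + Δ + (Δ + Δ) ≡⟨ lem Δ ⟩
      4 * Δ ∎
      where lem : ∀ d → d + d + (d + d) ≡ 4 * d
            lem = solve-∀

    near-end : ∀ {x} → # (nb y) (E x) ≤ g → # (nb y′) (E x) ≤ g → # V (λ z → near τ z ∧ E x z) ≤ 4 * g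
    near-end {x} h h′ = begin
      # V (λ z → near τ z ∧ E x z) ≤⟨ ∑-mono V (λ {z} _ → split (z == y) (z == y′) (E y z) (E y′ z) (E x z)) ⟩
      ∑ V (λ z → χ (z == y) + χ (z == y′) + (χ (E y z ∧ E x z) + χ (E y′ z ∧ E x z)))
        ≡⟨ trans (∑-+ V _ _) (cong₂ _+_ (∑-+ V _ _) (∑-+ V _ _)) ⟩
      # V (_== y) + # V (_== y′) + (# V (λ z → E y z ∧ E x z) + # V (λ z → E y′ z ∧ E x z))
        ≤⟨ +-mono-≤ (+-mono-≤ (point≤g y) (point≤g y′)) (+-mono-≤ (≤-trans (≤-reflexive (sym (codeg y x))) h) (≤-trans (≤-reflexive (sym (codeg y′ x))) h′)) ⟩
      g + g + (g + g) ≡⟨ lem g ⟩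
      4 * g ∎
      where
      lem : ∀ d → d + d + (d + d) ≡ 4 * d
      lem = solve-∀
      split : ∀ p q r s a → χ (((p ∨ q) ∨ (r ∨ s)) ∧ a) ≤ χ p + χ q + (χ (r ∧ a) + χ (s ∧ a))
      split true q r s a = ≤-trans (χ≤1 a) (s≤s z≤n)
      split false true r s a = ≤-trans (χ≤1 a) (s≤s z≤n)
      split false false true s a = m≤m+n (χ a) _
      split false false false true a = ≤-refl
      split false false false false a = z≤n

    near-β : ∑ V (λ z → χ (near τ z) * β z) ≤ 8 * g
    near-β = begin
      ∑ V (λ z → χ (near τ z) * β z) ≡⟨ trans (∑-cong V λ {z} _ → trans (*-distribˡ-+ (χ (near τ z)) _ _)
          (cong₂ _+_ (sym (χ-∧ (near τ z) _)) (sym (χ-∧ (near τ z) _)))) (∑-+ V _ _) ⟩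
      # V (λ z → near τ z ∧ E b z) + # V (λ z → near τ z ∧ E b′ z) ≤⟨ +-mono-≤ (near-end left-src right-src) (near-end left-dst right-dst) ⟩
      4 * g + 4 * g ≡⟨ lem g ⟩
      8 * g ∎
      where lem : ∀ g → 4 * g + 4 * g ≡ 8 * g
            lem = solve-∀

    G : Fin n → ℕ
    G z = ∑ (nb z) β

    G≡ : ∀ z → G z ≡ # (nb z) (E b) + # (nb z) (E b′)
    G≡ z = ∑-+ (nb z) _ _

    near-G : ∑ V (λ z → χ (near τ z) * G z) ≤ 10 * (g * Δ)
    near-G = begin
      ∑ V (λ z → χ (near τ z) * G z) ≡⟨ trans (∑-cong V λ {z} _ → trans (cong (χ (near τ z) *_) (G≡ z)) (*-distribˡ-+ (χ (near τ z)) _ _)) (∑-+ V _ _) ⟩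
      ∑ V (λ z → χ (near τ z) * # (nb z) (E b)) + ∑ V (λ z → χ (near τ z) * # (nb z) (E b′))
        ≤⟨ +-mono-≤ (sum-two-step src∈ (near τ) 4 near-count) (sum-two-step dst∈ (near τ) 4 near-count) ⟩
      5 * (g * Δ) + 5 * (g * Δ) ≡⟨ lem (g * Δ) ⟩
      10 * (g * Δ) ∎
      where lem : ∀ g → 5 * g + 5 * g ≡ 10 * g
            lem = solve-∀

    close : ∀ {x x′} → x ∈ V → x′ ∈ V → ∑ V (λ z → χ (E x z) * # (nb z) (E x′)) ≤ 2 * (g * Δ)
    close {x} x∈ x′∈ = sum-two-step x′∈ (E x) 1 (≤-trans (deg≤ x∈) (≤-reflexive (sym (*-identityˡ Δ))))

    β-G : ∑ V (λ z → β z * G z) ≤ 8 * (g * Δ)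
    β-G = begin
      ∑ V (λ z → β z * G z) ≡⟨ ∑-cong V (λ {z} _ → trans (cong (β z *_) (G≡ z)) (lem (χ (E b z)) (χ (E b′ z)) (# (nb z) (E b)) (# (nb z) (E b′)))) ⟩
      ∑ V (λ z → (χ (E b z) * # (nb z) (E b) + χ (E b z) * # (nb z) (E b′)) + (χ (E b′ z) * # (nb z) (E b) + χ (E b′ z) * # (nb z) (E b′)))
        ≡⟨ trans (∑-+ V _ _) (cong₂ _+_ (∑-+ V _ _) (∑-+ V _ _)) ⟩
      _ ≤⟨ +-mono-≤ (+-mono-≤ (close src∈ src∈) (close src∈ dst∈)) (+-mono-≤ (close dst∈ src∈) (close dst∈ dst∈)) ⟩
      2 * (g * Δ) + 2 * (g * Δ) + (2 * (g * Δ) + 2 * (g * Δ)) ≡⟨ lem′ (g * Δ) ⟩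
      8 * (g * Δ) ∎
      where
      lem : ∀ a c p q → (a + c) * (p + q) ≡ (a * p + a * q) + (c * p + c * q)
      lem = solve-∀
      lem′ : ∀ x → 2 * x + 2 * x + (2 * x + 2 * x) ≡ 8 * x
      lem′ = solve-∀

    weights : ∀ {z} → z ∈ V → ∑ (nb z) w ≤ Δ + Q * β z
    weights {z} z∈ = begin
      ∑ (nb z) w ≤⟨ ∑-mono (nb z) (λ {c} _ → weight≤ τ c) ⟩
      ∑ (nb z) (λ c → 1 + (χ (c == b) * Q + χ (c == b′) * Q)) ≡⟨ trans (∑-+ (nb z) _ _) (cong₂ _+_ (sym (length≡∑ (nb z))) (trans (∑-+ (nb z) _ _) (cong₂ _+_ (∑-*ʳ (nb z) _ Q) (∑-*ʳ (nb z) _ Q)))) ⟩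
      length (nb z) + (# (nb z) (_== b) * Q + # (nb z) (_== b′) * Q) ≤⟨ +-mono-≤ (nb-length z∈) (+-mono-≤ (*-monoˡ-≤ Q (at-most z b)) (*-monoˡ-≤ Q (at-most z b′))) ⟩
      Δ + (χ (E b z) * Q + χ (E b′ z) * Q) ≡⟨ cong (Δ +_) (lem (χ (E b z)) (χ (E b′ z)) Q) ⟩
      Δ + Q * β z ∎
      where lem : ∀ a c q → a * q + c * q ≡ q * (a + c)
            lem = solve-∀

    near-bound : ℕ
    near-bound = 4 * Δ * (Δ * (Δ * Δ)) + (Δ * Q * (10 * (g * Δ)) + (Q * (Δ * Δ) * (8 * g) + Q * Q * (8 * (g * Δ))))

    near-walks : ∑ V (λ z → χ (near τ z) * ∑ (nb z) (λ z′ → (Δ + Q * β z) * (Δ + Q * β z′))) ≤ near-bound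
    near-walks = begin
      ∑ V (λ z → χ (near τ z) * ∑ (nb z) (λ z′ → (Δ + Q * β z) * (Δ + Q * β z′))) ≤⟨ ∑-mono V (λ z∈ → each z∈) ⟩
      ∑ V (λ z → χ (near τ z) * (Δ * (Δ * Δ)) + (Δ * Q * (χ (near τ z) * G z) + (Q * (Δ * Δ) * (χ (near τ z) * β z) + Q * Q * (β z * G z))))
        ≡⟨ trans (∑-+ V _ _) (cong₂ _+_ (∑-*ʳ V _ (Δ * (Δ * Δ))) (trans (∑-+ V _ _) (cong₂ _+_ (∑-*ˡ V (Δ * Q) _)
             (trans (∑-+ V _ _) (cong₂ _+_ (∑-*ˡ V (Q * (Δ * Δ)) _) (∑-*ˡ V (Q * Q) _)))))) ⟩
      # V (near τ) * (Δ * (Δ * Δ)) + (Δ * Q * ∑ V (λ z → χ (near τ z) * G z) + (Q * (Δ * Δ) * ∑ V (λ z → χ (near τ z) * β z) + Q * Q * ∑ V (λ z → β z * G z)))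
        ≤⟨ +-mono-≤ (*-monoˡ-≤ (Δ * (Δ * Δ)) near-count) (+-mono-≤ (*-monoʳ-≤ (Δ * Q) near-G) (+-mono-≤ (*-monoʳ-≤ (Q * (Δ * Δ)) near-β) (*-monoʳ-≤ (Q * Q) β-G))) ⟩
      near-bound ∎
      where
      lem : ∀ x d q a c → x * ((d + q * a) * (d * d + q * c)) ≡ x * (d * (d * d)) + (d * q * (x * c) + (q * (d * d) * (x * a) + q * q * (x * (a * c))))
      lem = solve-∀
      each : ∀ {z} → z ∈ V → χ (near τ z) * ∑ (nb z) (λ z′ → (Δ + Q * β z) * (Δ + Q * β z′)) ≤
             χ (near τ z) * (Δ * (Δ * Δ)) + (Δ * Q * (χ (near τ z) * G z) + (Q * (Δ * Δ) * (χ (near τ z) * β z) + Q * Q * (β z * G z)))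
      each {z} z∈ = begin
        χ (near τ z) * ∑ (nb z) (λ z′ → (Δ + Q * β z) * (Δ + Q * β z′)) ≡⟨ cong (χ (near τ z) *_) (trans (∑-*ˡ (nb z) (Δ + Q * β z) _)
            (cong ((Δ + Q * β z) *_) (trans (∑-+ (nb z) _ _) (cong₂ _+_ (∑-const (nb z) Δ) (∑-*ˡ (nb z) Q β))))) ⟩
        χ (near τ z) * ((Δ + Q * β z) * (length (nb z) * Δ + Q * G z)) ≤⟨ *-monoʳ-≤ (χ (near τ z)) (*-monoʳ-≤ (Δ + Q * β z) (+-monoˡ-≤ (Q * G z) (*-monoˡ-≤ Δ (nb-length z∈)))) ⟩
        χ (near τ z) * ((Δ + Q * β z) * (Δ * Δ + Q * G z)) ≡⟨ lem (χ (near τ z)) Δ Q (β z) (G z) ⟩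
        χ (near τ z) * (Δ * (Δ * Δ)) + (Δ * Q * (χ (near τ z) * G z) + (Q * (Δ * Δ) * (χ (near τ z) * β z) + Q * Q * (χ (near τ z) * (β z * G z))))
          ≤⟨ +-monoʳ-≤ (χ (near τ z) * (Δ * (Δ * Δ))) (+-monoʳ-≤ (Δ * Q * (χ (near τ z) * G z)) (+-monoʳ-≤ (Q * (Δ * Δ) * (χ (near τ z) * β z)) (*-monoʳ-≤ (Q * Q) (χ*≤ (near τ z) _)))) ⟩
        χ (near τ z) * (Δ * (Δ * Δ)) + (Δ * Q * (χ (near τ z) * G z) + (Q * (Δ * Δ) * (χ (near τ z) * β z) + Q * Q * (β z * G z))) ∎

    product-weights : ∀ {z z′} → z ∈ V → z′ ∈ V → ∑ (nb z) (λ c → ∑ (nb z′) (λ c′ → w c * w c′)) ≤ (Δ + Q * β z) * (Δ + Q * β z′)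
    product-weights {z} {z′} z∈ z′∈ = ≤-trans
      (≤-reflexive (trans (∑-cong (nb z) λ {c} _ → ∑-*ˡ (nb z′) (w c) w) (∑-*ʳ (nb z) w (∑ (nb z′) w))))
      (*-mono-≤ (weights z∈) (weights z′∈))

    nb⊆ : ∀ {z z′} → z′ ∈ nb z → z′ ∈ V
    nb⊆ {z} h = proj₁ (∈-sel⁻ (E z) V h)

    left-walks : walks (λ z z′ c c′ → χ (near τ z) * (w c * w c′)) ≤ near-bound
    left-walks = ≤-trans (∑-mono V λ {z} z∈ → begin
      ∑ (nb z) (λ z′ → ∑ (nb z) λ c → ∑ (nb z′) λ c′ → χ (near τ z) * (w c * w c′))
        ≡⟨ trans (∑-cong (nb z) λ {z′} _ → trans (∑-cong (nb z) λ _ → ∑-*ˡ (nb z′) (χ (near τ z)) _) (∑-*ˡ (nb z) (χ (near τ z)) _)) (∑-*ˡ (nb z) (χ (near τ z)) _) ⟩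
      χ (near τ z) * ∑ (nb z) (λ z′ → ∑ (nb z) λ c → ∑ (nb z′) λ c′ → w c * w c′)
        ≤⟨ *-monoʳ-≤ (χ (near τ z)) (∑-mono (nb z) λ z′∈ → product-weights z∈ (nb⊆ z′∈)) ⟩
      χ (near τ z) * ∑ (nb z) (λ z′ → (Δ + Q * β z) * (Δ + Q * β z′)) ∎) near-walks

    right-walks : walks (λ z z′ c c′ → χ (near τ z′) * (w c * w c′)) ≤ near-bound
    right-walks = begin
      walks (λ z z′ c c′ → χ (near τ z′) * (w c * w c′)) ≤⟨ ∑-mono V (λ {z} z∈ → ∑-mono (nb z) λ {z′} z′∈ →
         ≤-trans (≤-reflexive (trans (∑-cong (nb z) λ _ → ∑-*ˡ (nb z′) (χ (near τ z′)) _) (∑-*ˡ (nb z) (χ (near τ z′)) _)))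
           (*-monoʳ-≤ (χ (near τ z′)) (product-weights z∈ (nb⊆ z′∈)))) ⟩
      ∑ V (λ z → ∑ (nb z) λ z′ → f z z′) ≡⟨ ∑-cong V (λ {z} _ → ∑-sel (E z) V _) ⟩
      ∑ V (λ z → ∑ V λ z′ → χ (E z z′) * f z z′) ≡⟨ ∑-swap V V _ ⟩
      ∑ V (λ z′ → ∑ V λ z → χ (E z z′) * f z z′) ≡⟨ ∑-cong V (λ {z′} _ → trans (∑-cong V λ {z} _ → cong₂ _*_ (cong χ (E-sym z z′))
          (cong (χ (near τ z′) *_) (*-comm (Δ + Q * β z) (Δ + Q * β z′)))) (trans (sym (∑-sel (E z′) V _)) (∑-*ˡ (nb z′) (χ (near τ z′)) _))) ⟩
      ∑ V (λ z′ → χ (near τ z′) * ∑ (nb z′) (λ z → (Δ + Q * β z′) * (Δ + Q * β z))) ≤⟨ near-walks ⟩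
      near-bound ∎
      where
      f : Fin n → Fin n → ℕ
      f z z′ = χ (near τ z′) * ((Δ + Q * β z) * (Δ + Q * β z′))

    pair-walks : ∀ {x x′} → x ∈ V → x′ ∈ V → walks (λ z z′ c c′ → χ (c == x ∧ c′ == x′) * (w c * w c′)) ≤ 2 * (g * Δ) * (Q * Q)
    pair-walks {x} {x′} x∈ x′∈ = begin
      walks (λ z z′ c c′ → χ (c == x ∧ c′ == x′) * (w c * w c′)) ≤⟨ ∑-mono V (λ {z} z∈ → begin
        ∑ (nb z) (λ z′ → ∑ (nb z) λ c → ∑ (nb z′) λ c′ → χ (c == x ∧ c′ == x′) * (w c * w c′)) ≤⟨ ∑-mono (nb z) (λ {z′} _ → begin
          ∑ (nb z) (λ c → ∑ (nb z′) λ c′ → χ (c == x ∧ c′ == x′) * (w c * w c′)) ≤⟨ ∑-mono (nb z) (λ {c} _ → ∑-mono (nb z′) λ {c′} _ →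
             *-mono-≤ (≤-reflexive (χ-∧ (c == x) (c′ == x′))) (*-mono-≤ (weight≤Q 0<Q τ c) (weight≤Q 0<Q τ c′))) ⟩
          ∑ (nb z) (λ c → ∑ (nb z′) λ c′ → χ (c == x) * χ (c′ == x′) * (Q * Q)) ≡⟨ trans (∑-cong (nb z) λ {c} _ → trans (∑-*ʳ (nb z′) _ (Q * Q)) (cong (_* (Q * Q)) (∑-*ˡ (nb z′) (χ (c == x)) _)))
               (trans (∑-*ʳ (nb z) _ (Q * Q)) (cong (_* (Q * Q)) (∑-*ʳ (nb z) _ _))) ⟩
          # (nb z) (_== x) * # (nb z′) (_== x′) * (Q * Q) ≤⟨ *-monoˡ-≤ (Q * Q) (*-mono-≤ (at-most z x) (at-most z′ x′)) ⟩
          χ (E x z) * χ (E x′ z′) * (Q * Q) ∎) ⟩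
        ∑ (nb z) (λ z′ → χ (E x z) * χ (E x′ z′) * (Q * Q)) ≡⟨ trans (∑-*ʳ (nb z) _ (Q * Q)) (cong (_* (Q * Q)) (∑-*ˡ (nb z) (χ (E x z)) _)) ⟩
        χ (E x z) * # (nb z) (E x′) * (Q * Q) ∎) ⟩
      ∑ V (λ z → χ (E x z) * # (nb z) (E x′) * (Q * Q)) ≡⟨ ∑-*ʳ V _ (Q * Q) ⟩
      ∑ V (λ z → χ (E x z) * # (nb z) (E x′)) * (Q * Q) ≤⟨ *-monoˡ-≤ (Q * Q) (close x∈ x′∈) ⟩
      2 * (g * Δ) * (Q * Q) ∎

    total : 4 * (near-bound + near-bound + (2 * (g * Δ) * (Q * Q) + 2 * (g * Δ) * (Q * Q))) ≤ k * (Q * Q)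
    total = begin
      4 * (near-bound + near-bound + (2 * (g * Δ) * (Q * Q) + 2 * (g * Δ) * (Q * Q))) ≡⟨ lem g Δ Q ⟩
      32 * (Δ * Δ * (Δ * Δ)) + (144 * (g * Δ * Δ * Q) + 80 * (g * Δ * (Q * Q)))
        ≤⟨ +-mono-≤ (≤-reflexive (cong (32 *_) e₁)) (+-mono-≤ (*-monoʳ-≤ 144 e₂) (*-monoʳ-≤ 80 e₃)) ⟩
      32 * (D * D * (Q * Q)) + (144 * (D * D * (Q * Q)) + 80 * (D * D * (Q * Q))) ≡⟨ lem′ (D * D) (Q * Q) ⟩
      k * (Q * Q) ∎
      where
      lem : ∀ g d q → 4 * ((4 * d * (d * (d * d)) + (d * q * (10 * (g * d)) + (q * (d * d) * (8 * g) + q * q * (8 * (g * d)))))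
                         + (4 * d * (d * (d * d)) + (d * q * (10 * (g * d)) + (q * (d * d) * (8 * g) + q * q * (8 * (g * d)))))
                         + (2 * (g * d) * (q * q) + 2 * (g * d) * (q * q)))
                       ≡ 32 * (d * d * (d * d)) + (144 * (g * d * d * q) + 80 * (g * d * (q * q)))
      lem = solve-∀
      lem′ : ∀ a q → 32 * (a * q) + (144 * (a * q) + 80 * (a * q)) ≡ 256 * a * q
      lem′ = solve-∀
      lem₁ : ∀ p d e → p * e * (p * e) * (d * d) ≡ e * e * (p * d * (p * d))
      lem₁ = solve-∀
      e₁ : Δ * Δ * (Δ * Δ) ≡ D * D * (Q * Q)
      e₁ = trans (cong (λ x → x * x * (Δ * Δ)) Δ≡) (lem₁ p Δ D)
      lem₂ : ∀ g p d e → g * (p * e) * d * (p * d) ≡ g * e * (p * d * (p * d))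
      lem₂ = solve-∀
      e₂ : g * Δ * Δ * Q ≤ D * D * (Q * Q)
      e₂ = ≤-trans (≤-reflexive (trans (cong (λ x → g * x * Δ * Q) Δ≡) (lem₂ g p Δ D))) (*-monoˡ-≤ (Q * Q) (*-monoˡ-≤ D g≤D))
      lem₃ : ∀ g p e q → g * (p * e) * q ≡ g * p * e * q
      lem₃ = solve-∀
      e₃ : g * Δ * (Q * Q) ≤ D * D * (Q * Q)
      e₃ = ≤-trans (≤-reflexive (trans (cong (λ x → g * x * (Q * Q)) Δ≡) (lem₃ g p D (Q * Q)))) (*-monoˡ-≤ (Q * Q) (*-monoˡ-≤ D gp≤D))

    con≤ : 4 * ∑ 𝒯 (λ τ′ → χ (con τ τ′) * (w (src τ′) * w (dst τ′))) ≤ k * (Q * Q)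
    con≤ = begin
      4 * ∑ 𝒯 (λ τ′ → χ (con τ τ′) * W τ′) ≤⟨ *-monoʳ-≤ 4 (∑-mono 𝒯 λ {τ′} _ → split (near τ (left τ′)) (near τ (right τ′)) (joins b b′ τ′) (joins b′ b τ′) (W τ′)) ⟩
      4 * ∑ 𝒯 (λ τ′ → (χ (near τ (left τ′)) * W τ′ + χ (near τ (right τ′)) * W τ′) + (χ (joins b b′ τ′) * W τ′ + χ (joins b′ b τ′) * W τ′))
        ≡⟨ cong (4 *_) (trans (∑-+ 𝒯 _ _) (cong₂ _+_ (∑-+ 𝒯 _ _) (∑-+ 𝒯 _ _))) ⟩
      4 * (∑ 𝒯 (λ τ′ → χ (near τ (left τ′)) * W τ′) + ∑ 𝒯 (λ τ′ → χ (near τ (right τ′)) * W τ′)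
           + (∑ 𝒯 (λ τ′ → χ (joins b b′ τ′) * W τ′) + ∑ 𝒯 (λ τ′ → χ (joins b′ b τ′) * W τ′)))
        ≤⟨ *-monoʳ-≤ 4 (+-mono-≤ (+-mono-≤ (≤-trans (𝒯≤walks λ z z′ c c′ → χ (near τ z) * (w c * w c′)) left-walks)
                                           (≤-trans (𝒯≤walks λ z z′ c c′ → χ (near τ z′) * (w c * w c′)) right-walks))
                                 (+-mono-≤ (≤-trans (𝒯≤walks λ z z′ c c′ → χ (c == b ∧ c′ == b′) * (w c * w c′)) (pair-walks src∈ dst∈))
                                           (≤-trans (𝒯≤walks λ z z′ c c′ → χ (c == b′ ∧ c′ == b) * (w c * w c′)) (pair-walks dst∈ src∈)))) ⟩
      4 * (near-bound + near-bound + (2 * (g * Δ) * (Q * Q) + 2 * (g * Δ) * (Q * Q))) ≤⟨ total ⟩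
      k * (Q * Q) ∎
      where
      W : Obj → ℕ
      W τ′ = w (src τ′) * w (dst τ′)
      split : ∀ p q r s x → χ ((p ∨ q) ∨ (r ∨ s)) * x ≤ (χ p * x + χ q * x) + (χ r * x + χ s * x)
      split true q r s x = ≤-trans (m≤m+n (1 * x) _) (m≤m+n _ _)
      split false true r s x = m≤m+n (1 * x) _
      split false false true s x = m≤m+n (1 * x) _
      split false false false true x = ≤-refl
      split false false false false x = z≤n

  many : 4 * (C * k) * (length V * Q) < length 𝒯
  many = begin-strict
    4 * (C * (256 * (D * D))) * (length V * (p * Δ)) ≡⟨ cong (λ x → 4 * (C * (256 * (D * D))) * (length V * (p * x))) Δ≡ ⟩
    4 * (C * (256 * (D * D))) * (length V * (p * (p * D))) ≡⟨ lem C K (p * g) (length V) p ⟩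
    1024 * (C * (2 * K * (2 * K) * (2 * K))) * (length V * (p * p * (p * g * (p * g) * (p * g))))
      <⟨ *-monoˡ-< _ {{>-nonZero (*-mono-≤ V≢[] (*-mono-≤ (*-mono-≤ 0<p 0<p) (*-mono-≤ (*-mono-≤ 0<pg 0<pg) 0<pg)))}} p-large ⟩
    p * (length V * (p * p * (p * g * (p * g) * (p * g)))) ≡⟨ lem′ (p * g) (length V) p ⟩
    length V * (ℓ * (ℓ * ℓ)) ≤⟨ 𝒯-length ⟩
    length 𝒯 ∎
    where
    0<pg : 0 < p * g
    0<pg = *-mono-≤ 0<p 0<g
    lem : ∀ c K x v p → 4 * (c * (256 * (K * (2 * x) * (K * (2 * x))))) * (v * (p * (p * (K * (2 * x))))) ≡ 1024 * (c * (2 * K * (2 * K) * (2 * K))) * (v * (p * p * (x * x * x)))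
    lem = solve-∀
    lem′ : ∀ x v p → p * (v * (p * p * (x * x * x))) ≡ v * (p * x * (p * x * (p * x)))
    lem′ = solve-∀

  0<k : 0 < k
  0<k = *-mono-≤ (s≤s (z≤n {255})) (*-mono-≤ (≤-trans 0<g g≤D) (≤-trans 0<g g≤D))

  abstract
    selection : Selected
    selection = selected 0<k 0<Q (λ h → Facts.src≢dst (facts h))
      killed≤ (λ τ → ∨-t₁ (∨-t₁ (∨-t₁ (∨-t₁ (==-refl (left τ)))))) Conflicts.con≤ many

  open Selected selection

  open Ends src dst I V S

  aliveW : ∀ {τ} → τ ∈ I → ∀ {x} → x ∈ W → killed τ x ≡ true → x ≡ src τ ⊎ x ≡ dst τ
  aliveW τ∈ x∈ = alive τ∈ (proj₁ (W⁻ x∈)) (proj₁ (proj₂ (W⁻ x∈)))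

  record Good (τ : Obj) : Set where
    field
      src≢dst : src τ ≢ dst τ
      left~right : E (left τ) (right τ) ≡ true
      left~src : E (left τ) (src τ) ≡ true
      right~dst : E (right τ) (dst τ) ≡ true
      left∉ : left τ ∉ W
      right∉ : right τ ∉ W
      left-only : ∀ {x} → x ∈ W → E (left τ) x ≡ true → x ≡ src τ
      right-only : ∀ {x} → x ∈ W → E (right τ) x ≡ true → x ≡ dst τ

  good : ∀ {τ} → τ ∈ I → Good τ
  good {τ@(y , y′ , b , b′)} τ∈ = record
    { src≢dst = src≢dst ; left~right = left~right ; left~src = left~src ; right~dst = right~dst
    ; left∉ = λ h → left-out (aliveW τ∈ h (∨-t₂ {E y y ∨ E y′ y} (∨-t₁ (trans (E-sym b y) left~src))))
    ; right∉ = λ h → right-out (aliveW τ∈ h (∨-t₂ {E y y′ ∨ E y′ y′} (∨-t₂ {E b y′} (trans (E-sym b′ y′) right~dst))))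
    ; left-only = λ x∈ h → left-only (aliveW τ∈ x∈ (∨-t₁ (∨-t₁ h))) h
    ; right-only = λ {x} x∈ h → right-only (aliveW τ∈ x∈ (∨-t₁ (∨-t₂ {E y x} h))) h }
    where
    open Facts (facts (I⊆ τ∈))
    left-out : y ≡ b ⊎ y ≡ b′ → ⊥
    left-out (inj₁ refl) = t≢f left~src (E-irr y)
    left-out (inj₂ q) = dst≢left (sym q)
    right-out : y′ ≡ b ⊎ y′ ≡ b′ → ⊥
    right-out (inj₁ q) = src≢right (sym q)
    right-out (inj₂ refl) = t≢f right~dst (E-irr y′)
    left-only : ∀ {x} → x ≡ b ⊎ x ≡ b′ → E y x ≡ true → x ≡ b
    left-only (inj₁ q) _ = q
    left-only (inj₂ refl) h = ⊥-elim (t≢f h left≁dst)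
    right-only : ∀ {x} → x ≡ b ⊎ x ≡ b′ → E y′ x ≡ true → x ≡ b′
    right-only (inj₁ refl) h = ⊥-elim (t≢f h right≁src)
    right-only (inj₂ q) _ = q

  rev : Obj → Obj
  rev (y , y′ , b , b′) = y′ , y , b′ , b

  good-rev : ∀ {τ} → τ ∈ I → Good (rev τ)
  good-rev {τ@(y , y′ , b , b′)} τ∈ = record
    { src≢dst = src≢dst ∘ sym ; left~right = trans (E-sym y′ y) left~right ; left~src = right~dst ; right~dst = left~src
    ; left∉ = right∉ ; right∉ = left∉ ; left-only = right-only ; right-only = left-only }
    where open Good (good τ∈)

  W-indep : ∀ {x y} → x ∈ W → y ∈ W → E x y ≡ false
  W-indep {x} {y} x∈ y∈ = ¬t⇒f λ h → go h (W⁻ x∈)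
    where
    go : E x y ≡ true → x ∈ V × lookup S x ≡ true × (∃ λ τ → τ ∈ I × (x ≡ src τ ⊎ x ≡ dst τ)) → ⊥
    go h (_ , _ , (z , z′ , b , b′) , τ∈ , inj₁ refl) with aliveW τ∈ y∈ (∨-t₂ {E z y ∨ E z′ y} (∨-t₁ h))
    ... | inj₁ refl = t≢f h (E-irr _)
    ... | inj₂ refl = t≢f h (Facts.src≁dst (facts (I⊆ τ∈)))
    go h (_ , _ , (z , z′ , b , b′) , τ∈ , inj₂ refl) with aliveW τ∈ y∈ (∨-t₂ {E z y ∨ E z′ y} (∨-t₂ {E b y} h))
    ... | inj₁ refl = t≢f h (trans (E-sym _ _) (Facts.src≁dst (facts (I⊆ τ∈))))
    ... | inj₂ refl = t≢f h (E-irr _)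

  inn : Obj → List (Fin n)
  inn τ = left τ ∷ right τ ∷ []

  swap-inn : ∀ {τ z} → z ∈ inn (rev τ) → z ∈ inn τ
  swap-inn (here q) = there (here q)
  swap-inn (there (here q)) = here q

  separate : ∀ {τ τ′} → τ ∈ I → τ′ ∈ I → Apart con τ τ′ → Separate E src dst inn τ τ′
  separate {τ@(y , y′ , b , b′)} {τ′@(z , z′ , c , c′)} τ∈ τ′∈ (q , _) = record
    { pair≢ = λ { (refl , refl) → t≢f (∨-t₁ (∧-t (==-refl b) (==-refl b′))) (∨-f₂ {near τ z ∨ near τ z′} q) }
    ; pair≢′ = λ { (refl , refl) → t≢f (∨-t₂ {joins b b′ τ′} (∧-t (==-refl b′) (==-refl b))) (∨-f₂ {near τ z ∨ near τ z′} q) }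
    ; inn≢ = λ { (here refl) h refl → t≢f (==-refl y) (∨-f₁ {y == y} (∨-f₁ {y == y ∨ y == y′} (far h)))
               ; (there (here refl)) h refl → t≢f (==-refl y′) (∨-f₂ {y′ == y} (∨-f₁ {y′ == y ∨ y′ == y′} (far h))) }
    ; inn≁ = λ { {z′ = x} (here refl) h → ∨-f₁ (∨-f₂ {x == y ∨ x == y′} (far h))
               ; {z′ = x} (there (here refl)) h → ∨-f₂ {E y x} (∨-f₂ {x == y ∨ x == y′} (far h)) } }
    where
    far : ∀ {x} → x ∈ inn τ′ → near τ x ≡ false
    far (here refl) = ∨-f₁ (∨-f₁ q)
    far (there (here refl)) = ∨-f₂ {near τ z} (∨-f₁ q)

  subdivision : SubdivisionIn E r t
  subdivision = Assemble.copy E E-sym r t src dst inn rev (λ _ → refl) (λ _ → refl) (λ {τ} → swap-inn {τ}) I W (sel-unique _ (sel-unique _ uV)) Good good good-rev Good.src≢dst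
    (λ h → src∈W h (Facts.src∈ (facts (I⊆ h))) (src∈ h)) (λ h → dst∈W h (Facts.dst∈ (facts (I⊆ h))) (dst∈ h))
    (λ {τ} G → trans (E-sym (src τ) (left τ)) (Good.left~src G) , Good.left~right G , Good.right~dst G , _)
    (λ G → ((λ q → t≢f (Good.left~right G) (trans (cong (E _) (sym q)) (E-irr _))) ∷ []) ∷ [] ∷ [])
    (λ { G (here refl) → Good.left∉ G ; G (there (here refl)) → Good.right∉ G })
    W-indep
    (λ { G (here refl) v∈ h → left-end (Good.left-only G v∈ h) ; G (there (here refl)) v∈ h → right-end (Good.right-only G v∈ h) })
    (λ { G (here refl) (here refl) h → ⊥-elim (t≢f h (E-irr _)) ; G (here refl) (there (here refl)) h → inj₁ (there here)
       ; G (there (here refl)) (here refl) h → inj₂ (there here) ; G (there (here refl)) (there (here refl)) h → ⊥-elim (t≢f h (E-irr _)) })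
    (λ {τ} → swap-inn {rev τ})
    (allPairs-map separate apart)
    (≤-<-trans (*-monoʳ-≤ C |W|≤) dense)
    where
    left-end : ∀ {τ x} → x ≡ src τ → Consecutive (src τ ∷ inn τ ++ [ dst τ ]) (left τ) x
    left-end refl = inj₂ here
    right-end : ∀ {τ x} → x ≡ dst τ → Consecutive (src τ ∷ inn τ ++ [ dst τ ]) (right τ) x
    right-end refl = inj₁ (there (there here))

-- Graphs and polynomials

∑-tabulate : ∀ {A : Set} {n} (h : Fin n → A) (f : A → ℕ) → ∑ (L.tabulate h) f ≡ Vec.sum (Vec.tabulate (f ∘ h))
∑-tabulate {n = zero} h f = refl
∑-tabulate {n = suc n} h f = cong (f (h zero) +_) (∑-tabulate (h ∘ suc) f)

∣tabulate∣ : ∀ {n} (f : Fin n → Bool) → Ss.∣ Vec.tabulate f ∣ ≡ Vec.sum (Vec.tabulate (χ ∘ f))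
∣tabulate∣ {zero} f = refl
∣tabulate∣ {suc n} f with f zero
... | true = cong suc (∣tabulate∣ (f ∘ suc))
... | false = ∣tabulate∣ (f ∘ suc)

#-allFin : ∀ {n} (f : Fin n → Bool) → # (allFin n) f ≡ Ss.∣ Vec.tabulate f ∣
#-allFin f = trans (∑-tabulate (λ i → i) (χ ∘ f)) (sym (∣tabulate∣ f))

degreeSum≡ : (G : Graph) → degreeSum G ≡ ∑ (allFin (Graph.n G)) (λ v → # (allFin (Graph.n G)) (Graph.adj G v))
degreeSum≡ G = trans (sym (∑-tabulate (λ i → i) (degree G))) (∑-cong (allFin (Graph.n G)) λ {v} _ → sym (#-allFin (Graph.adj G v)))

^-distribʳ-* : ∀ k a b → (a * b) ^ k ≡ a ^ k * b ^ k
^-distribʳ-* zero a b = refl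
^-distribʳ-* (suc k) a b = trans (cong (a * b *_) (^-distribʳ-* k a b)) (lem a b (a ^ k) (b ^ k))
  where lem : ∀ a b c d → a * b * (c * d) ≡ a * c * (b * d)
        lem = solve-∀

shift : Poly → Poly
shift [] = []
shift (c ∷ cs) = 2 * c ∷ carry (shift cs)
  where carry : Poly → Poly
        carry [] = c ∷ []
        carry (d ∷ ds) = (c + d) ∷ ds

eval-shift : ∀ g x → eval (shift g) x ≡ (2 + x) * eval g x
eval-shift [] x = sym (*-zeroʳ (2 + x))
eval-shift (c ∷ cs) x with shift cs | eval-shift cs x
... | [] | q = trans (lem c x) (trans (cong (λ y → 2 * c + x * (c + y)) q) (lem′ c x (eval cs x)))
  where lem : ∀ c x → 2 * c + x * (c + x * 0) ≡ 2 * c + x * (c + 0)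
        lem = solve-∀
        lem′ : ∀ c x e → 2 * c + x * (c + (2 + x) * e) ≡ (2 + x) * (c + x * e)
        lem′ = solve-∀
... | d ∷ ds | q = trans (cong (λ y → 2 * c + x * y) (+-assoc c d _)) (trans (cong (λ y → 2 * c + x * (c + y)) q) (lem′ c x (eval cs x)))
  where lem′ : ∀ c x e → 2 * c + x * (c + (2 + x) * e) ≡ (2 + x) * (c + x * e)
        lem′ = solve-∀

shifted : ℕ → ℕ → Poly
shifted c zero = c ∷ []
shifted c (suc k) = shift (shifted c k)

eval-shifted : ∀ c k x → eval (shifted c k) x ≡ (2 + x) ^ k * c
eval-shifted c zero x = trans (cong (c +_) (*-zeroʳ x)) (trans (+-identityʳ c) (sym (*-identityˡ c)))
eval-shifted c (suc k) x = trans (eval-shift (shifted c k) x)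
  (trans (cong ((2 + x) *_) (eval-shifted c k x)) (sym (*-assoc (2 + x) ((2 + x) ^ k) c)))

module InGraph (G : Graph) where
  private
    N = Graph.n G
    E = Graph.adj G
    E-sym = Graph.sym G
    E-irr = Graph.loopless G
  open Sparse E E-sym

  clique-unique : ∀ K → clique K ≡ true → Unique K
  clique-unique [] c = []
  clique-unique (x ∷ K) c =
    All.tabulate (λ { y∈ refl → t≢f (every⁻ (E x) (∧-t₁ c) y∈) (E-irr x) }) ∷ clique-unique K (∧-t₂ {every (E x) K} c)

  clique⁻ : ∀ K → clique K ≡ true → ∀ {x y} → x ∈ K → y ∈ K → x ≢ y → E x y ≡ true
  clique⁻ (z ∷ K) c (here refl) (here refl) ne = ⊥-elim (ne refl)
  clique⁻ (z ∷ K) c (here refl) (there y∈) ne = every⁻ (E z) (∧-t₁ c) y∈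
  clique⁻ (z ∷ K) c {x} (there x∈) (here refl) ne = trans (E-sym x z) (every⁻ (E z) (∧-t₁ c) x∈)
  clique⁻ (z ∷ K) c (there x∈) (there y∈) ne = clique⁻ K (∧-t₂ {every (E z) K} c) x∈ y∈ ne

  no-clique : ∀ {w} → IsCliqueNumber G w → ∀ K → clique K ≡ true → length K ≡ suc w → ⊥
  no-clique {w} (_ , max) K c l = <⇒≱ (begin-strict
    w <⟨ ≤-reflexive (sym l) ⟩
    length K ≤⟨ length-⊆ (clique-unique K c) (sel-unique mem (Uᵖ.allFin⁺ N)) (λ {x} x∈ → ∈-sel⁺ mem (allFin N) (∈-allFin x) (some⁺ (_== x) x∈ (==-refl x))) ⟩
    length (sel mem (allFin N)) ≡⟨ trans (length-sel mem (allFin N)) (#-allFin mem) ⟩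
    Ss.∣ Vec.tabulate mem ∣ ∎) (max (Vec.tabulate mem) λ i j i∈ j∈ ne → clique⁻ K c (mem⁻ i∈) (mem⁻ j∈) ne)
    where
    open ≤-Reasoning
    open import Data.Vec.Properties using ([]=⇒lookup; lookup∘tabulate)
    mem : Fin N → Bool
    mem i = some (_== i) K
    mem⁻ : ∀ {i} → i Ss.∈ Vec.tabulate mem → i ∈ K
    mem⁻ {i} h with some⁻ (_== i) K (trans (sym (lookup∘tabulate mem i)) ([]=⇒lookup h))
    ... | x , x∈ , q = subst (_∈ K) (==⇒≡ q) x∈

  indep⁻ : ∀ I → indep I ≡ true → ∀ {x y} → x ∈ I → y ∈ I → E x y ≡ false
  indep⁻ (z ∷ I) c (here refl) (here refl) = E-irr z
  indep⁻ (z ∷ I) c (here refl) (there y∈) = not-f (∧-t₁ (every⁻ _ (∧-t₁ c) y∈))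
  indep⁻ (z ∷ I) c {x} (there x∈) (here refl) = trans (E-sym x z) (not-f (∧-t₁ (every⁻ _ (∧-t₁ c) x∈)))
  indep⁻ (z ∷ I) c (there x∈) (there y∈) = indep⁻ I (∧-t₂ {every _ I} c) x∈ y∈

  indep-unique : ∀ I → indep I ≡ true → Unique I
  indep-unique [] c = []
  indep-unique (x ∷ I) c = All.tabulate (λ {y} y∈ → ==-f (not-f (∧-t₂ {not (E x y)} (every⁻ _ (∧-t₁ c) y∈)))) ∷
    indep-unique I (∧-t₂ {every _ I} c)

  biclique-copy : ∀ I J → indep I ≡ true → indep J ≡ true → (∀ {x y} → x ∈ I → y ∈ J → E x y ≡ true) →
                  HasInducedSubdivision (length I) (length J) G
  biclique-copy I J iI iJ all = (λ _ _ → 0) , f , f-inj , (λ { x y (inj₁ s) → step s ; x y (inj₂ s) → trans (E-sym (f x) (f y)) (step s) }) , back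
    where
    f : SubdivV (length I) (length J) (λ _ _ → 0) → Fin N
    f (inj₁ i) = L.lookup I i
    f (inj₂ (inj₁ j)) = L.lookup J j
    f (inj₂ (inj₂ (_ , ())))
    apart : ∀ {i j} → L.lookup I i ≢ L.lookup J j
    apart {i} {j} q = t≢f (all (∈-lookup i) (∈-lookup j)) (trans (cong (E (L.lookup I i)) (sym q)) (E-irr _))
    f-inj : Injective _≡_ _≡_ f
    f-inj {inj₁ i} {inj₁ j} q = cong inj₁ (lookup-injective (indep-unique I iI) q)
    f-inj {inj₁ i} {inj₂ (inj₁ j)} q = ⊥-elim (apart q)
    f-inj {inj₂ (inj₁ i)} {inj₁ j} q = ⊥-elim (apart (sym q))
    f-inj {inj₂ (inj₁ i)} {inj₂ (inj₁ j)} q = cong (inj₂ ∘ inj₁) (lookup-injective (indep-unique J iJ) q)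
    f-inj {_} {inj₂ (inj₂ (_ , ()))}
    f-inj {inj₂ (inj₂ (_ , ()))}
    step : ∀ {x y} → Step (λ _ _ → 0) x y → E (f x) (f y) ≡ true
    step (i , j , zero , refl , refl) = all (∈-lookup i) (∈-lookup j)
    back : ∀ x y → E (f x) (f y) ≡ true → SubdivAdj (λ _ _ → 0) x y
    back (inj₁ i) (inj₁ j) h = ⊥-elim (t≢f h (indep⁻ I iI (∈-lookup i) (∈-lookup j)))
    back (inj₁ i) (inj₂ (inj₁ j)) h = inj₁ (i , j , zero , refl , refl)
    back (inj₂ (inj₁ j)) (inj₁ i) h = inj₂ (i , j , zero , refl , refl)
    back (inj₂ (inj₁ i)) (inj₂ (inj₁ j)) h = ⊥-elim (t≢f h (indep⁻ J iJ (∈-lookup i) (∈-lookup j)))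
    back _ (inj₂ (inj₂ (_ , ())))
    back (inj₂ (inj₂ (_ , ())))

module Bound (r t : ℕ) (1≤r : 1 ≤ r) (K₁ p : ℕ) (4<K₁ : 4 < K₁) (16≤p : 16 ≤ p)
  (K₁-large : 4 * (minorBound r t * (692 * 720)) < K₁)
  (p-large : 1024 * (minorBound r t * (2 * (36 * K₁) * (2 * (36 * K₁)) * (2 * (36 * K₁)))) < p) where

  h Λ s : ℕ
  h = r + t
  Λ = 36 * K₁ * (2 * (p * p))
  s = 9 * (2 * (p * p))

  poly : Poly
  poly = shifted (4 * s * (2 * Λ) ^ h) (h + h * h)

  0<h : 0 < h
  0<h = ≤-trans 1≤r (m≤m+n r t)

  0<p : 0 < p
  0<p = ≤-trans (s≤s z≤n) 16≤p

  0<K : 0 < 36 * K₁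
  0<K = *-mono-≤ (s≤s (z≤n {35})) (≤-trans (s≤s z≤n) 4<K₁)

  0<pp : 0 < 2 * (p * p)
  0<pp = *-mono-≤ (s≤s (z≤n {1})) (*-mono-≤ 0<p 0<p)

  0<Λ : 0 < Λ
  0<Λ = *-mono-≤ 0<K 0<pp

  module _ (G : Graph) (w : ℕ) (ω : IsCliqueNumber G w) (free : ¬ HasInducedSubdivision r t G) where
    open InGraph G
    open ≤-Reasoning

    N : ℕ
    N = Graph.n G

    V : List (Fin N)
    V = allFin N

    E : Fin N → Fin N → Bool
    E = Graph.adj G

    E-sym : ∀ x y → E x y ≡ E y x
    E-sym = Graph.sym G

    E-irr : ∀ x → E x x ≡ false
    E-irr = Graph.loopless G

    ρ g₀ : ℕ
    ρ = suc (suc w) ^ h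
    g₀ = 2 * ρ * (2 * Λ * ρ) ^ h

    eval-poly : 2 * (s * g₀) ≡ eval poly w
    eval-poly = begin-equality
      2 * (s * (2 * ρ * (2 * Λ * ρ) ^ h)) ≡⟨ cong (λ x → 2 * (s * (2 * ρ * x))) (^-distribʳ-* h (2 * Λ) ρ) ⟩
      2 * (s * (2 * ρ * ((2 * Λ) ^ h * ρ ^ h))) ≡⟨ lem s ρ ((2 * Λ) ^ h) (ρ ^ h) ⟩
      ρ * ρ ^ h * (4 * s * (2 * Λ) ^ h) ≡⟨ cong (_* (4 * s * (2 * Λ) ^ h)) (cong (ρ *_) (^-*-assoc (suc (suc w)) h h)) ⟩
      (2 + w) ^ h * (2 + w) ^ (h * h) * (4 * s * (2 * Λ) ^ h) ≡⟨ cong (_* (4 * s * (2 * Λ) ^ h)) (^-distribˡ-+-* (2 + w) h (h * h)) ⟨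
      (2 + w) ^ (h + h * h) * (4 * s * (2 * Λ) ^ h) ≡⟨ eval-shifted (4 * s * (2 * Λ) ^ h) (h + h * h) w ⟨
      eval poly w ∎
      where lem : ∀ s r a b → 2 * (s * (2 * r * (a * b))) ≡ r * b * (4 * s * a)
            lem = solve-∀

    0<ρ : 0 < ρ
    0<ρ = m^n>0 (suc (suc w)) h

    0<g₀ : 0 < g₀
    0<g₀ = *-mono-≤ (*-mono-≤ (s≤s (z≤n {1})) 0<ρ) (m^n>0 (2 * Λ * ρ) {{>-nonZero (*-mono-≤ (*-mono-≤ (s≤s (z≤n {1})) 0<Λ) 0<ρ)}} h)

    no-biclique : ∀ I J → Sparse.indep E E-sym I ≡ true → Sparse.indep E E-sym J ≡ true → length I ≡ r → length J ≡ t →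
                  (∀ {x y} → x ∈ I → y ∈ J → E x y ≡ true) → ⊥
    no-biclique I J iI iJ refl refl all = free (biclique-copy I J iI iJ all)

    few : ∀ g X Y → g₀ ≤ g → Unique X → Unique Y → length X ≤ Λ * g → # Y (λ y → g ≤ᵇ # X (E y)) ≤ g
    few g X Y g₀≤ uX uY le = Sparse.few E E-sym r t w (no-clique ω) no-biclique Λ g X Y uX uY 0<Λ 0<h le g₀≤

    no-core : Core E (λ _ → s * g₀) V → ⊥
    no-core core₀ with maxCore E E-sym s (*-mono-≤ (s≤s (z≤n {8})) 0<pp) N g₀ (≤-trans (≤-reflexive refl) (+-monoˡ-≤ N 0<g₀)) core₀
    ... | g , g₀≤g , core , o = split (Dichotomy.dichotomy E E-sym m g K₁ 0<m g≤m 4<K₁ T uT T≢[] deg≥ deg-sum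
          (λ X uX le → few g X T g₀≤g uX uT (≤-trans le (≤-trans (*-monoˡ-≤ m 144≤K) Km≤))))
      where
      T = Core.verts core
      uT = Core.unique core
      T≢[] = Core.nonempty core
      m : ℕ
      m = 2 * (p * (p * g))
      0<g : 0 < g
      0<g = ≤-trans 0<g₀ g₀≤g
      0<m : 0 < m
      0<m = *-mono-≤ (s≤s (z≤n {1})) (*-mono-≤ 0<p (*-mono-≤ 0<p 0<g))
      m-eq : ∀ c p g → c * (2 * (p * p)) * g ≡ c * (2 * (p * (p * g)))
      m-eq = solve-∀
      g≤m : g ≤ m
      g≤m = ≤-trans (m≤n*m g (2 * (p * p)) {{>-nonZero 0<pp}}) (≤-reflexive (lem p g))
        where lem : ∀ p g → 2 * (p * p) * g ≡ 2 * (p * (p * g))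
              lem = solve-∀
      144≤K : 144 ≤ 36 * K₁
      144≤K = *-monoʳ-≤ 36 {4} {K₁} (<⇒≤ 4<K₁)
      K₁≤K : K₁ ≤ 36 * K₁
      K₁≤K = m≤n*m K₁ 36
      Km≤ : 36 * K₁ * m ≤ Λ * g
      Km≤ = ≤-reflexive (sym (m-eq (36 * K₁) p g))
      deg≥ : ∀ {v} → v ∈ T → 9 * m ≤ # T (E v)
      deg≥ v∈ = ≤-trans (≤-reflexive (sym (m-eq 9 p g))) (Core.degrees core v∈)
      out = Orientation.out o
      out≤V : ∀ v → # V (out v) ≤ 18 * m
      out≤V v = begin
        # V (out v) ≤⟨ <⇒≤ (Orientation.out< o (∈-allFin v)) ⟩
        s * suc g ≤⟨ *-monoʳ-≤ s (+-monoˡ-≤ g 0<g) ⟩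
        s * (g + g) ≡⟨ lem p g ⟩
        18 * m ∎
        where lem : ∀ p g → 9 * (2 * (p * p)) * (g + g) ≡ 18 * (2 * (p * (p * g)))
              lem = solve-∀
      out≤ : ∀ {v} → v ∈ T → # T (out v) ≤ 18 * m
      out≤ {v} _ = ≤-trans (#-sub (out v) uT (Uᵖ.allFin⁺ N) (λ _ → ∈-allFin _)) (out≤V v)
      deg-sum : ∑ T (λ v → # T (E v)) ≤ 36 * m * length T
      deg-sum = begin
        ∑ T (λ v → # T (E v)) ≤⟨ orientation-sum o T T (λ _ → ∈-allFin _) (λ _ → ∈-allFin _) ⟩
        ∑ T (λ v → # T (out v)) + ∑ T (λ v → # T (out v)) ≤⟨ +-mono-≤ (∑≤ T (18 * m) out≤) (∑≤ T (18 * m) out≤) ⟩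
        length T * (18 * m) + length T * (18 * m) ≡⟨ lem m (length T) ⟩
        36 * m * length T ∎
        where lem : ∀ m l → l * (18 * m) + l * (18 * m) ≡ 36 * m * l
              lem = solve-∀
      split : Unbalanced E m g K₁ T ⊎ Regular E m K₁ T → ⊥
      split (inj₁ U) = free (UnbalancedCase.subdivision E E-sym E-irr r t m g K₁ 0<m g≤m T uT out out≤
        (λ _ _ → Orientation.covers o (∈-allFin _) (∈-allFin _))
        (λ X uX le → few g X T g₀≤g uX uT (≤-trans le (≤-trans (*-monoˡ-≤ m K₁≤K) Km≤))) K₁-large U)
      split (inj₂ R) = free (RegularCase.subdivision E E-sym E-irr r t g p (36 * K₁) 0<g 0<K 16≤p p-large m refl
        V′ uV V≢[] V-deg≥ V-deg≤ (λ X uX le → few g X V′ g₀≤g uX uV (≤-trans le Km≤)))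
        where open Regular R renaming (V to V′)

    bounded : degreeSum G ≤ eval poly w * N
    bounded with peel E E-sym (λ _ → s * g₀) (length V) V ≤-refl (Uᵖ.allFin⁺ N)
    ... | inj₁ core = ⊥-elim (no-core core)
    ... | inj₂ o = begin
      degreeSum G ≡⟨ degreeSum≡ G ⟩
      ∑ V (λ v → # V (E v)) ≤⟨ orientation-sum o V V (λ x∈ → x∈) (λ x∈ → x∈) ⟩
      ∑ V (λ v → # V (out v)) + ∑ V (λ v → # V (out v)) ≤⟨ +-mono-≤ half half ⟩
      length V * (s * g₀) + length V * (s * g₀) ≡⟨ lem (s * g₀) (length V) ⟩
      2 * (s * g₀) * length V ≡⟨ cong₂ _*_ eval-poly (length-tabulate {n = N} (λ i → i)) ⟩
      eval poly w * N ∎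
      where
      open import Data.List.Properties using (length-tabulate)
      out = Orientation.out o
      half : ∑ V (λ v → # V (out v)) ≤ length V * (s * g₀)
      half = ∑≤ V (s * g₀) λ v∈ → <⇒≤ (Orientation.out< o v∈)
      lem : ∀ a l → l * a + l * a ≡ 2 * a * l
      lem = solve-∀

open import Defs using (n)

theorem4p4 : (r t : ℕ) → 1 ≤ r → 1 ≤ t →
    Σ Poly (λ g → (G : Graph) (w : ℕ) → IsCliqueNumber G w →
    ¬ HasInducedSubdivision r t G →
    degreeSum G ≤ eval g w * n G)
theorem4p4 r t 1≤r 1≤t = poly , bounded
  where
  K₁-bound p-bound : ℕ
  K₁-bound = 4 * (minorBound r t * (692 * 720))
  p-bound = 1024 * (minorBound r t * (2 * (36 * (5 + K₁-bound)) * (2 * (36 * (5 + K₁-bound))) * (2 * (36 * (5 + K₁-bound)))))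
  open Bound r t 1≤r (5 + K₁-bound) (16 + p-bound) (m≤m+n 5 _) (m≤m+n 16 _) (m≤n+m _ 4) (m≤n+m _ 15)
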